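{- Let $p>3$ be a prime, $x\in\mathbb Z_p$ with $2x+1\not\equiv0\pmod p$, and $x'=(x-\langle x\rangle_p)/p$. Then $$\sum_{n=0}^{p-1}V_n(x)\equiv\frac{1+2x'}{1+2x}p+\frac{x'(x'+1)+1}{1+2x}p^3B_{p-2}(-x)\pmod{p^4}.$$ Consequently $$\sum_{n=0}^{p-1}\frac{V_n^{(3)}}{27^n}\equiv(-1)^{[p/3]}p+14p^3U_{p-3}\pmod{p^4},\quad\sum_{n=0}^{p-1}\frac{V_n^{(4)}}{64^n}\equiv(-1)^{\frac{p-1}2}p+13p^3E_{p-3}\pmod{p^4},$$ $$\sum_{n=0}^{p-1}\frac{V_n^{(6)}}{432^n}\equiv(-1)^{[p/3]}p+\tfrac{155}4p^3U_{p-3}\pmod{p^4}.$$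
   Context: For real $x$ and integer $k\ge0$, $\binom xk=x(x-1)\cdots(x-k+1)/k!$. $V_n(x)=\sum_{k=0}^n\binom nk\binom{n+k}k(-1)^k\binom xk\binom{ -1-x}k$. $\mathbb Z_p$: rationals with denominator prime to $p$; congruences modulo powers of $p$ are in $\mathbb Z_p$; for $x\in\mathbb Z_p$, $\langle x\rangle_p\in\{0,\ldots,p-1\}$ with $x\equiv\langle x\rangle_p\pmod p$. $[y]$ is the floor. Bernoulli numbers: $B_0=1$, $\sum_{k=0}^{n-1}\binom nkB_k=0$ ($n\ge2$); $B_n(x)=\sum_{k=0}^n\binom nkB_kx^{n-k}$. Euler numbers: $E_{2n-1}=0$, $E_0=1$, $E_{2n}=-\sum_{k=1}^n\binom{2n}{2k}E_{2n-2k}$. $U_{2n-1}=0$, $U_0=1$, $U_{2n}=-2\sum_{k=1}^n\binom{2n}{2k}U_{2n-2k}$. $V_n^{(3)}=27^nV_n(-\tfrac13)$, $V_n^{(4)}=64^nV_n(-\tfrac14)$, $V_n^{(6)}=432^nV_n(-\tfrac16)$. -}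

module Defs where

open import Data.Nat as ℕ using (ℕ; zero; suc; _∸_; _≡ᵇ_)
open import Data.Nat.Divisibility using (_∣_)
open import Data.Nat.DivMod as ND using (_%_)
open import Data.Nat.Combinatorics using (_C_)
open import Data.Integer using (+_)
open import Data.Rational using (ℚ; 0ℚ; 1ℚ; _+_; _*_; _-_; -_; 1/_; ↧ₙ_; ≢-nonZero)
open import Data.Rational.Properties using (_≟_)
open import Data.List using (List; []; _∷_; _++_)
open import Data.Product using (Σ; _×_)
open import Data.Bool using (if_then_else_)
open import Relation.Nullary using (¬_; yes; no)
open import Relation.Binary.PropositionalEquality using (_≡_)

ℕ→ℚ : ℕ → ℚ
ℕ→ℚ n = Data.Rational._/_ (+ n) 1

_div_ : ℕ → (d : ℕ) → .{{_ : ℕ.NonZero d}} → ℕ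
m div d = ND._/_ m d

-- multiplicative inverse in ℚ (only ever applied to nonzero arguments; 0 ↦ 0)
inv : ℚ → ℚ
inv q with q ≟ 0ℚ
... | yes _ = 0ℚ
... | no q≢0 = 1/_ q {{≢-nonZero q≢0}}

pow : ℚ → ℕ → ℚ
pow q zero = 1ℚ
pow q (suc n) = q * pow q n

sumTo : ℕ → (ℕ → ℚ) → ℚ
sumTo zero f = 0ℚ
sumTo (suc n) f = sumTo n f + f n

binom : ℚ → ℕ → ℚ
binom x zero = 1ℚ
binom x (suc k) = binom x k * ((x - ℕ→ℚ k) * Data.Rational._/_ (+ 1) (suc k))

V : ℕ → ℚ → ℚ
V n x = sumTo (suc n) (λ k →
  ℕ→ℚ (n C k) * ℕ→ℚ ((n ℕ.+ k) C k) * pow (- 1ℚ) k * binom x k * binom (- 1ℚ - x) k)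

InZp : ℕ → ℚ → Set
InZp p q = ¬ (p ∣ (↧ₙ q))

Cong : ℕ → ℕ → ℚ → ℚ → Set
Cong p k a b = Σ ℚ (λ c → InZp p c × (a - b ≡ pow (ℕ→ℚ p) k * c))

at : List ℚ → ℕ → ℚ
at [] _ = 0ℚ
at (q ∷ qs) zero = q
at (q ∷ qs) (suc n) = at qs n

-- table [B_0, ..., B_m]; B_m = -(1/(m+1)) Σ_{k<m} C(m+1,k) B_k for m ≥ 1,
-- i.e. Σ_{k=0}^{n-1} C(n,k) B_k = 0 for n ≥ 2
bernTab : ℕ → List ℚ
bernTab zero = 1ℚ ∷ []
bernTab (suc m) = bs ++ (nxt ∷ [])
  where
  bs = bernTab m
  nxt = - (inv (ℕ→ℚ (suc (suc m))) * sumTo (suc m) (λ k → ℕ→ℚ (suc (suc m) C k) * at bs k))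

B : ℕ → ℚ
B n = at (bernTab n) n

Bpoly : ℕ → ℚ → ℚ
Bpoly n x = sumTo (suc n) (λ k → ℕ→ℚ (n C k) * B k * pow x (n ∸ k))

-- table of [X_0, X_2, ..., X_{2m}] for the recursion
-- X_0 = 1, X_{2n} = - c Σ_{k=1}^n C(2n,2k) X_{2n-2k}
evenTab : ℚ → ℕ → List ℚ
evenTab c zero = 1ℚ ∷ []
evenTab c (suc m) = ts ++ (nxt ∷ [])
  where
  ts = evenTab c m
  n = suc m
  nxt = - (c * sumTo n (λ i → ℕ→ℚ ((2 ℕ.* n) C (2 ℕ.* suc i)) * at ts (n ∸ suc i)))

evenSeq : ℚ → ℕ → ℚ
evenSeq c m = if (m % 2) ≡ᵇ 0 then at (evenTab c (m div 2)) (m div 2) else 0ℚ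

E : ℕ → ℚ
E = evenSeq 1ℚ

U : ℕ → ℚ
U = evenSeq (ℕ→ℚ 2)

V3 : ℕ → ℚ
V3 n = pow (ℕ→ℚ 27) n * V n (- Data.Rational._/_ (+ 1) 3)

V4 : ℕ → ℚ
V4 n = pow (ℕ→ℚ 64) n * V n (- Data.Rational._/_ (+ 1) 4)

V6 : ℕ → ℚ
V6 n = pow (ℕ→ℚ 432) n * V n (- Data.Rational._/_ (+ 1) 6)

{-# OPTIONS --safe #-}
-- Put Q_k(y) = C(y,k) C(-1-y,k), so that V_n(x) = Σ_k Q_k(n) Q_k(x), and F(x) = (2x+1) Σ_{n<p} V_n(x).
-- Since (2k+1) Σ_{n<p} Q_k(n) is the product p Π_{i≤k} (1 - p²/i²), while
-- (2x+1) Q_k(x) - (2x-1) Q_k(x-1) contains the factor 2(2k+1), the difference F(x) - F(x-1) equals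
-- 2p D(x) for a sum D without denominators 2k+1. Summation by parts gives D(pt) ≡ 1 and
-- D(pt+j) ≡ p²(t²+t+1)/j² modulo p³ for 0 < j < p, so that, as Σ_{j<p} 1/j² ≡ 0 modulo p,
-- F(pT+r) ≡ p(1+2T) + 2p³(T²+T+1) Σ_{j≤r} 1/j² modulo p⁴ for natural T. A general p-adic integer x is
-- congruent to a natural number modulo p⁴, and 2 Σ_{j≤r} 1/j² ≡ B_{p-2}(-r) modulo p by
-- B_m(y+1) - B_m(y) = m yᵐ⁻¹ and Fermat's little theorem.
--
-- For the special values, identities between generating functions express B_{p-2}(1/3), B_{p-2}(1/4)
-- and B_{p-2}(1/6) modulo p as 6U_{p-3}, 8E_{p-3} and 30U_{p-3}.
module Submission where

open import Defs
import Algebra.Solver.Ring as RingSolver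
import Algebra.Solver.Ring.AlmostCommutativeRing as ACR
open import Algebra.Bundles using (CommutativeRing)
open import Data.Bool using (Bool; if_then_else_)
open import Data.Empty using (⊥; ⊥-elim)
open import Data.Integer as ℤ using (ℤ; +_)
import Data.Integer.Properties as ℤₚ
open import Data.List using (List; []; _∷_; _++_; length)
import Data.List.Properties as Listₚ
open import Data.Maybe as Maybe using (Maybe)
open import Data.Nat as ℕ using (ℕ; zero; suc; _<_; _≤_; _∸_; z≤n; s≤s)
open import Data.Nat.Combinatorics using (_C_; nCk≡nC[n∸k]; nCn≡1; k>n⇒nCk≡0; nCk+nC[k+1]≡[n+1]C[k+1])
open import Data.Nat.Coprimality as Coprimality using (coprime-divisor)
open import Data.Nat.Divisibility using (_∣_; divides; ∣-trans; ∣⇒≤)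
open import Data.Nat.DivMod as ℕ/ using (_%_)
open import Data.Nat.Primality using (Prime; euclidsLemma; prime⇒nonTrivial; prime⇒irreducible)
import Data.Nat.Properties as ℕₚ
import Data.Nat.Tactic.RingSolver as ℕRing
open import Data.Product using (Σ; _×_; _,_; proj₁; proj₂)
open import Data.Rational using (ℚ; mkℚ; 0ℚ; 1ℚ; _+_; _*_; _-_; -_; toℚᵘ; ≢-nonZero)
import Data.Rational.Properties as ℚ
open import Data.Rational.Unnormalised as ℚᵘ using (ℚᵘ; mkℚᵘ; *≡*)
import Data.Rational.Unnormalised.Properties as ℚᵘ
open import Data.Sum using (_⊎_; inj₁; inj₂)
open import Function using (_∘_)
open import Level using (0ℓ)
open import Relation.Binary.PropositionalEquality
open import Relation.Nullary using (¬_; yes; no)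
open import Relation.Nullary.Decidable using (dec⇒maybe)
open import Tactic.RingSolver using (solve-∀)
open import Tactic.RingSolver.Core.AlmostCommutativeRing using (AlmostCommutativeRing; fromCommutativeRing)

-- The obstacle is the index k = (p - 1)/2: there Σ_{n<p} Q_k(n) has the denominator 2k + 1 = p, so
-- the sum over k cannot be reduced term by term without losing a power of p. Passing to F removes
-- that denominator before anything is reduced. Each step of the difference equation then carries an
-- explicit factor 2p, so D is needed only modulo p³; and the sum left over in D after summation by
-- parts is multiplied by p², so it is needed only modulo p. In D(pt + j) the part t² + t comes from
-- the product Π_{0<i<p} (1 - y²/i²), and the part 1 from that remaining sum.
--
-- In the special cases the residue of p modulo the denominator of x decides between two values of
-- x', exchanged by x' ↦ -1 - x'. This reflection fixes x'(x' + 1), so the coefficient of p³ is the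
-- same in both classes, and it negates 1 + 2x', which is the source of the signs (-1)^[p/3] and
-- (-1)^((p-1)/2).

ℚ-ring : AlmostCommutativeRing 0ℓ 0ℓ
ℚ-ring = fromCommutativeRing ℚ.+-*-commutativeRing (λ q → dec⇒maybe (0ℚ ℚ.≟ q))

-- Integers inside the rationals, reciprocals, powers and finite sums

ζ : ℤ → ℚ
ζ i = Data.Rational._/_ i 1

ι : ℕ → ℚ
ι = ℕ→ℚ

toℚᵘ-ζ : ∀ i → toℚᵘ (ζ i) ℚᵘ.≃ mkℚᵘ i 0
toℚᵘ-ζ i = ℚ.toℚᵘ-fromℚᵘ (mkℚᵘ i 0)

ζ-+ : ∀ i j → ζ (i ℤ.+ j) ≡ ζ i + ζ j
ζ-+ i j = ℚ.toℚᵘ-injective (begin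
  toℚᵘ (ζ (i ℤ.+ j))           ≈⟨ toℚᵘ-ζ (i ℤ.+ j) ⟩
  mkℚᵘ (i ℤ.+ j) 0             ≈⟨ *≡* (cong (ℤ._* + 1) (sym (cong₂ ℤ._+_ (ℤₚ.*-identityʳ i) (ℤₚ.*-identityʳ j)))) ⟩
  mkℚᵘ i 0 ℚᵘ.+ mkℚᵘ j 0       ≈⟨ ℚᵘ.+-cong (toℚᵘ-ζ i) (toℚᵘ-ζ j) ⟨
  toℚᵘ (ζ i) ℚᵘ.+ toℚᵘ (ζ j)   ≈⟨ ℚ.toℚᵘ-homo-+ (ζ i) (ζ j) ⟨
  toℚᵘ (ζ i + ζ j)             ∎)
  where open ℚᵘ.≃-Reasoning

ζ-* : ∀ i j → ζ (i ℤ.* j) ≡ ζ i * ζ j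
ζ-* i j = ℚ.toℚᵘ-injective (begin
  toℚᵘ (ζ (i ℤ.* j))           ≈⟨ toℚᵘ-ζ (i ℤ.* j) ⟩
  mkℚᵘ i 0 ℚᵘ.* mkℚᵘ j 0       ≈⟨ ℚᵘ.*-cong (toℚᵘ-ζ i) (toℚᵘ-ζ j) ⟨
  toℚᵘ (ζ i) ℚᵘ.* toℚᵘ (ζ j)   ≈⟨ ℚ.toℚᵘ-homo-* (ζ i) (ζ j) ⟨
  toℚᵘ (ζ i * ζ j)             ∎)
  where open ℚᵘ.≃-Reasoning

ζ-injective : ∀ i j → ζ i ≡ ζ j → i ≡ j
ζ-injective i j eq with ℚᵘ.≃-trans (ℚᵘ.≃-sym (toℚᵘ-ζ i)) (ℚᵘ.≃-trans (ℚᵘ.≃-reflexive (cong toℚᵘ eq)) (toℚᵘ-ζ j))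
... | *≡* e = ℤₚ.*-cancelʳ-≡ i j (+ 1) e

ι-+ : ∀ m n → ι (m ℕ.+ n) ≡ ι m + ι n
ι-+ m n = ζ-+ (+ m) (+ n)

ι-* : ∀ m n → ι (m ℕ.* n) ≡ ι m * ι n
ι-* m n = trans (cong ζ (ℤₚ.pos-* m n)) (ζ-* (+ m) (+ n))

ι-suc : ∀ n → ι (suc n) ≡ 1ℚ + ι n
ι-suc n = ι-+ 1 n

1/[1+_] : ℕ → ℚ
1/[1+ k ] = Data.Rational._/_ (+ 1) (suc k)

*-cancel-unit : ∀ u v {a b} → u * v ≡ 1ℚ → u * a ≡ u * b → a ≡ b
*-cancel-unit u v {a} {b} uv eq = begin
  a             ≡⟨ sym (ℚ.*-identityˡ a) ⟩
  1ℚ * a        ≡⟨ cong (_* a) (sym uv) ⟩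
  u * v * a     ≡⟨ lem u v a ⟩
  v * (u * a)   ≡⟨ cong (v *_) eq ⟩
  v * (u * b)   ≡⟨ sym (lem u v b) ⟩
  u * v * b     ≡⟨ cong (_* b) uv ⟩
  1ℚ * b        ≡⟨ ℚ.*-identityˡ b ⟩
  b             ∎
  where
  open ≡-Reasoning
  lem : ∀ u v a → u * v * a ≡ v * (u * a)
  lem = solve-∀ ℚ-ring

1/[1+]-inverse : ∀ k → ι (suc k) * 1/[1+ k ] ≡ 1ℚ
1/[1+]-inverse k = ℚ.toℚᵘ-injective (begin
  toℚᵘ (ι (suc k) * 1/[1+ k ])             ≈⟨ ℚ.toℚᵘ-homo-* (ι (suc k)) 1/[1+ k ] ⟩
  toℚᵘ (ι (suc k)) ℚᵘ.* toℚᵘ 1/[1+ k ]     ≈⟨ ℚᵘ.*-cong (toℚᵘ-ζ (+ suc k)) (ℚ.toℚᵘ-fromℚᵘ (mkℚᵘ (+ 1) k)) ⟩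
  mkℚᵘ (+ suc k) 0 ℚᵘ.* mkℚᵘ (+ 1) k       ≈⟨ *≡* (cong (+_) (trans (ℕₚ.*-identityʳ _) (trans (ℕₚ.*-identityʳ _) (sym (trans (ℕₚ.+-identityʳ _) (ℕₚ.+-identityʳ _)))))) ⟩
  toℚᵘ 1ℚ                                  ∎)
  where open ℚᵘ.≃-Reasoning

inv-inverse : ∀ q → q ≢ 0ℚ → q * inv q ≡ 1ℚ
inv-inverse q q≢0 with q ℚ.≟ 0ℚ
... | yes q≡0 = ⊥-elim (q≢0 q≡0)
... | no  q≢0 = ℚ.*-inverseʳ q {{≢-nonZero q≢0}}

unit≢0 : ∀ u v → u * v ≡ 1ℚ → u ≢ 0ℚ
unit≢0 u v uv u≡0 = ℚ.1≢0 (trans (sym uv) (trans (cong (_* v) u≡0) (ℚ.*-zeroˡ v)))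

inv-unique : ∀ u v → u * v ≡ 1ℚ → inv u ≡ v
inv-unique u v uv = *-cancel-unit u v uv (trans (inv-inverse u (unit≢0 u v uv)) (sym uv))

ι-suc≢0 : ∀ k → ι (suc k) ≢ 0ℚ
ι-suc≢0 k = unit≢0 (ι (suc k)) 1/[1+ k ] (1/[1+]-inverse k)

inv-ι-suc : ∀ k → inv (ι (suc k)) ≡ 1/[1+ k ]
inv-ι-suc k = inv-unique (ι (suc k)) 1/[1+ k ] (1/[1+]-inverse k)

*-cancelˡ : ∀ q {a b} → q ≢ 0ℚ → q * a ≡ q * b → a ≡ b
*-cancelˡ q q≢0 = *-cancel-unit q (inv q) (inv-inverse q q≢0)

pow-+ : ∀ q m n → pow q (m ℕ.+ n) ≡ pow q m * pow q n
pow-+ q zero n = sym (ℚ.*-identityˡ _)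
pow-+ q (suc m) n = trans (cong (q *_) (pow-+ q m n)) (sym (ℚ.*-assoc q _ _))

pow-* : ∀ a b n → pow (a * b) n ≡ pow a n * pow b n
pow-* a b zero = refl
pow-* a b (suc n) = trans (cong (a * b *_) (pow-* a b n)) (lem a b (pow a n) (pow b n))
  where
  lem : ∀ a b c d → a * b * (c * d) ≡ a * c * (b * d)
  lem = solve-∀ ℚ-ring

pow-1 : ∀ n → pow 1ℚ n ≡ 1ℚ
pow-1 zero = refl
pow-1 (suc n) = trans (ℚ.*-identityˡ _) (pow-1 n)

pow-double : ∀ q n → pow q (n ℕ.+ n) ≡ pow (q * q) n
pow-double q n = trans (pow-+ q n n) (sym (pow-* q q n))

pow-neg-even : ∀ n → pow (- 1ℚ) (n ℕ.+ n) ≡ 1ℚ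
pow-neg-even n = trans (pow-double (- 1ℚ) n) (pow-1 n)

sum-cong< : ∀ n {f g : ℕ → ℚ} → (∀ k → k < n → f k ≡ g k) → sumTo n f ≡ sumTo n g
sum-cong< zero eq = refl
sum-cong< (suc n) eq = cong₂ _+_ (sum-cong< n (λ k k<n → eq k (ℕₚ.m<n⇒m<1+n k<n))) (eq n (ℕₚ.n<1+n n))

sum-cong : ∀ n {f g : ℕ → ℚ} → (∀ k → f k ≡ g k) → sumTo n f ≡ sumTo n g
sum-cong n eq = sum-cong< n (λ k _ → eq k)

sum-+ : ∀ n (f g : ℕ → ℚ) → sumTo n (λ k → f k + g k) ≡ sumTo n f + sumTo n g
sum-+ zero f g = refl
sum-+ (suc n) f g = trans (cong (_+ (f n + g n)) (sum-+ n f g)) (lem (sumTo n f) (sumTo n g) (f n) (g n))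
  where
  lem : ∀ a b c d → a + b + (c + d) ≡ a + c + (b + d)
  lem = solve-∀ ℚ-ring

sum-*ˡ : ∀ n c (f : ℕ → ℚ) → sumTo n (λ k → c * f k) ≡ c * sumTo n f
sum-*ˡ zero c f = sym (ℚ.*-zeroʳ c)
sum-*ˡ (suc n) c f = trans (cong (_+ c * f n) (sum-*ˡ n c f)) (sym (ℚ.*-distribˡ-+ c _ _))

sum-0 : ∀ n → sumTo n (λ _ → 0ℚ) ≡ 0ℚ
sum-0 zero = refl
sum-0 (suc n) = trans (ℚ.+-identityʳ _) (sum-0 n)

sum-swap : ∀ m n (f : ℕ → ℕ → ℚ) →
  sumTo m (λ i → sumTo n (f i)) ≡ sumTo n (λ j → sumTo m (λ i → f i j))
sum-swap zero n f = sym (sum-0 n)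
sum-swap (suc m) n f = trans (cong (_+ sumTo n (f m)) (sum-swap m n f))
  (sym (sum-+ n (λ j → sumTo m (λ i → f i j)) (f m)))

sum-extend : ∀ m n (f : ℕ → ℚ) → (∀ k → m ≤ k → f k ≡ 0ℚ) → sumTo (n ℕ.+ m) f ≡ sumTo m f
sum-extend m zero f z = refl
sum-extend m (suc n) f z =
  trans (cong₂ _+_ (sum-extend m n f z) (z (n ℕ.+ m) (ℕₚ.m≤n+m m n))) (ℚ.+-identityʳ _)

sum-first : ∀ n (f : ℕ → ℚ) → sumTo (suc n) f ≡ f 0 + sumTo n (f ∘ suc)
sum-first zero f = ℚ.+-comm 0ℚ (f 0)
sum-first (suc n) f = trans (cong (_+ f (suc n)) (sum-first n f)) (ℚ.+-assoc (f 0) _ _)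

-- Congruences between p-integral rationals

module Congruences (p : ℕ) (p-prime : Prime p) where

  -- `InZp` speaks of the denominator in lowest terms, which sums and products do not control. Here
  -- any denominator prime to p may serve as witness, so closure under the ring operations needs no
  -- reduction of fractions.
  record Integral (q : ℚ) : Set where
    constructor fraction
    field
      num : ℤ
      den : ℕ
      p∤den : ¬ p ∣ den
      q*den≡num : q * ι den ≡ ζ num

  1<p : 1 < p
  1<p = ℕ.nonTrivial⇒n>1 p {{prime⇒nonTrivial p-prime}}

  p∤< : ∀ k → suc k < p → ¬ p ∣ suc k
  p∤< k k<p p∣k = ℕₚ.<⇒≱ k<p (∣⇒≤ p∣k)

  p∤1 : ¬ p ∣ 1
  p∤1 = p∤< 0 1<p

  p∤* : ∀ {m n} → ¬ p ∣ m → ¬ p ∣ n → ¬ p ∣ m ℕ.* n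
  p∤* {m} {n} p∤m p∤n p∣mn with euclidsLemma m n p-prime p∣mn
  ... | inj₁ p∣m = p∤m p∣m
  ... | inj₂ p∣n = p∤n p∣n

  InZp⇒Integral : ∀ {q} → InZp p q → Integral q
  InZp⇒Integral {q@(mkℚ n d-1 c)} p∤d = fraction n (suc d-1) p∤d (ℚ.toℚᵘ-injective (begin
    toℚᵘ (q * ι (suc d-1))                 ≈⟨ ℚ.toℚᵘ-homo-* q (ι (suc d-1)) ⟩
    toℚᵘ q ℚᵘ.* toℚᵘ (ι (suc d-1))         ≈⟨ ℚᵘ.*-cong {x = toℚᵘ q} ℚᵘ.≃-refl (toℚᵘ-ζ (+ suc d-1)) ⟩
    mkℚᵘ n d-1 ℚᵘ.* mkℚᵘ (+ suc d-1) 0     ≈⟨ *≡* (trans (ℤₚ.*-identityʳ _) (cong (λ z → n ℤ.* + z) (sym (ℕₚ.*-identityʳ (suc d-1))))) ⟩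
    mkℚᵘ n 0                               ≈⟨ toℚᵘ-ζ n ⟨
    toℚᵘ (ζ n)                             ∎))
    where open ℚᵘ.≃-Reasoning

  -- A denominator in lowest terms divides every other denominator of the same number, since it is
  -- coprime to the numerator.
  Integral⇒InZp : ∀ {q} → Integral q → InZp p q
  Integral⇒InZp {q@(mkℚ n d-1 c)} (fraction m d p∤d eq) p∣q = p∤d (∣-trans p∣q D∣d)
    where
    unnormalised : mkℚᵘ n d-1 ℚᵘ.* mkℚᵘ (+ d) 0 ℚᵘ.≃ mkℚᵘ m 0
    unnormalised = begin
      mkℚᵘ n d-1 ℚᵘ.* mkℚᵘ (+ d) 0   ≈⟨ ℚᵘ.*-cong {x = toℚᵘ q} ℚᵘ.≃-refl (toℚᵘ-ζ (+ d)) ⟨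
      toℚᵘ q ℚᵘ.* toℚᵘ (ι d)         ≈⟨ ℚ.toℚᵘ-homo-* q (ι d) ⟨
      toℚᵘ (q * ι d)                 ≈⟨ ℚᵘ.≃-reflexive (cong toℚᵘ eq) ⟩
      toℚᵘ (ζ m)                     ≈⟨ toℚᵘ-ζ m ⟩
      mkℚᵘ m 0                       ∎
      where open ℚᵘ.≃-Reasoning
    cross : n ℤ.* + d ≡ m ℤ.* + suc d-1
    cross with unnormalised
    ... | *≡* e = trans (sym (ℤₚ.*-identityʳ _)) (trans e (cong (λ z → m ℤ.* + z) (ℕₚ.*-identityʳ (suc d-1))))
    D∣d : suc d-1 ∣ d
    D∣d = coprime-divisor (Coprimality.sym (Coprimality.recompute c))
      (divides ℤ.∣ m ∣ (trans (sym (ℤₚ.abs-* n (+ d))) (trans (cong ℤ.∣_∣ cross) (ℤₚ.abs-* m (+ suc d-1)))))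

  int-ζ : ∀ i → Integral (ζ i)
  int-ζ i = fraction i 1 p∤1 (ℚ.*-identityʳ (ζ i))

  int-ι : ∀ n → Integral (ι n)
  int-ι n = int-ζ (+ n)

  int-0 : Integral 0ℚ
  int-0 = int-ι 0

  int-1 : Integral 1ℚ
  int-1 = int-ι 1

  int-* : ∀ {a b} → Integral a → Integral b → Integral (a * b)
  int-* {a} {b} (fraction n d p∤d e) (fraction m f p∤f e′) =
    fraction (n ℤ.* m) (d ℕ.* f) (p∤* p∤d p∤f) (begin
      a * b * ι (d ℕ.* f)         ≡⟨ cong (a * b *_) (ι-* d f) ⟩
      a * b * (ι d * ι f)         ≡⟨ lem a b (ι d) (ι f) ⟩
      (a * ι d) * (b * ι f)       ≡⟨ cong₂ _*_ e e′ ⟩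
      ζ n * ζ m                   ≡⟨ sym (ζ-* n m) ⟩
      ζ (n ℤ.* m)                 ∎)
    where
    open ≡-Reasoning
    lem : ∀ a b c d → a * b * (c * d) ≡ a * c * (b * d)
    lem = solve-∀ ℚ-ring

  int-+ : ∀ {a b} → Integral a → Integral b → Integral (a + b)
  int-+ {a} {b} (fraction n d p∤d e) (fraction m f p∤f e′) =
    fraction (n ℤ.* + f ℤ.+ m ℤ.* + d) (d ℕ.* f) (p∤* p∤d p∤f) (begin
      (a + b) * ι (d ℕ.* f)                ≡⟨ cong ((a + b) *_) (ι-* d f) ⟩
      (a + b) * (ι d * ι f)                ≡⟨ lem a b (ι d) (ι f) ⟩
      (a * ι d) * ι f + (b * ι f) * ι d    ≡⟨ cong₂ (λ x y → x * ι f + y * ι d) e e′ ⟩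
      ζ n * ι f + ζ m * ι d                ≡⟨ sym (cong₂ _+_ (ζ-* n (+ f)) (ζ-* m (+ d))) ⟩
      ζ (n ℤ.* + f) + ζ (m ℤ.* + d)        ≡⟨ sym (ζ-+ (n ℤ.* + f) (m ℤ.* + d)) ⟩
      ζ (n ℤ.* + f ℤ.+ m ℤ.* + d)          ∎)
    where
    open ≡-Reasoning
    lem : ∀ a b c d → (a + b) * (c * d) ≡ a * c * d + b * d * c
    lem = solve-∀ ℚ-ring

  int-neg : ∀ {a} → Integral a → Integral (- a)
  int-neg {a} i = subst Integral (lem a) (int-* (int-ζ (ℤ.- (+ 1))) i)
    where
    lem : ∀ a → (- 1ℚ) * a ≡ - a
    lem = solve-∀ ℚ-ring

  int-- : ∀ {a b} → Integral a → Integral b → Integral (a - b)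
  int-- i j = int-+ i (int-neg j)

  int-pow : ∀ {a} n → Integral a → Integral (pow a n)
  int-pow zero i = int-1
  int-pow (suc n) i = int-* i (int-pow n i)

  int-sum : ∀ n {f : ℕ → ℚ} → (∀ k → k < n → Integral (f k)) → Integral (sumTo n f)
  int-sum zero i = int-0
  int-sum (suc n) i = int-+ (int-sum n (λ k k<n → i k (ℕₚ.m<n⇒m<1+n k<n))) (i n (ℕₚ.n<1+n n))

  int-1/[1+] : ∀ k → ¬ p ∣ suc k → Integral 1/[1+ k ]
  int-1/[1+] k p∤k = fraction (+ 1) (suc k) p∤k (trans (ℚ.*-comm 1/[1+ k ] (ι (suc k))) (1/[1+]-inverse k))

  record _≋_[_] (a b : ℚ) (k : ℕ) : Set where
    constructor congruent
    field
      quot : ℚ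
      quot-int : Integral quot
      diff : a - b ≡ pow (ι p) k * quot

  infix 4 _≋_[_]

  ≋⇒Cong : ∀ {a b k} → a ≋ b [ k ] → Cong p k a b
  ≋⇒Cong (congruent c i e) = c , Integral⇒InZp i , e

  Cong⇒≋ : ∀ {a b k} → Cong p k a b → a ≋ b [ k ]
  Cong⇒≋ (c , i , e) = congruent c (InZp⇒Integral i) e

  ≋-reflexive : ∀ {a b k} → a ≡ b → a ≋ b [ k ]
  ≋-reflexive {a} {.a} {k} refl = congruent 0ℚ int-0 (trans (ℚ.+-inverseʳ a) (sym (ℚ.*-zeroʳ (pow (ι p) k))))

  ≋-refl : ∀ {a k} → a ≋ a [ k ]
  ≋-refl = ≋-reflexive refl

  ≋-sym : ∀ {a b k} → a ≋ b [ k ] → b ≋ a [ k ]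
  ≋-sym {a} {b} {k} (congruent c i e) = congruent (- c) (int-neg i)
    (trans (l₁ a b) (trans (cong -_ e) (l₂ (pow (ι p) k) c)))
    where
    l₁ : ∀ a b → b - a ≡ - (a - b)
    l₁ = solve-∀ ℚ-ring
    l₂ : ∀ q c → - (q * c) ≡ q * - c
    l₂ = solve-∀ ℚ-ring

  ≋-+ : ∀ {a b c d k} → a ≋ b [ k ] → c ≋ d [ k ] → a + c ≋ b + d [ k ]
  ≋-+ {a} {b} {c} {d} {k} (congruent q i e) (congruent r j f) = congruent (q + r) (int-+ i j)
    (trans (l₁ a b c d) (trans (cong₂ _+_ e f) (sym (ℚ.*-distribˡ-+ (pow (ι p) k) q r))))
    where
    l₁ : ∀ a b c d → a + c - (b + d) ≡ (a - b) + (c - d)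
    l₁ = solve-∀ ℚ-ring

  ≋-trans : ∀ {a b c k} → a ≋ b [ k ] → b ≋ c [ k ] → a ≋ c [ k ]
  ≋-trans {a} {b} {c} {k} (congruent q i e) (congruent r j f) = congruent (q + r) (int-+ i j)
    (trans (l₁ a b c) (trans (cong₂ _+_ e f) (sym (ℚ.*-distribˡ-+ (pow (ι p) k) q r))))
    where
    l₁ : ∀ a b c → a - c ≡ (a - b) + (b - c)
    l₁ = solve-∀ ℚ-ring

  ≋-*ˡ : ∀ {a b k} c → Integral c → a ≋ b [ k ] → c * a ≋ c * b [ k ]
  ≋-*ˡ {a} {b} {k} c i (congruent q j e) = congruent (c * q) (int-* i j)
    (trans (l₁ a b c) (trans (cong (c *_) e) (l₂ c (pow (ι p) k) q)))
    where
    l₁ : ∀ a b c → c * a - c * b ≡ c * (a - b)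
    l₁ = solve-∀ ℚ-ring
    l₂ : ∀ a b c → a * (b * c) ≡ b * (a * c)
    l₂ = solve-∀ ℚ-ring

  ≋-*ʳ : ∀ {a b k} c → Integral c → a ≋ b [ k ] → a * c ≋ b * c [ k ]
  ≋-*ʳ {a} {b} {k} c i e = subst₂ (_≋_[ k ]) (ℚ.*-comm c a) (ℚ.*-comm c b) (≋-*ˡ c i e)

  ≋-neg : ∀ {a b k} → a ≋ b [ k ] → - a ≋ - b [ k ]
  ≋-neg {a} {b} {k} e = subst₂ (_≋_[ k ]) (l₁ a) (l₁ b) (≋-*ˡ (- 1ℚ) (int-neg int-1) e)
    where
    l₁ : ∀ a → (- 1ℚ) * a ≡ - a
    l₁ = solve-∀ ℚ-ring

  ≋-- : ∀ {a b c d k} → a ≋ b [ k ] → c ≋ d [ k ] → a - c ≋ b - d [ k ]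
  ≋-- e f = ≋-+ e (≋-neg f)

  ≋-* : ∀ {a b c d k} → Integral b → Integral c → a ≋ b [ k ] → c ≋ d [ k ] → a * c ≋ b * d [ k ]
  ≋-* {a} {b} {c} {d} i j e f = ≋-trans (≋-*ʳ c j e) (≋-*ˡ b i f)

  ≋-sum : ∀ n {f g : ℕ → ℚ} {k} → (∀ i → i < n → f i ≋ g i [ k ]) → sumTo n f ≋ sumTo n g [ k ]
  ≋-sum zero e = ≋-refl
  ≋-sum (suc n) e = ≋-+ (≋-sum n (λ k k<n → e k (ℕₚ.m<n⇒m<1+n k<n))) (e n (ℕₚ.n<1+n n))

  ≋-int : ∀ {a b k} → Integral b → a ≋ b [ k ] → Integral a
  ≋-int {a} {b} {k} i (congruent q j e) =
    subst Integral (trans (cong (λ z → z + b) (sym e)) (l₁ a b)) (int-+ (int-* (int-pow k (int-ι p)) j) i)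
    where
    l₁ : ∀ a b → a - b + b ≡ a
    l₁ = solve-∀ ℚ-ring

  ≋-pow : ∀ {a b k} n → Integral b → a ≋ b [ k ] → pow a n ≋ pow b n [ k ]
  ≋-pow zero i e = ≋-refl
  ≋-pow (suc n) i e = ≋-* i (int-pow n (≋-int i e)) e (≋-pow n i e)

  ≋-weaken : ∀ {a b} j {k} → a ≋ b [ j ℕ.+ k ] → a ≋ b [ k ]
  ≋-weaken j {k} (congruent q i e) = congruent (pow (ι p) j * q) (int-* (int-pow j (int-ι p)) i)
    (trans e (trans (cong (_* q) (pow-+ (ι p) j k)) (l₁ (pow (ι p) j) (pow (ι p) k) q)))
    where
    l₁ : ∀ a b c → a * b * c ≡ b * (a * c)
    l₁ = solve-∀ ℚ-ring

  -- This is how precision is gained: next to a factor divisible by pʲ, a congruence modulo pᵏ is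
  -- worth one modulo pʲ⁺ᵏ. All steps from modulus p up to p³ and p⁴ go through it.
  ≋-absorb : ∀ {z a b j k} → z ≋ 0ℚ [ j ] → a ≋ b [ k ] → z * a ≋ z * b [ j ℕ.+ k ]
  ≋-absorb {z} {a} {b} {j} {k} (congruent q i e) (congruent r l f) = congruent (q * r) (int-* i l)
    (trans (l₁ z a b) (trans (cong₂ _*_ e f) (trans (l₂ (pow (ι p) j) q (pow (ι p) k) r) (cong (_* (q * r)) (sym (pow-+ (ι p) j k))))))
    where
    l₁ : ∀ z a b → z * a - z * b ≡ (z - 0ℚ) * (a - b)
    l₁ = solve-∀ ℚ-ring
    l₂ : ∀ a b c d → a * b * (c * d) ≡ a * c * (b * d)
    l₂ = solve-∀ ℚ-ring

  pow-p≋0 : ∀ k → pow (ι p) k ≋ 0ℚ [ k ]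
  pow-p≋0 k = congruent 1ℚ int-1 (lem (pow (ι p) k))
    where
    lem : ∀ a → a - 0ℚ ≡ a * 1ℚ
    lem = solve-∀ ℚ-ring

  p≋0 : ι p ≋ 0ℚ [ 1 ]
  p≋0 = subst (_≋ 0ℚ [ 1 ]) (ℚ.*-identityʳ (ι p)) (pow-p≋0 1)

  ≋0-*ʳ : ∀ {z k} c → Integral c → z ≋ 0ℚ [ k ] → z * c ≋ 0ℚ [ k ]
  ≋0-*ʳ {z} {k} c i e = subst (z * c ≋_[ k ]) (ℚ.*-zeroˡ c) (≋-*ʳ c i e)

  ≋-cancel : ∀ {a b k} u v → u * v ≡ 1ℚ → Integral v → u * a ≋ u * b [ k ] → a ≋ b [ k ]
  ≋-cancel {a} {b} {k} u v uv i e = subst₂ (_≋_[ k ]) (lem a) (lem b) (≋-*ˡ v i e)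
    where
    l₁ : ∀ u v a → v * (u * a) ≡ u * v * a
    l₁ = solve-∀ ℚ-ring
    lem : ∀ a → v * (u * a) ≡ a
    lem a = trans (l₁ u v a) (trans (cong (_* a) uv) (ℚ.*-identityˡ a))

  -- From u = p q follows 1 = p (q v); clearing a denominator d of q v would make d a multiple of p.
  unit≇0 : ∀ {u} v → u * v ≡ 1ℚ → Integral v → ¬ u ≋ 0ℚ [ 1 ]
  unit≇0 {u} v uv i (congruent q j e) = absurd (int-* j i)
    where
    absurd : Integral (q * v) → ⊥
    absurd (fraction n d p∤d eq) = p∤d (divides ℤ.∣ n ∣ (trans (cong ℤ.∣_∣ d≡pn) (trans (ℤₚ.abs-* (+ p) n) (ℕₚ.*-comm p ℤ.∣ n ∣))))
      where
      l₁ : ∀ u v d → u * v * d ≡ (u - 0ℚ) * v * d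
      l₁ = solve-∀ ℚ-ring
      l₂ : ∀ p q v d → p * 1ℚ * q * v * d ≡ p * (q * v * d)
      l₂ = solve-∀ ℚ-ring
      d≡pn : + d ≡ + p ℤ.* n
      d≡pn = ζ-injective (+ d) (+ p ℤ.* n) (begin
        ι d                          ≡⟨ sym (ℚ.*-identityˡ (ι d)) ⟩
        1ℚ * ι d                     ≡⟨ cong (_* ι d) (sym uv) ⟩
        u * v * ι d                  ≡⟨ l₁ u v (ι d) ⟩
        (u - 0ℚ) * v * ι d           ≡⟨ cong (λ z → z * v * ι d) e ⟩
        ι p * 1ℚ * q * v * ι d       ≡⟨ l₂ (ι p) q v (ι d) ⟩
        ι p * (q * v * ι d)          ≡⟨ cong (ι p *_) eq ⟩
        ι p * ζ n                    ≡⟨ sym (ζ-* (+ p) n) ⟩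
        ζ (+ p ℤ.* n)                ∎)
        where open ≡-Reasoning

  ζ-sign : ∀ n → (ζ n ≡ ι ℤ.∣ n ∣) ⊎ (ζ n ≡ - ι ℤ.∣ n ∣)
  ζ-sign (+ n) = inj₁ refl
  ζ-sign (ℤ.-[1+ n ]) = inj₂ refl

  -- The inverse is den/num. If p divided the numerator, u would be p times an integral number. The
  -- two cases of `ζ-sign` move the sign of the numerator over, because `den` must be a natural
  -- number.
  int-inv : ∀ {u} → Integral u → ¬ u ≋ 0ℚ [ 1 ] → Integral (inv u)
  int-inv {u} i@(fraction n zero p∤d e) u≇0 = ⊥-elim (p∤d (divides 0 refl))
  int-inv {u} i@(fraction n d@(suc d-1) p∤d e) u≇0 = invert (ζ-sign n)
    where
    δ : ℚ
    δ = 1/[1+ d-1 ]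
    uv : u * inv u ≡ 1ℚ
    uv = inv-inverse u (λ u≡0 → u≇0 (≋-reflexive u≡0))
    l₀ : ∀ u v d → v * (u * d) ≡ u * v * d
    l₀ = solve-∀ ℚ-ring
    l₁ : ∀ u d δ → u ≡ u * d * δ + u * (1ℚ - d * δ)
    l₁ = solve-∀ ℚ-ring
    l₃ : ∀ k p δ → k * p * δ ≡ p * (k * δ)
    l₃ = solve-∀ ℚ-ring
    l₄ : ∀ k p δ → (- (k * p)) * δ ≡ p * - (k * δ)
    l₄ = solve-∀ ℚ-ring
    l₅ : ∀ v n → v * - n ≡ - (v * n)
    l₅ = solve-∀ ℚ-ring
    l₆ : ∀ a → - - a ≡ a
    l₆ = solve-∀ ℚ-ring
    u≡nδ : u ≡ ζ n * δ
    u≡nδ = begin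
      u                                          ≡⟨ l₁ u (ι d) δ ⟩
      u * ι d * δ + u * (1ℚ - ι d * δ)           ≡⟨ cong₂ (λ x y → x * δ + u * (1ℚ - y)) e (1/[1+]-inverse d-1) ⟩
      ζ n * δ + u * (1ℚ - 1ℚ)                    ≡⟨ trans (cong (λ z → ζ n * δ + z) (ℚ.*-zeroʳ u)) (ℚ.+-identityʳ _) ⟩
      ζ n * δ                                    ∎
      where open ≡-Reasoning
    δ-int : Integral δ
    δ-int = int-1/[1+] d-1 p∤d
    v*num : inv u * ζ n ≡ ι d
    v*num = trans (cong (inv u *_) (sym e)) (trans (l₀ u (inv u) (ι d)) (trans (cong (_* ι d) uv) (ℚ.*-identityˡ (ι d))))
    multiple : ∀ w → u ≡ ι p * w → Integral w → ⊥
    multiple w eq j = u≇0 (subst (_≋ 0ℚ [ 1 ]) (sym eq) (≋0-*ʳ w j p≋0))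
    num-unit : (ζ n ≡ ι ℤ.∣ n ∣) ⊎ (ζ n ≡ - ι ℤ.∣ n ∣) → ¬ p ∣ ℤ.∣ n ∣
    num-unit (inj₁ s) (divides k eq) = multiple (ι k * δ)
      (trans u≡nδ (trans (cong (_* δ) (trans s (trans (cong ι eq) (ι-* k p)))) (l₃ (ι k) (ι p) δ)))
      (int-* (int-ι k) δ-int)
    num-unit (inj₂ s) (divides k eq) = multiple (- (ι k * δ))
      (trans u≡nδ (trans (cong (_* δ) (trans s (cong -_ (trans (cong ι eq) (ι-* k p))))) (l₄ (ι k) (ι p) δ)))
      (int-neg (int-* (int-ι k) δ-int))
    invert : (ζ n ≡ ι ℤ.∣ n ∣) ⊎ (ζ n ≡ - ι ℤ.∣ n ∣) → Integral (inv u)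
    invert (inj₁ s) = fraction (+ d) ℤ.∣ n ∣ (num-unit (inj₁ s)) (trans (cong (inv u *_) (sym s)) v*num)
    invert (inj₂ s) = fraction (ℤ.- (+ d)) ℤ.∣ n ∣ (num-unit (inj₂ s))
      (trans (trans (sym (l₆ _)) (cong -_ (trans (sym (l₅ (inv u) (ι ℤ.∣ n ∣))) (trans (cong (inv u *_) (sym s)) v*num)))) refl)

-- Hypergeometric sums

nC0≡1 : ∀ n → n C 0 ≡ 1
nC0≡1 n = trans (nCk≡nC[n∸k] {k = 0} {n = n} z≤n) (nCn≡1 n)

ι-pascal : ∀ n k → ι (suc n C suc k) ≡ ι (n C k) + ι (n C suc k)
ι-pascal n k = trans (cong ι (sym (nCk+nC[k+1]≡[n+1]C[k+1] n k))) (ι-+ (n C k) (n C suc k))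

ι-0C : ∀ k → ι (0 C suc k) ≡ 0ℚ
ι-0C k = cong ι (k>n⇒nCk≡0 {n = 0} {k = suc k} (s≤s z≤n))

choose-step : ∀ n k → (1ℚ + ι k) * ι (n C suc k) ≡ (ι n - ι k) * ι (n C k)
choose-step zero zero = refl
choose-step zero (suc k) = begin
  (1ℚ + ι (suc k)) * ι (0 C suc (suc k))   ≡⟨ cong ((1ℚ + ι (suc k)) *_) (ι-0C (suc k)) ⟩
  (1ℚ + ι (suc k)) * 0ℚ                    ≡⟨ ℚ.*-zeroʳ (1ℚ + ι (suc k)) ⟩
  0ℚ                                       ≡⟨ sym (ℚ.*-zeroʳ (0ℚ - ι (suc k))) ⟩
  (0ℚ - ι (suc k)) * 0ℚ                    ≡⟨ cong ((0ℚ - ι (suc k)) *_) (sym (ι-0C k)) ⟩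
  (0ℚ - ι (suc k)) * ι (0 C suc k)         ∎
  where open ≡-Reasoning
choose-step (suc n) zero = begin
  1ℚ * ι (suc n C 1)                       ≡⟨ cong (1ℚ *_) (ι-pascal n 0) ⟩
  1ℚ * (ι (n C 0) + ι (n C 1))             ≡⟨ l₁ (ι (n C 0)) (ι (n C 1)) ⟩
  ι (n C 0) + (1ℚ + 0ℚ) * ι (n C 1)        ≡⟨ cong (λ z → ι (n C 0) + z) (choose-step n 0) ⟩
  ι (n C 0) + (ι n - 0ℚ) * ι (n C 0)       ≡⟨ l₂ (ι n) (ι (n C 0)) ⟩
  ((1ℚ + ι n) - 0ℚ) * ι (n C 0)            ≡⟨ cong₂ (λ u v → (u - 0ℚ) * ι v) (sym (ι-suc n)) (trans (nC0≡1 n) (sym (nC0≡1 (suc n)))) ⟩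
  (ι (suc n) - 0ℚ) * ι (suc n C 0)         ∎
  where
  open ≡-Reasoning
  l₁ : ∀ a b → 1ℚ * (a + b) ≡ a + (1ℚ + 0ℚ) * b
  l₁ = solve-∀ ℚ-ring
  l₂ : ∀ n a → a + (n - 0ℚ) * a ≡ ((1ℚ + n) - 0ℚ) * a
  l₂ = solve-∀ ℚ-ring
choose-step (suc n) (suc k) = begin
  (1ℚ + ι (suc k)) * ι (suc n C suc (suc k))               ≡⟨ cong ((1ℚ + ι (suc k)) *_) (ι-pascal n (suc k)) ⟩
  (1ℚ + ι (suc k)) * (b + c)                               ≡⟨ ℚ.*-distribˡ-+ (1ℚ + ι (suc k)) b c ⟩
  (1ℚ + ι (suc k)) * b + (1ℚ + ι (suc k)) * c              ≡⟨ cong (λ z → (1ℚ + ι (suc k)) * b + z) (choose-step n (suc k)) ⟩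
  (1ℚ + ι (suc k)) * b + (ι n - ι (suc k)) * b             ≡⟨ cong (λ z → (1ℚ + z) * b + (ι n - z) * b) (ι-suc k) ⟩
  (1ℚ + (1ℚ + ι k)) * b + (ι n - (1ℚ + ι k)) * b           ≡⟨ l₁ (ι n) (ι k) b ⟩
  (1ℚ + ι k) * b + (ι n - ι k) * b                         ≡⟨ cong (_+ (ι n - ι k) * b) (choose-step n k) ⟩
  (ι n - ι k) * a + (ι n - ι k) * b                        ≡⟨ l₂ (ι n) (ι k) a b ⟩
  ((1ℚ + ι n) - (1ℚ + ι k)) * (a + b)                      ≡⟨ cong₂ (λ u v → (u - v) * (a + b)) (sym (ι-suc n)) (sym (ι-suc k)) ⟩
  (ι (suc n) - ι (suc k)) * (a + b)                        ≡⟨ cong ((ι (suc n) - ι (suc k)) *_) (sym (ι-pascal n k)) ⟩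
  (ι (suc n) - ι (suc k)) * ι (suc n C suc k)              ∎
  where
  open ≡-Reasoning
  a b c : ℚ
  a = ι (n C k)
  b = ι (n C suc k)
  c = ι (n C suc (suc k))
  l₁ : ∀ n k b → (1ℚ + (1ℚ + k)) * b + (n - (1ℚ + k)) * b ≡ (1ℚ + k) * b + (n - k) * b
  l₁ = solve-∀ ℚ-ring
  l₂ : ∀ n k a b → (n - k) * a + (n - k) * b ≡ ((1ℚ + n) - (1ℚ + k)) * (a + b)
  l₂ = solve-∀ ℚ-ring

choose-absorb : ∀ n k → (1ℚ + ι k) * ι (suc n C suc k) ≡ (1ℚ + ι n) * ι (n C k)
choose-absorb n k = begin
  (1ℚ + ι k) * ι (suc n C suc k)                   ≡⟨ cong ((1ℚ + ι k) *_) (ι-pascal n k) ⟩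
  (1ℚ + ι k) * (a + b)                             ≡⟨ ℚ.*-distribˡ-+ (1ℚ + ι k) a b ⟩
  (1ℚ + ι k) * a + (1ℚ + ι k) * b                  ≡⟨ cong (λ z → (1ℚ + ι k) * a + z) (choose-step n k) ⟩
  (1ℚ + ι k) * a + (ι n - ι k) * a                 ≡⟨ l₁ (ι n) (ι k) a ⟩
  (1ℚ + ι n) * a                                   ∎
  where
  open ≡-Reasoning
  a b : ℚ
  a = ι (n C k)
  b = ι (n C suc k)
  l₁ : ∀ n k a → (1ℚ + k) * a + (n - k) * a ≡ (1ℚ + n) * a
  l₁ = solve-∀ ℚ-ring

1/-inv : ∀ k → (1ℚ + ι k) * 1/[1+ k ] ≡ 1ℚ
1/-inv k = trans (cong (_* 1/[1+ k ]) (sym (ι-suc k))) (1/[1+]-inverse k)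

-- Q k x = C(x,k) C(-1-x,k), which at a natural number n equals (-1)^k C(n,k) C(n+k,k).
Q : ℕ → ℚ → ℚ
Q zero y = 1ℚ
Q (suc k) y = Q k y * ((ι k - y) * (y + 1ℚ + ι k) * (1/[1+ k ] * 1/[1+ k ]))

-- This is C(y,k) C(-y,k), the common part of Q_k(y) = C(y,k) C(-1-y,k) and Q_k(y-1) = C(y-1,k)
-- C(-y,k).
R : ℕ → ℚ → ℚ
R zero y = 1ℚ
R (suc k) y = R k y * ((ι k * ι k - y * y) * (1/[1+ k ] * 1/[1+ k ]))

-- The product Π_{1≤i≤k} (1 - z/i²). At z = y² it equals C(y-1,k) C(-1-y,k).
W : ℕ → ℚ → ℚ
W zero z = 1ℚ
W (suc k) z = W k z * (1ℚ - z * (1/[1+ k ] * 1/[1+ k ]))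

binom-Q : ∀ k x → binom x k * binom (- 1ℚ - x) k ≡ Q k x
binom-Q zero x = refl
binom-Q (suc k) x = trans (lem x (ι k) 1/[1+ k ] (binom x k) (binom (- 1ℚ - x) k))
  (cong (_* ((ι k - x) * (x + 1ℚ + ι k) * (1/[1+ k ] * 1/[1+ k ]))) (binom-Q k x))
  where
  lem : ∀ x k d a b → a * ((x - k) * d) * (b * (((- 1ℚ - x) - k) * d)) ≡ a * b * ((k - x) * (x + 1ℚ + k) * (d * d))
  lem = solve-∀ ℚ-ring

-- Both sides have the same ratio of consecutive terms in k: `choose-step` supplies it for the first
-- binomial and `choose-absorb` for the second. The factor (k + 1)² clears the denominators.
choose-Q : ∀ n k → ι (n C k) * ι ((n ℕ.+ k) C k) * pow (- 1ℚ) k ≡ Q k (ι n)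
choose-Q n zero = cong₂ (λ a b → ι a * ι b * 1ℚ) (nC0≡1 n) (nC0≡1 (n ℕ.+ 0))
choose-Q n (suc k) = *-cancel-unit u (d * d) unit (begin
  u * (ι (n C suc k) * ι ((n ℕ.+ suc k) C suc k) * (- 1ℚ * s))
    ≡⟨ cong (λ m → u * (ι (n C suc k) * ι (m C suc k) * (- 1ℚ * s))) (ℕₚ.+-suc n k) ⟩
  u * (ι (n C suc k) * ι (suc (n ℕ.+ k) C suc k) * (- 1ℚ * s))
    ≡⟨ l₁ (1ℚ + ι k) (ι (n C suc k)) (ι (suc (n ℕ.+ k) C suc k)) s ⟩
  (1ℚ + ι k) * ι (n C suc k) * ((1ℚ + ι k) * ι (suc (n ℕ.+ k) C suc k)) * (- 1ℚ * s)
    ≡⟨ cong₂ (λ a b → a * b * (- 1ℚ * s)) (choose-step n k) (trans (choose-absorb (n ℕ.+ k) k) (cong (λ z → (1ℚ + z) * ι ((n ℕ.+ k) C k)) (ι-+ n k))) ⟩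
  (ι n - ι k) * ι (n C k) * ((1ℚ + (ι n + ι k)) * ι ((n ℕ.+ k) C k)) * (- 1ℚ * s)
    ≡⟨ l₂ (ι n) (ι k) (ι (n C k)) (ι ((n ℕ.+ k) C k)) s ⟩
  1ℚ * (ι (n C k) * ι ((n ℕ.+ k) C k) * s * ((ι k - ι n) * (ι n + 1ℚ + ι k)))
    ≡⟨ cong₂ (λ a b → a * (b * ((ι k - ι n) * (ι n + 1ℚ + ι k)))) (sym unit) (choose-Q n k) ⟩
  u * (d * d) * (Q k (ι n) * ((ι k - ι n) * (ι n + 1ℚ + ι k)))
    ≡⟨ l₃ u (d * d) (Q k (ι n)) ((ι k - ι n) * (ι n + 1ℚ + ι k)) ⟩
  u * (Q k (ι n) * ((ι k - ι n) * (ι n + 1ℚ + ι k) * (d * d)))  ∎)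
  where
  open ≡-Reasoning
  d u s : ℚ
  d = 1/[1+ k ]
  u = (1ℚ + ι k) * (1ℚ + ι k)
  s = pow (- 1ℚ) k
  l₀ : ∀ a d → a * a * (d * d) ≡ a * d * (a * d)
  l₀ = solve-∀ ℚ-ring
  unit : u * (d * d) ≡ 1ℚ
  unit = trans (l₀ (1ℚ + ι k) d) (cong₂ _*_ (1/-inv k) (1/-inv k))
  l₁ : ∀ u a b s → u * u * (a * b * (- 1ℚ * s)) ≡ u * a * (u * b) * (- 1ℚ * s)
  l₁ = solve-∀ ℚ-ring
  l₂ : ∀ n k a b s → (n - k) * a * ((1ℚ + (n + k)) * b) * (- 1ℚ * s) ≡ 1ℚ * (a * b * s * ((k - n) * (n + 1ℚ + k)))
  l₂ = solve-∀ ℚ-ring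
  l₃ : ∀ u d q z → u * d * (q * z) ≡ u * (q * (z * d))
  l₃ = solve-∀ ℚ-ring

Q-vanishes : ∀ n k → n < k → Q k (ι n) ≡ 0ℚ
Q-vanishes n (suc k) (s≤s n≤k) = helper (ℕₚ.m≤n⇒m<n∨m≡n n≤k)
  where
  l₁ : ∀ q a b d → q * ((a - a) * b * d) ≡ 0ℚ
  l₁ = solve-∀ ℚ-ring
  z : ℚ
  z = (ι k - ι n) * (ι n + 1ℚ + ι k) * (1/[1+ k ] * 1/[1+ k ])
  helper : n < k ⊎ n ≡ k → Q k (ι n) * z ≡ 0ℚ
  helper (inj₁ n<k) = trans (cong (_* z) (Q-vanishes n k n<k)) (ℚ.*-zeroˡ z)
  helper (inj₂ refl) = l₁ (Q k (ι n)) (ι n) (ι n + 1ℚ + ι n) (1/[1+ k ] * 1/[1+ k ])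

-- The upper bound N is the same for all n < N, which allows the sums over n and k to be
-- interchanged. The added terms vanish by `Q-vanishes`.
V≡ΣQQ : ∀ {n N} x → n < N → V n x ≡ sumTo N (λ k → Q k (ι n) * Q k x)
V≡ΣQQ {n} {N} x n<N = begin
  V n x
    ≡⟨ sum-cong (suc n) (λ k → trans (lem (ι (n C k)) (ι ((n ℕ.+ k) C k)) (pow (- 1ℚ) k) (binom x k) (binom (- 1ℚ - x) k))
                                     (cong₂ _*_ (choose-Q n k) (binom-Q k x))) ⟩
  sumTo (suc n) f
    ≡⟨ sym (sum-extend (suc n) (N ∸ suc n) f (λ k n<k → trans (cong (_* Q k x) (Q-vanishes n k n<k)) (ℚ.*-zeroˡ (Q k x)))) ⟩
  sumTo (N ∸ suc n ℕ.+ suc n) f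
    ≡⟨ cong (λ m → sumTo m f) (ℕₚ.m∸n+n≡m n<N) ⟩
  sumTo N f ∎
  where
  open ≡-Reasoning
  f : ℕ → ℚ
  f k = Q k (ι n) * Q k x
  lem : ∀ a b s c d → a * b * s * c * d ≡ a * b * s * (c * d)
  lem = solve-∀ ℚ-ring

-- Together with the next lemma this makes n W_k(n²) a summation of (2k + 1) Q_k(n) over n: its
-- values at n and n + 1 are (n - k) Q_k(n) and (n + 1 + k) Q_k(n), and these differ by (2k + 1)
-- Q_k(n).
y*W≡[y-k]*Q : ∀ k y → y * W k (y * y) ≡ (y - ι k) * Q k y
y*W≡[y-k]*Q zero y = lem y
  where
  lem : ∀ y → y * 1ℚ ≡ (y - 0ℚ) * 1ℚ
  lem = solve-∀ ℚ-ring
y*W≡[y-k]*Q (suc k) y = begin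
  y * (W k (y * y) * (1ℚ - y * y * (d * d)))              ≡⟨ sym (ℚ.*-assoc y (W k (y * y)) (1ℚ - y * y * (d * d))) ⟩
  y * W k (y * y) * (1ℚ - y * y * (d * d))                ≡⟨ cong₂ (λ a b → a * (b * b - y * y * (d * d))) (y*W≡[y-k]*Q k y) (sym (1/-inv k)) ⟩
  (y - ι k) * Q k y * (m * d * (m * d) - y * y * (d * d)) ≡⟨ lem y (ι k) (Q k y) d ⟩
  (y - m) * (Q k y * ((ι k - y) * (y + 1ℚ + ι k) * (d * d))) ≡⟨ cong (λ z → (y - z) * Q (suc k) y) (sym (ι-suc k)) ⟩
  (y - ι (suc k)) * Q (suc k) y                           ∎
  where
  open ≡-Reasoning
  d m : ℚ
  d = 1/[1+ k ]
  m = 1ℚ + ι k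
  lem : ∀ y k q d → (y - k) * q * ((1ℚ + k) * d * ((1ℚ + k) * d) - y * y * (d * d)) ≡ (y - (1ℚ + k)) * (q * ((k - y) * (y + 1ℚ + k) * (d * d)))
  lem = solve-∀ ℚ-ring

y*W≡[y+k]*Q[y-1] : ∀ k y → y * W k (y * y) ≡ (y + ι k) * Q k (y - 1ℚ)
y*W≡[y+k]*Q[y-1] zero y = lem y
  where
  lem : ∀ y → y * 1ℚ ≡ (y + 0ℚ) * 1ℚ
  lem = solve-∀ ℚ-ring
y*W≡[y+k]*Q[y-1] (suc k) y = begin
  y * (W k (y * y) * (1ℚ - y * y * (d * d)))              ≡⟨ sym (ℚ.*-assoc y (W k (y * y)) (1ℚ - y * y * (d * d))) ⟩
  y * W k (y * y) * (1ℚ - y * y * (d * d))                ≡⟨ cong₂ (λ a b → a * (b * b - y * y * (d * d))) (y*W≡[y+k]*Q[y-1] k y) (sym (1/-inv k)) ⟩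
  (y + ι k) * q * (m * d * (m * d) - y * y * (d * d))     ≡⟨ lem y (ι k) q d ⟩
  (y + m) * (q * ((ι k - (y - 1ℚ)) * (y - 1ℚ + 1ℚ + ι k) * (d * d))) ≡⟨ cong (λ z → (y + z) * Q (suc k) (y - 1ℚ)) (sym (ι-suc k)) ⟩
  (y + ι (suc k)) * Q (suc k) (y - 1ℚ)                    ∎
  where
  open ≡-Reasoning
  d m q : ℚ
  d = 1/[1+ k ]
  m = 1ℚ + ι k
  q = Q k (y - 1ℚ)
  lem : ∀ y k q d → (y + k) * q * ((1ℚ + k) * d * ((1ℚ + k) * d) - y * y * (d * d)) ≡ (y + (1ℚ + k)) * (q * ((k - (y - 1ℚ)) * (y - 1ℚ + 1ℚ + k) * (d * d)))
  lem = solve-∀ ℚ-ring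

-- Because C(-1-y,k) = C(-y,k) (y + k)/y; in the companion lemma C(y-1,k) = C(y,k) (y - k)/y. The
-- factor y keeps both identities polynomial.
y*Q≡[y+k]*R : ∀ k y → y * Q k y ≡ (y + ι k) * R k y
y*Q≡[y+k]*R zero y = lem y
  where
  lem : ∀ y → y * 1ℚ ≡ (y + 0ℚ) * 1ℚ
  lem = solve-∀ ℚ-ring
y*Q≡[y+k]*R (suc k) y = begin
  y * (Q k y * z)                             ≡⟨ sym (ℚ.*-assoc y (Q k y) z) ⟩
  y * Q k y * z                               ≡⟨ cong (_* z) (y*Q≡[y+k]*R k y) ⟩
  (y + ι k) * R k y * z                       ≡⟨ lem y (ι k) (R k y) 1/[1+ k ] ⟩
  (y + (1ℚ + ι k)) * R (suc k) y              ≡⟨ cong (λ w → (y + w) * R (suc k) y) (sym (ι-suc k)) ⟩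
  (y + ι (suc k)) * R (suc k) y               ∎
  where
  open ≡-Reasoning
  z : ℚ
  z = (ι k - y) * (y + 1ℚ + ι k) * (1/[1+ k ] * 1/[1+ k ])
  lem : ∀ y k r d → (y + k) * r * ((k - y) * (y + 1ℚ + k) * (d * d)) ≡ (y + (1ℚ + k)) * (r * ((k * k - y * y) * (d * d)))
  lem = solve-∀ ℚ-ring

y*Q[y-1]≡[y-k]*R : ∀ k y → y * Q k (y - 1ℚ) ≡ (y - ι k) * R k y
y*Q[y-1]≡[y-k]*R zero y = lem y
  where
  lem : ∀ y → y * 1ℚ ≡ (y - 0ℚ) * 1ℚ
  lem = solve-∀ ℚ-ring
y*Q[y-1]≡[y-k]*R (suc k) y = begin
  y * (Q k (y - 1ℚ) * z)                      ≡⟨ sym (ℚ.*-assoc y (Q k (y - 1ℚ)) z) ⟩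
  y * Q k (y - 1ℚ) * z                        ≡⟨ cong (_* z) (y*Q[y-1]≡[y-k]*R k y) ⟩
  (y - ι k) * R k y * z                       ≡⟨ lem y (ι k) (R k y) 1/[1+ k ] ⟩
  (y - (1ℚ + ι k)) * R (suc k) y              ≡⟨ cong (λ w → (y - w) * R (suc k) y) (sym (ι-suc k)) ⟩
  (y - ι (suc k)) * R (suc k) y               ∎
  where
  open ≡-Reasoning
  z : ℚ
  z = (ι k - (y - 1ℚ)) * (y - 1ℚ + 1ℚ + ι k) * (1/[1+ k ] * 1/[1+ k ])
  lem : ∀ y k r d → (y - k) * r * ((k - (y - 1ℚ)) * (y - 1ℚ + 1ℚ + k) * (d * d)) ≡ (y - (1ℚ + k)) * (r * ((k * k - y * y) * (d * d)))
  lem = solve-∀ ℚ-ring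

-- After multiplication by y both terms are multiples of `R k y`, and (2y + 1)(y + k) - (2y - 1)(y -
-- k) = 2y (2k + 1). The weight 2y + 1 is chosen so that the terms in y² cancel here.
Q-difference : ∀ k y → y ≢ 0ℚ →
  (y + y + 1ℚ) * Q k y - (y + y - 1ℚ) * Q k (y - 1ℚ) ≡ (1ℚ + 1ℚ) * ((1ℚ + (ι k + ι k)) * R k y)
Q-difference k y y≢0 = *-cancelˡ y y≢0 (begin
  y * ((y + y + 1ℚ) * Q k y - (y + y - 1ℚ) * Q k (y - 1ℚ))
    ≡⟨ l₁ y (Q k y) (Q k (y - 1ℚ)) ⟩
  (y + y + 1ℚ) * (y * Q k y) - (y + y - 1ℚ) * (y * Q k (y - 1ℚ))
    ≡⟨ cong₂ (λ a b → (y + y + 1ℚ) * a - (y + y - 1ℚ) * b) (y*Q≡[y+k]*R k y) (y*Q[y-1]≡[y-k]*R k y) ⟩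
  (y + y + 1ℚ) * ((y + ι k) * R k y) - (y + y - 1ℚ) * ((y - ι k) * R k y)
    ≡⟨ l₂ y (ι k) (R k y) ⟩
  y * ((1ℚ + 1ℚ) * ((1ℚ + (ι k + ι k)) * R k y)) ∎)
  where
  open ≡-Reasoning
  l₁ : ∀ y a b → y * ((y + y + 1ℚ) * a - (y + y - 1ℚ) * b) ≡ (y + y + 1ℚ) * (y * a) - (y + y - 1ℚ) * (y * b)
  l₁ = solve-∀ ℚ-ring
  l₂ : ∀ y k r → (y + y + 1ℚ) * ((y + k) * r) - (y + y - 1ℚ) * ((y - k) * r) ≡ y * ((1ℚ + 1ℚ) * ((1ℚ + (k + k)) * r))
  l₂ = solve-∀ ℚ-ring

ΣQ : ∀ k N → (1ℚ + (ι k + ι k)) * sumTo N (λ n → Q k (ι n)) ≡ ι N * W k (ι N * ι N)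
ΣQ k zero = trans (ℚ.*-zeroʳ (1ℚ + (ι k + ι k))) (sym (ℚ.*-zeroˡ (W k (0ℚ * 0ℚ))))
ΣQ k (suc N) = begin
  c * (sumTo N (λ n → Q k (ι n)) + Q k (ι N))              ≡⟨ ℚ.*-distribˡ-+ c (sumTo N (λ n → Q k (ι n))) (Q k (ι N)) ⟩
  c * sumTo N (λ n → Q k (ι n)) + c * Q k (ι N)            ≡⟨ cong (_+ c * Q k (ι N)) (trans (ΣQ k N) (y*W≡[y-k]*Q k (ι N))) ⟩
  (ι N - ι k) * Q k (ι N) + c * Q k (ι N)                  ≡⟨ l₁ (ι N) (ι k) (Q k (ι N)) ⟩
  (1ℚ + ι N + ι k) * Q k (ι N)                             ≡⟨ cong₂ (λ a b → (a + ι k) * Q k b) (sym (ι-suc N)) (trans (l₂ (ι N)) (cong (_- 1ℚ) (sym (ι-suc N)))) ⟩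
  (ι (suc N) + ι k) * Q k (ι (suc N) - 1ℚ)                 ≡⟨ sym (y*W≡[y+k]*Q[y-1] k (ι (suc N))) ⟩
  ι (suc N) * W k (ι (suc N) * ι (suc N))                  ∎
  where
  open ≡-Reasoning
  c : ℚ
  c = 1ℚ + (ι k + ι k)
  l₁ : ∀ n k q → (n - k) * q + (1ℚ + (k + k)) * q ≡ (1ℚ + n + k) * q
  l₁ = solve-∀ ℚ-ring
  l₂ : ∀ n → n ≡ (1ℚ + n) - 1ℚ
  l₂ = solve-∀ ℚ-ring

ΣV : ℕ → ℚ → ℚ
ΣV N x = sumTo N (λ n → V n x)

ΣV≡ΣQ : ∀ N x → ΣV N x ≡ sumTo N (λ k → Q k x * sumTo N (λ n → Q k (ι n)))
ΣV≡ΣQ N x = begin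
  sumTo N (λ n → V n x)                                     ≡⟨ sum-cong< N (λ n n<N → V≡ΣQQ x n<N) ⟩
  sumTo N (λ n → sumTo N (λ k → Q k (ι n) * Q k x))         ≡⟨ sum-swap N N (λ n k → Q k (ι n) * Q k x) ⟩
  sumTo N (λ k → sumTo N (λ n → Q k (ι n) * Q k x))         ≡⟨ sum-cong N (λ k → trans (sum-cong N (λ n → ℚ.*-comm (Q k (ι n)) (Q k x))) (sum-*ˡ N (Q k x) (λ n → Q k (ι n)))) ⟩
  sumTo N (λ k → Q k x * sumTo N (λ n → Q k (ι n)))         ∎
  where open ≡-Reasoning

D : ℕ → ℚ → ℚ
D N y = sumTo N (λ k → R k y * W k (ι N * ι N))

ΣV-difference : ∀ N y → y ≢ 0ℚ →
  (y + y + 1ℚ) * ΣV N y ≡ (y + y - 1ℚ) * ΣV N (y - 1ℚ) + (1ℚ + 1ℚ) * ι N * D N y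
ΣV-difference N y y≢0 = begin
  (y + y + 1ℚ) * ΣV N y
    ≡⟨ cong ((y + y + 1ℚ) *_) (ΣV≡ΣQ N y) ⟩
  (y + y + 1ℚ) * sumTo N (λ k → Q k y * h k)
    ≡⟨ sym (sum-*ˡ N (y + y + 1ℚ) (λ k → Q k y * h k)) ⟩
  sumTo N (λ k → (y + y + 1ℚ) * (Q k y * h k))
    ≡⟨ sum-cong N term ⟩
  sumTo N (λ k → (y + y - 1ℚ) * (Q k (y - 1ℚ) * h k) + (1ℚ + 1ℚ) * ι N * (R k y * W k (ι N * ι N)))
    ≡⟨ sum-+ N (λ k → (y + y - 1ℚ) * (Q k (y - 1ℚ) * h k)) (λ k → (1ℚ + 1ℚ) * ι N * (R k y * W k (ι N * ι N))) ⟩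
  sumTo N (λ k → (y + y - 1ℚ) * (Q k (y - 1ℚ) * h k)) + sumTo N (λ k → (1ℚ + 1ℚ) * ι N * (R k y * W k (ι N * ι N)))
    ≡⟨ cong₂ _+_ (sum-*ˡ N (y + y - 1ℚ) (λ k → Q k (y - 1ℚ) * h k)) (sum-*ˡ N ((1ℚ + 1ℚ) * ι N) (λ k → R k y * W k (ι N * ι N))) ⟩
  (y + y - 1ℚ) * sumTo N (λ k → Q k (y - 1ℚ) * h k) + (1ℚ + 1ℚ) * ι N * D N y
    ≡⟨ cong (λ z → (y + y - 1ℚ) * z + (1ℚ + 1ℚ) * ι N * D N y) (sym (ΣV≡ΣQ N (y - 1ℚ))) ⟩
  (y + y - 1ℚ) * ΣV N (y - 1ℚ) + (1ℚ + 1ℚ) * ι N * D N y ∎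
  where
  open ≡-Reasoning
  h : ℕ → ℚ
  h k = sumTo N (λ n → Q k (ι n))
  l₁ : ∀ a b c d h → a * (b * h) ≡ c * (d * h) + (a * b - c * d) * h
  l₁ = solve-∀ ℚ-ring
  l₂ : ∀ t c r h → t * (c * r) * h ≡ t * (c * h) * r
  l₂ = solve-∀ ℚ-ring
  l₃ : ∀ t n w r → t * (n * w) * r ≡ t * n * (r * w)
  l₃ = solve-∀ ℚ-ring
  term : ∀ k → (y + y + 1ℚ) * (Q k y * h k) ≡ (y + y - 1ℚ) * (Q k (y - 1ℚ) * h k) + (1ℚ + 1ℚ) * ι N * (R k y * W k (ι N * ι N))
  term k = trans (l₁ (y + y + 1ℚ) (Q k y) (y + y - 1ℚ) (Q k (y - 1ℚ)) (h k))
    (cong (λ z → (y + y - 1ℚ) * (Q k (y - 1ℚ) * h k) + z) (begin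
      ((y + y + 1ℚ) * Q k y - (y + y - 1ℚ) * Q k (y - 1ℚ)) * h k    ≡⟨ cong (_* h k) (Q-difference k y y≢0) ⟩
      -- The factor 1 + 2k passes from `R k y` to `h k`, where `ΣQ` absorbs it; division by 1 + 2k
      -- never takes place.
      (1ℚ + 1ℚ) * ((1ℚ + (ι k + ι k)) * R k y) * h k                ≡⟨ l₂ (1ℚ + 1ℚ) (1ℚ + (ι k + ι k)) (R k y) (h k) ⟩
      (1ℚ + 1ℚ) * ((1ℚ + (ι k + ι k)) * h k) * R k y                ≡⟨ cong (λ z → (1ℚ + 1ℚ) * z * R k y) (ΣQ k N) ⟩
      (1ℚ + 1ℚ) * (ι N * W k (ι N * ι N)) * R k y                   ≡⟨ l₃ (1ℚ + 1ℚ) (ι N) (W k (ι N * ι N)) (R k y) ⟩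
      (1ℚ + 1ℚ) * ι N * (R k y * W k (ι N * ι N))                   ∎))

-- The numerator with i = 0 is -y². The remaining k numerators i² - y², taken over the i² with 1 ≤ i
-- ≤ k, form `W k (y * y)`, which leaves one denominator (k + 1)².
R-suc : ∀ k y → R (suc k) y ≡ - (y * y * (1/[1+ k ] * 1/[1+ k ])) * W k (y * y)
R-suc zero y = lem y (1/[1+ 0 ])
  where
  lem : ∀ y d → 1ℚ * ((0ℚ * 0ℚ - y * y) * (d * d)) ≡ - (y * y * (d * d)) * 1ℚ
  lem = solve-∀ ℚ-ring
R-suc (suc k) y = begin
  R (suc k) y * ((ι (suc k) * ι (suc k) - y * y) * (e * e))                  ≡⟨ cong₂ (λ a b → a * ((b * b - y * y) * (e * e))) (R-suc k y) (ι-suc k) ⟩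
  - (y * y * (d * d)) * w * (((1ℚ + ι k) * (1ℚ + ι k) - y * y) * (e * e))    ≡⟨ l₁ y (1ℚ + ι k) d e w ⟩
  - (y * y * (e * e)) * (w * ((1ℚ + ι k) * d * ((1ℚ + ι k) * d) - y * y * (d * d))) ≡⟨ cong (λ z → - (y * y * (e * e)) * (w * (z * z - y * y * (d * d)))) (1/-inv k) ⟩
  - (y * y * (e * e)) * (w * (1ℚ - y * y * (d * d)))                         ∎
  where
  open ≡-Reasoning
  d e w : ℚ
  d = 1/[1+ k ]
  e = 1/[1+ suc k ]
  w = W k (y * y)
  l₁ : ∀ y m d e w → - (y * y * (d * d)) * w * ((m * m - y * y) * (e * e)) ≡ - (y * y * (e * e)) * (w * (m * d * (m * d) - y * y * (d * d)))
  l₁ = solve-∀ ℚ-ring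

-- Summation by parts, since R (suc k) y = W (suc k) y² - W k y².
ΣRW : ∀ n y z → sumTo (suc n) (λ k → R k y * W k z) ≡
  W n (y * y) * W n z + z * sumTo n (λ k → W k (y * y) * W k z * (1/[1+ k ] * 1/[1+ k ]))
ΣRW zero y z = lem z
  where
  lem : ∀ z → 0ℚ + 1ℚ * 1ℚ ≡ 1ℚ * 1ℚ + z * 0ℚ
  lem = solve-∀ ℚ-ring
ΣRW (suc n) y z = trans (cong₂ (λ a b → a + b * W (suc n) z) (ΣRW n y z) (R-suc n y))
  (lem (W n (y * y)) (W n z) (sumTo n (λ k → W k (y * y) * W k z * (1/[1+ k ] * 1/[1+ k ]))) y z (1/[1+ n ]))
  where
  lem : ∀ w w′ s y z d → (w * w′ + z * s) + - (y * y * (d * d)) * w * (w′ * (1ℚ - z * (d * d))) ≡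
    w * (1ℚ - y * y * (d * d)) * (w′ * (1ℚ - z * (d * d))) + z * (s + w * w′ * (d * d))
  lem = solve-∀ ℚ-ring

-- Telescopes, since W_k(z) - W_{k+1}(z) = W_k(z) z/(k + 1)². It evaluates the last sum of `ΣRW`
-- modulo p, where the factors `W k z` with z = p² are 1.
ΣW/k² : ∀ n y → y * y * sumTo n (λ k → W k (y * y) * (1/[1+ k ] * 1/[1+ k ])) ≡ 1ℚ - W n (y * y)
ΣW/k² zero y = lem y
  where
  lem : ∀ y → y * y * 0ℚ ≡ 1ℚ - 1ℚ
  lem = solve-∀ ℚ-ring
ΣW/k² (suc n) y = trans (ℚ.*-distribˡ-+ (y * y) s (w * (1/[1+ n ] * 1/[1+ n ])))
  (trans (cong (_+ y * y * (w * (1/[1+ n ] * 1/[1+ n ]))) (ΣW/k² n y)) (lem y w 1/[1+ n ]))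
  where
  w s : ℚ
  w = W n (y * y)
  s = sumTo n (λ k → W k (y * y) * (1/[1+ k ] * 1/[1+ k ]))
  lem : ∀ y w d → (1ℚ - w) + y * y * (w * (d * d)) ≡ 1ℚ - w * (1ℚ - y * y * (d * d))
  lem = solve-∀ ℚ-ring

-- Up to the same denominators W_n(y²) is Π (i - y)(i + y). Replacing y by y - 1 shifts each of the
-- two runs of factors by one, so only their end factors change.
W-shift : ∀ n y → y * (1ℚ + ι n - y) * W n (y * y) ≡ (1ℚ - y) * (y + ι n) * W n ((y - 1ℚ) * (y - 1ℚ))
W-shift zero y = lem y
  where
  lem : ∀ y → y * (1ℚ + 0ℚ - y) * 1ℚ ≡ (1ℚ - y) * (y + 0ℚ) * 1ℚ
  lem = solve-∀ ℚ-ring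
W-shift (suc n) y = begin
  y * (1ℚ + ι (suc n) - y) * (w * (1ℚ - y * y * (d * d)))
    ≡⟨ cong₂ (λ a b → y * (1ℚ + a - y) * (w * (b * b - y * y * (d * d)))) (ι-suc n) (sym (1/-inv n)) ⟩
  y * (1ℚ + m - y) * (w * (m * d * (m * d) - y * y * (d * d)))
    ≡⟨ l₁ y m d w ⟩
  (1ℚ + m - y) * (m + y) * (d * d) * (y * (m - y) * w)
    ≡⟨ cong ((1ℚ + m - y) * (m + y) * (d * d) *_) (W-shift n y) ⟩
  (1ℚ + m - y) * (m + y) * (d * d) * ((1ℚ - y) * (y + ι n) * w′)
    ≡⟨ l₂ y (ι n) d w′ ⟩
  (1ℚ - y) * (y + m) * (w′ * (m * d * (m * d) - (y - 1ℚ) * (y - 1ℚ) * (d * d)))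
    ≡⟨ cong₂ (λ a b → (1ℚ - y) * (y + a) * (w′ * (b * b - (y - 1ℚ) * (y - 1ℚ) * (d * d)))) (sym (ι-suc n)) (1/-inv n) ⟩
  (1ℚ - y) * (y + ι (suc n)) * (w′ * (1ℚ - (y - 1ℚ) * (y - 1ℚ) * (d * d))) ∎
  where
  open ≡-Reasoning
  d m w w′ : ℚ
  d = 1/[1+ n ]
  m = 1ℚ + ι n
  w = W n (y * y)
  w′ = W n ((y - 1ℚ) * (y - 1ℚ))
  l₁ : ∀ y m d w → y * (1ℚ + m - y) * (w * (m * d * (m * d) - y * y * (d * d))) ≡ (1ℚ + m - y) * (m + y) * (d * d) * (y * (m - y) * w)
  l₁ = solve-∀ ℚ-ring
  l₂ : ∀ y n d w → (1ℚ + (1ℚ + n) - y) * ((1ℚ + n) + y) * (d * d) * ((1ℚ - y) * (y + n) * w) ≡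
    (1ℚ - y) * (y + (1ℚ + n)) * (w * ((1ℚ + n) * d * ((1ℚ + n) * d) - (y - 1ℚ) * (y - 1ℚ) * (d * d)))
  l₂ = solve-∀ ℚ-ring

-- The sum D modulo p³

1/k² : ℕ → ℚ
1/k² k = 1/[1+ k ] * 1/[1+ k ]

H₂ : ℕ → ℚ
H₂ n = sumTo n 1/k²

-- The congruence for Σ_{i<p} 1/i² is a parameter here because it is derived further on, from
-- Bernoulli polynomials.
module SumOfV (p : ℕ) (p-prime : Prime p) (H₂[p-1]≋0 : Congruences._≋_[_] p p-prime (H₂ (p ∸ 1)) 0ℚ 1) where
  open Congruences p p-prime

  n : ℕ
  n = p ∸ 1

  1+n≡p : suc n ≡ p
  1+n≡p = ℕₚ.m+[n∸m]≡n (ℕₚ.<⇒≤ 1<p)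

  1+ιn≡ιp : 1ℚ + ι n ≡ ι p
  1+ιn≡ιp = trans (sym (ι-suc n)) (cong ι 1+n≡p)

  p∤≤n : ∀ {k} → k < n → ¬ p ∣ suc k
  p∤≤n {k} k<n = p∤< k (subst (suc k <_) 1+n≡p (s≤s k<n))

  int-1/k : ∀ {k} → k < n → Integral 1/[1+ k ]
  int-1/k {k} k<n = int-1/[1+] k (p∤≤n k<n)

  int-1/k² : ∀ {k} → k < n → Integral (1/k² k)
  int-1/k² k<n = int-* (int-1/k k<n) (int-1/k k<n)

  int-H₂ : ∀ {k} → k ≤ n → Integral (H₂ k)
  int-H₂ {k} k≤n = int-sum k (λ i i<k → int-1/k² (ℕₚ.<-≤-trans i<k k≤n))

  int-W : ∀ k {z} → k ≤ n → Integral z → Integral (W k z)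
  int-W zero k≤n i = int-1
  int-W (suc k) k<n i = int-* (int-W k (ℕₚ.<⇒≤ k<n) i) (int-- int-1 (int-* i (int-1/k² k<n)))

  ≋0⇒int : ∀ {z j} → z ≋ 0ℚ [ j ] → Integral z
  ≋0⇒int = ≋-int int-0

  W≋1 : ∀ k {z j} → k ≤ n → z ≋ 0ℚ [ j ] → W k z ≋ 1ℚ [ j ]
  W≋1 zero k≤n e = ≋-refl
  W≋1 (suc k) {z} {j} k<n e = subst (W (suc k) z ≋_[ j ]) (lem (1/k² k))
    (≋-* int-1 (int-- int-1 (int-* (≋0⇒int e) (int-1/k² k<n))) (W≋1 k (ℕₚ.<⇒≤ k<n) e)
      (≋-- {a = 1ℚ} ≋-refl (≋-*ʳ (1/k² k) (int-1/k² k<n) e)))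
    where
    lem : ∀ d → 1ℚ * (1ℚ - 0ℚ * d) ≡ 1ℚ
    lem = solve-∀ ℚ-ring

  -- In the expansion of the product every term beyond the linear one contains z², which is
  -- divisible by p⁴.
  W≋1-zH₂ : ∀ k {z} → k ≤ n → z ≋ 0ℚ [ 2 ] → W k z ≋ 1ℚ - z * H₂ k [ 3 ]
  W≋1-zH₂ zero {z} k≤n e = ≋-reflexive (lem z)
    where
    lem : ∀ z → 1ℚ ≡ 1ℚ - z * 0ℚ
    lem = solve-∀ ℚ-ring
  W≋1-zH₂ (suc k) {z} k<n e = ≋-trans
    (≋-*ʳ (1ℚ - z * 1/k² k) (int-- int-1 (int-* z-int (int-1/k² k<n))) (W≋1-zH₂ k k≤n e))
    (subst₂ (_≋_[ 3 ]) (sym (l₁ z (H₂ k) (1/k² k))) (l₂ z (H₂ k) (1/k² k))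
      (≋-+ {a = 1ℚ - z * (H₂ k + 1/k² k)} ≋-refl
        (≋0-*ʳ (H₂ k * 1/k² k) (int-* (int-H₂ k≤n) (int-1/k² k<n)) z²≋0)))
    where
    k≤n = ℕₚ.<⇒≤ k<n
    z-int = ≋0⇒int e
    z²≋0 : z * z ≋ 0ℚ [ 3 ]
    z²≋0 = ≋-weaken 1 (subst (z * z ≋_[ 4 ]) (ℚ.*-zeroʳ z) (≋-absorb {j = 2} e e))
    l₁ : ∀ z h d → (1ℚ - z * h) * (1ℚ - z * d) ≡ (1ℚ - z * (h + d)) + z * z * (h * d)
    l₁ = solve-∀ ℚ-ring
    l₂ : ∀ z h d → (1ℚ - z * (h + d)) + 0ℚ ≡ 1ℚ - z * (h + d)
    l₂ = solve-∀ ℚ-ring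

  p² : ℚ
  p² = ι p * ι p

  ≋0-* : ∀ {a b i j} → a ≋ 0ℚ [ i ] → b ≋ 0ℚ [ j ] → a * b ≋ 0ℚ [ i ℕ.+ j ]
  ≋0-* {a} {b} {i} {j} e f = subst (a * b ≋_[ i ℕ.+ j ]) (ℚ.*-zeroʳ a) (≋-absorb {j = i} e f)

  p²≋0 : p² ≋ 0ℚ [ 2 ]
  p²≋0 = ≋0-* p≋0 p≋0

  D-expand : ∀ y → D p y ≡ W n (y * y) * W n p² + p² * sumTo n (λ k → W k (y * y) * W k p² * 1/k² k)
  D-expand y = trans (cong (λ m → sumTo m (λ k → R k y * W k p²)) (sym 1+n≡p)) (ΣRW n y p²)

  -- Both y² and p² are divisible by p². Hence the two products in `D-expand` are 1 - z H₂(p-1) ≡ 1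
  -- modulo p³, and the last sum contributes p² H₂(p-1) ≡ 0.
  D≋1 : ∀ t → Integral t → D p (ι p * t) ≋ 1ℚ [ 3 ]
  D≋1 t t-int = subst (_≋ 1ℚ [ 3 ]) (sym (D-expand y)) (≋-trans
    (≋-+ (≋-* int-1 (int-W n ℕₚ.≤-refl (≋0⇒int p²≋0)) (W≋1₃ y²≋0) (W≋1₃ p²≋0))
      (≋0-* {i = 2} p²≋0 (≋-trans (≋-sum n term) H₂[p-1]≋0)))
    (≋-reflexive l₃))
    where
    y : ℚ
    y = ι p * t
    y≋0 : y ≋ 0ℚ [ 1 ]
    y≋0 = ≋0-*ʳ t t-int p≋0
    y²≋0 : y * y ≋ 0ℚ [ 2 ]
    y²≋0 = ≋0-* y≋0 y≋0
    l₃ : 1ℚ * 1ℚ + 0ℚ ≡ 1ℚ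
    l₃ = refl
    W≋1₃ : ∀ {z} → z ≋ 0ℚ [ 2 ] → W n z ≋ 1ℚ [ 3 ]
    W≋1₃ {z} e = ≋-trans (W≋1-zH₂ n ℕₚ.≤-refl e) (≋-- {a = 1ℚ} {d = 0ℚ} ≋-refl (≋0-* {i = 2} e H₂[p-1]≋0))
    term : ∀ k → k < n → W k (y * y) * W k p² * 1/k² k ≋ 1/k² k [ 1 ]
    term k k<n = ≋-trans (≋-*ʳ (1/k² k) (int-1/k² k<n)
      (≋-weaken 1 (≋-* int-1 (int-W k k≤n (≋0⇒int p²≋0)) (W≋1 k k≤n y²≋0) (W≋1 k k≤n p²≋0))))
      (≋-reflexive (ℚ.*-identityˡ (1/k² k)))
      where k≤n = ℕₚ.<⇒≤ k<n

  module _ (t : ℚ) (t-int : Integral t) where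

    y[_] : ℕ → ℚ
    y[ j ] = ι p * t + ι j

    -- For 0 < j < p the factors i = j and i = p - j of this product are divisible by p, so its
    -- value modulo p³ requires the remaining factors only modulo p. Instead of evaluating those,
    -- the proof carries the value from each j to the next by `A-shift`.
    A : ℕ → ℚ
    A j = W n (y[ j ] * y[ j ])

    c : ℚ
    c = p² * (t * t + t)

    c≋0 : c ≋ 0ℚ [ 2 ]
    c≋0 = ≋0-*ʳ (t * t + t) (int-+ (int-* t-int t-int) t-int) p²≋0

    int-y : ∀ j → Integral y[ j ]
    int-y j = int-+ (int-* (int-ι p) t-int) (int-ι j)

    y≋j : ∀ j → y[ j ] ≋ ι j [ 1 ]
    y≋j j = subst (y[ j ] ≋_[ 1 ]) (ℚ.+-identityˡ (ι j)) (≋-+ (≋0-*ʳ t t-int p≋0) ≋-refl)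

    y-suc : ∀ j → y[ suc j ] - 1ℚ ≡ y[ j ]
    y-suc j = trans (cong (λ z → ι p * t + z - 1ℚ) (ι-suc j)) (lem (ι p * t) (ι j))
      where
      lem : ∀ a b → a + (1ℚ + b) - 1ℚ ≡ a + b
      lem = solve-∀ ℚ-ring

    A-shift : ∀ j → y[ suc j ] * (ι p - y[ suc j ]) * A (suc j) ≡ - y[ j ] * (ι p + y[ j ]) * A j
    A-shift j = begin
      y[ suc j ] * (ι p - y[ suc j ]) * A (suc j)            ≡⟨ cong (λ z → y[ suc j ] * (z - y[ suc j ]) * A (suc j)) (sym 1+ιn≡ιp) ⟩
      y[ suc j ] * (1ℚ + ι n - y[ suc j ]) * A (suc j)       ≡⟨ W-shift n y[ suc j ] ⟩
      (1ℚ - y[ suc j ]) * (y[ suc j ] + ι n) * W n ((y[ suc j ] - 1ℚ) * (y[ suc j ] - 1ℚ))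
        ≡⟨ cong₂ _*_ (l₁ y[ suc j ] (ι n)) refl ⟩
      - (y[ suc j ] - 1ℚ) * ((1ℚ + ι n) + (y[ suc j ] - 1ℚ)) * W n ((y[ suc j ] - 1ℚ) * (y[ suc j ] - 1ℚ))
        ≡⟨ cong₂ (λ u v → - u * (v + u) * W n (u * u)) (y-suc j) 1+ιn≡ιp ⟩
      - y[ j ] * (ι p + y[ j ]) * A j                        ∎
      where
      open ≡-Reasoning
      l₁ : ∀ y n → (1ℚ - y) * (y + n) ≡ - (y - 1ℚ) * ((1ℚ + n) + (y - 1ℚ))
      l₁ = solve-∀ ℚ-ring

    -- The multiplier u of `A (suc j)` in `A-shift` is -(j + 1)² modulo p, hence a unit, and this
    -- forces p² to divide `A (suc j)`. Given that divisibility, u may be replaced by its residue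
    -- modulo p without leaving modulus p³.
    A-lemma : ∀ j → j < n → - y[ j ] * (ι p + y[ j ]) * A j ≋ - c [ 3 ] →
      (A (suc j) ≋ 0ℚ [ 2 ]) × (ι (suc j) * ι (suc j) * A (suc j) ≋ c [ 3 ])
    A-lemma j j<n prev = A≋0 , subst₂ (_≋_[ 3 ]) (l₃ (m * m) (A (suc j))) (l₄ c)
        (≋-neg (≋-trans (≋-sym (subst₂ (_≋_[ 3 ]) (ℚ.*-comm (A (suc j)) u) (ℚ.*-comm (A (suc j)) (- (m * m))) (≋-absorb {j = 2} A≋0 u≋-m²))) uA≋-c))
      where
      m u d : ℚ
      m = ι (suc j)
      u = y[ suc j ] * (ι p - y[ suc j ])
      d = 1/[1+ j ]
      l₁ : ∀ m → m * (0ℚ - m) ≡ - (m * m)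
      l₁ = solve-∀ ℚ-ring
      l₂ : ∀ m d → - (m * m) * - (d * d) ≡ m * d * (m * d)
      l₂ = solve-∀ ℚ-ring
      l₃ : ∀ a b → - (- a * b) ≡ a * b
      l₃ = solve-∀ ℚ-ring
      l₄ : ∀ a → - (- a) ≡ a
      l₄ = solve-∀ ℚ-ring
      u≋-m² : u ≋ - (m * m) [ 1 ]
      u≋-m² = subst (u ≋_[ 1 ]) (l₁ m) (≋-* (int-ι (suc j)) (int-- (int-ι p) (int-y (suc j))) (y≋j (suc j)) (≋-- p≋0 (y≋j (suc j))))
      u≇0 : ¬ u ≋ 0ℚ [ 1 ]
      u≇0 e = unit≇0 (- (d * d)) (trans (l₂ m d) (cong₂ _*_ (1/[1+]-inverse j) (1/[1+]-inverse j)))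
        (int-neg (int-1/k² j<n)) (≋-trans (≋-sym u≋-m²) e)
      u-int : Integral u
      u-int = int-* (int-y (suc j)) (int-- (int-ι p) (int-y (suc j)))
      uA≋-c : u * A (suc j) ≋ - c [ 3 ]
      uA≋-c = ≋-trans (≋-reflexive (A-shift j)) prev
      A≋0 : A (suc j) ≋ 0ℚ [ 2 ]
      A≋0 = ≋-cancel u (inv u) (inv-inverse u (λ u≡0 → u≇0 (≋-reflexive u≡0))) (int-inv u-int u≇0)
        (≋-trans (≋-trans (≋-weaken 1 uA≋-c) (≋-neg c≋0)) (≋-reflexive (sym (ℚ.*-zeroʳ u))))

    -- The constant c originates at y = pt, where -y (p + y) is exactly -p² (t² + t) and `A 0` ≡ 1
    -- modulo p. It is then passed on unchanged, because the multiplier -y (p + y) of `A j` is -j²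
    -- modulo p, which cancels the sign and the square in j² A(j) ≡ c.
    A-properties : ∀ j → j < n → (A (suc j) ≋ 0ℚ [ 2 ]) × (ι (suc j) * ι (suc j) * A (suc j) ≋ c [ 3 ])
    A-properties zero 0<n = A-lemma 0 0<n (subst₂ (_≋_[ 3 ]) (l₁ (ι p) t (A 0)) (l₂ (ι p) t)
        (≋-*ʳ (- (t * t + t)) (int-neg (int-+ (int-* t-int t-int) t-int)) (≋-absorb {j = 2} p²≋0 A₀≋1)))
      where
      l₁ : ∀ p t a → p * p * a * - (t * t + t) ≡ - (p * t + 0ℚ) * (p + (p * t + 0ℚ)) * a
      l₁ = solve-∀ ℚ-ring
      l₂ : ∀ p t → p * p * 1ℚ * - (t * t + t) ≡ - (p * p * (t * t + t))
      l₂ = solve-∀ ℚ-ring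
      y₀≋0 : y[ 0 ] ≋ 0ℚ [ 1 ]
      y₀≋0 = y≋j 0
      A₀≋1 : A 0 ≋ 1ℚ [ 1 ]
      A₀≋1 = W≋1 n ℕₚ.≤-refl (≋-weaken 1 (≋0-* y₀≋0 y₀≋0))
    A-properties (suc j) j<n = A-lemma (suc j) j<n (≋-trans
        (subst₂ (_≋_[ 3 ]) (ℚ.*-comm (A (suc j)) _) (ℚ.*-comm (A (suc j)) _)
          (≋-absorb {j = 2} (proj₁ prev) (≋-* (int-neg (int-ι (suc j))) (int-+ (int-ι p) (int-y (suc j))) (≋-neg (y≋j (suc j))) (≋-+ p≋0 (y≋j (suc j))))))
        (subst (_≋ - c [ 3 ]) (l₁ (ι (suc j)) (A (suc j))) (≋-neg (proj₂ prev))))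
      where
      prev = A-properties j (ℕₚ.<⇒≤ j<n)
      l₁ : ∀ m a → - (m * m * a) ≡ - m * (0ℚ + m) * a
      l₁ = solve-∀ ℚ-ring

    -- After multiplication by (j + 1)² the product in `D-expand` yields c = p² (t² + t) by
    -- `A-properties`. The sum σ yields p² · 1, because modulo p the square (j + 1)² is y², and y² σ
    -- telescopes to 1 - A(j + 1) ≡ 1.
    D≋ : ∀ j → j < n → D p y[ suc j ] ≋ p² * (t * t + t + 1ℚ) * 1/k² j [ 3 ]
    D≋ j j<n = subst₂ (_≋_[ 3 ]) refl (ℚ.*-comm (1/k² j) _)
      (≋-trans (≋-reflexive (trans (sym (ℚ.*-identityˡ (D p y))) (trans (cong (_* D p y) (sym dm)) (ℚ.*-assoc (1/k² j) (m * m) (D p y)))))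
        (≋-*ˡ (1/k² j) (int-1/k² j<n) m²D))
      where
      y m σ : ℚ
      y = y[ suc j ]
      m = ι (suc j)
      σ = sumTo n (λ k → W k (y * y) * 1/k² k)
      int-y² : Integral (y * y)
      int-y² = int-* (int-y (suc j)) (int-y (suc j))
      l₀ : ∀ m d → d * d * (m * m) ≡ m * d * (m * d)
      l₀ = solve-∀ ℚ-ring
      dm : 1/k² j * (m * m) ≡ 1ℚ
      dm = trans (l₀ m 1/[1+ j ]) (cong₂ _*_ (1/[1+]-inverse j) (1/[1+]-inverse j))
      σ-int : Integral σ
      σ-int = int-sum n (λ k k<n → int-* (int-W k (ℕₚ.<⇒≤ k<n) int-y²) (int-1/k² k<n))
      m²σ : m * m * σ ≋ 1ℚ [ 1 ]
      m²σ = ≋-trans (≋-*ʳ σ σ-int (≋-sym (≋-* (int-ι (suc j)) (int-y (suc j)) (y≋j (suc j)) (y≋j (suc j)))))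
        (≋-trans (≋-reflexive (ΣW/k² n y)) (≋-- {a = 1ℚ} {d = 0ℚ} ≋-refl (≋-weaken 1 (proj₁ (A-properties j j<n)))))
      term : ∀ k → k < n → W k (y * y) * W k p² * 1/k² k ≋ W k (y * y) * 1/k² k [ 1 ]
      term k k<n = ≋-*ʳ (1/k² k) (int-1/k² k<n) (≋-trans
        (≋-*ˡ (W k (y * y)) (int-W k k≤n int-y²) (≋-weaken 1 (W≋1 k k≤n p²≋0)))
        (≋-reflexive (ℚ.*-identityʳ (W k (y * y)))))
        where k≤n = ℕₚ.<⇒≤ k<n
      D≋A+p²σ : D p y ≋ A (suc j) * 1ℚ + p² * σ [ 3 ]
      D≋A+p²σ = ≋-trans (≋-reflexive (D-expand y)) (≋-+
        (≋-absorb {j = 2} (proj₁ (A-properties j j<n)) (≋-weaken 1 (W≋1 n ℕₚ.≤-refl p²≋0)))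
        (≋-absorb {j = 2} p²≋0 (≋-sum n term)))
      l₁ : ∀ m a p σ → m * m * (a * 1ℚ + p * σ) ≡ m * m * a + p * (m * m * σ)
      l₁ = solve-∀ ℚ-ring
      l₂ : ∀ p t → p * (t * t + t) + p * 1ℚ ≡ p * (t * t + t + 1ℚ)
      l₂ = solve-∀ ℚ-ring
      m²D : m * m * D p y ≋ p² * (t * t + t + 1ℚ) [ 3 ]
      m²D = ≋-trans (≋-*ˡ (m * m) (int-* (int-ι (suc j)) (int-ι (suc j))) D≋A+p²σ)
        (≋-trans (≋-reflexive (l₁ m (A (suc j)) p² σ))
          (≋-trans (≋-+ (proj₂ (A-properties j j<n)) (≋-absorb {j = 2} p²≋0 m²σ)) (≋-reflexive (l₂ p² t))))

-- Exponential generating functions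

-- A series f stands for Σ f n tⁿ/n!, so that the tail f ∘ suc is the
-- derivative of f and the product is determined by the Leibniz rule.
Series : Set
Series = ℕ → ℚ

infixl 6 _⊕_
infixl 7 _⊛_
infix 8 ⊖_

_⊕_ : Series → Series → Series
(f ⊕ g) n = f n + g n

⊖_ : Series → Series
(⊖ f) n = - f n

_⊛_ : Series → Series → Series
(f ⊛ g) zero = f 0 * g 0
(f ⊛ g) (suc n) = (f ∘ suc ⊛ g) n + (f ⊛ g ∘ suc) n

const : ℚ → Series
const c zero = c
const c (suc n) = 0ℚ

⊛-cong : ∀ {f f′ g g′} → f ≗ f′ → g ≗ g′ → f ⊛ g ≗ f′ ⊛ g′
⊛-cong e e′ zero = cong₂ _*_ (e 0) (e′ 0)
⊛-cong e e′ (suc n) = cong₂ _+_ (⊛-cong (e ∘ suc) e′ n) (⊛-cong e (e′ ∘ suc) n)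

⊛-comm : ∀ f g → f ⊛ g ≗ g ⊛ f
⊛-comm f g zero = ℚ.*-comm (f 0) (g 0)
⊛-comm f g (suc n) = trans (cong₂ _+_ (⊛-comm (f ∘ suc) g n) (⊛-comm f (g ∘ suc) n)) (ℚ.+-comm ((g ⊛ f ∘ suc) n) _)

⊛-distribʳ : ∀ h f g → (f ⊕ g) ⊛ h ≗ f ⊛ h ⊕ g ⊛ h
⊛-distribʳ h f g zero = ℚ.*-distribʳ-+ (h 0) (f 0) (g 0)
⊛-distribʳ h f g (suc n) = trans (cong₂ _+_ (⊛-distribʳ h (f ∘ suc) (g ∘ suc) n) (⊛-distribʳ (h ∘ suc) f g n))
  (lem ((f ∘ suc ⊛ h) n) ((g ∘ suc ⊛ h) n) ((f ⊛ h ∘ suc) n) ((g ⊛ h ∘ suc) n))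
  where
  lem : ∀ a b c d → a + b + (c + d) ≡ a + c + (b + d)
  lem = solve-∀ ℚ-ring

⊛-distribˡ : ∀ h f g → h ⊛ (f ⊕ g) ≗ h ⊛ f ⊕ h ⊛ g
⊛-distribˡ h f g n = trans (⊛-comm h (f ⊕ g) n) (trans (⊛-distribʳ h f g n) (cong₂ _+_ (⊛-comm f h n) (⊛-comm g h n)))

⊛-assoc : ∀ f g h → (f ⊛ g) ⊛ h ≗ f ⊛ (g ⊛ h)
⊛-assoc f g h zero = ℚ.*-assoc (f 0) (g 0) (h 0)
⊛-assoc f g h (suc n) = begin
  ((f ∘ suc ⊛ g ⊕ f ⊛ g ∘ suc) ⊛ h) n + ((f ⊛ g) ⊛ h ∘ suc) n
    ≡⟨ cong (_+ ((f ⊛ g) ⊛ h ∘ suc) n) (⊛-distribʳ h (f ∘ suc ⊛ g) (f ⊛ g ∘ suc) n) ⟩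
  ((f ∘ suc ⊛ g) ⊛ h) n + ((f ⊛ g ∘ suc) ⊛ h) n + ((f ⊛ g) ⊛ h ∘ suc) n
    ≡⟨ cong₂ _+_ (cong₂ _+_ (⊛-assoc (f ∘ suc) g h n) (⊛-assoc f (g ∘ suc) h n)) (⊛-assoc f g (h ∘ suc) n) ⟩
  (f ∘ suc ⊛ (g ⊛ h)) n + (f ⊛ (g ∘ suc ⊛ h)) n + (f ⊛ (g ⊛ h ∘ suc)) n
    ≡⟨ ℚ.+-assoc ((f ∘ suc ⊛ (g ⊛ h)) n) _ _ ⟩
  (f ∘ suc ⊛ (g ⊛ h)) n + ((f ⊛ (g ∘ suc ⊛ h)) n + (f ⊛ (g ⊛ h ∘ suc)) n)
    ≡⟨ cong (λ z → (f ∘ suc ⊛ (g ⊛ h)) n + z) (sym (⊛-distribˡ f (g ∘ suc ⊛ h) (g ⊛ h ∘ suc) n)) ⟩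
  (f ∘ suc ⊛ (g ⊛ h)) n + (f ⊛ (g ∘ suc ⊛ h ⊕ g ⊛ h ∘ suc)) n ∎
  where open ≡-Reasoning

scalar-⊛ : ∀ c f g → (λ n → c * f n) ⊛ g ≗ (λ n → c * (f ⊛ g) n)
scalar-⊛ c f g zero = ℚ.*-assoc c (f 0) (g 0)
scalar-⊛ c f g (suc n) = trans (cong₂ _+_ (scalar-⊛ c (f ∘ suc) g n) (scalar-⊛ c f (g ∘ suc) n))
  (sym (ℚ.*-distribˡ-+ c ((f ∘ suc ⊛ g) n) _))

0-⊛ : ∀ f → (λ _ → 0ℚ) ⊛ f ≗ (λ _ → 0ℚ)
0-⊛ f zero = ℚ.*-zeroˡ (f 0)
0-⊛ f (suc n) = cong₂ _+_ (0-⊛ f n) (0-⊛ (f ∘ suc) n)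

const-⊛ : ∀ c f n → (const c ⊛ f) n ≡ c * f n
const-⊛ c f zero = refl
const-⊛ c f (suc n) = trans (cong₂ _+_ (0-⊛ f n) (const-⊛ c (f ∘ suc) n)) (ℚ.+-identityˡ _)

Series-commutativeRing : CommutativeRing 0ℓ 0ℓ
Series-commutativeRing = record
  { Carrier = Series
  ; _≈_ = _≗_
  ; _+_ = _⊕_
  ; _*_ = _⊛_
  ; -_ = ⊖_
  ; 0# = λ _ → 0ℚ
  ; 1# = const 1ℚ
  ; isCommutativeRing = record
    { isRing = record
      { +-isAbelianGroup = record
        { isGroup = record
          { isMonoid = record
            { isSemigroup = record
              { isMagma = record
                { isEquivalence = record
                  { refl = λ _ → refl ; sym = λ e n → sym (e n) ; trans = λ e e′ n → trans (e n) (e′ n) }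
                ; ∙-cong = λ e e′ n → cong₂ _+_ (e n) (e′ n) }
              ; assoc = λ f g h n → ℚ.+-assoc (f n) (g n) (h n) }
            ; identity = (λ f n → ℚ.+-identityˡ (f n)) , (λ f n → ℚ.+-identityʳ (f n)) }
          ; inverse = (λ f n → ℚ.+-inverseˡ (f n)) , (λ f n → ℚ.+-inverseʳ (f n))
          ; ⁻¹-cong = λ e n → cong -_ (e n) }
        ; comm = λ f g n → ℚ.+-comm (f n) (g n) }
      ; *-cong = ⊛-cong
      ; *-assoc = ⊛-assoc
      ; *-identity = (λ f n → trans (const-⊛ 1ℚ f n) (ℚ.*-identityˡ (f n)))
                   , (λ f n → trans (⊛-comm f (const 1ℚ) n) (trans (const-⊛ 1ℚ f n) (ℚ.*-identityˡ (f n))))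
      ; distrib = ⊛-distribˡ , ⊛-distribʳ }
    ; *-comm = ⊛-comm } }

-- Rational constants enter the solver as coefficients and not as atoms, so it computes with them
-- when normalising.
const-morphism : CommutativeRing.rawRing ℚ.+-*-commutativeRing ACR.-Raw-AlmostCommutative⟶ ACR.fromCommutativeRing Series-commutativeRing
const-morphism = record
  { ⟦_⟧ = const
  ; +-homo = λ { a b zero → refl ; a b (suc n) → refl }
  ; *-homo = λ { a b zero → refl ; a b (suc n) → sym (trans (const-⊛ a (const b) (suc n)) (ℚ.*-zeroʳ a)) }
  ; -‿homo = λ { a zero → refl ; a (suc n) → refl }
  ; 0-homo = λ { zero → refl ; (suc n) → refl }
  ; 1-homo = λ _ → refl }

const-≟ : ∀ a b → Maybe (const a ≗ const b)
const-≟ a b = Maybe.map (λ a≡b n → cong (λ c → const c n) a≡b) (dec⇒maybe (a ℚ.≟ b))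

module SeriesSolver = RingSolver (CommutativeRing.rawRing ℚ.+-*-commutativeRing)
  (ACR.fromCommutativeRing Series-commutativeRing) const-morphism const-≟

exp : ℚ → Series
exp a n = pow a n

exp-+ : ∀ a b → exp a ⊛ exp b ≗ exp (a + b)
exp-+ a b zero = refl
exp-+ a b (suc n) = begin
  ((λ n → a * pow a n) ⊛ exp b) n + (exp a ⊛ (λ n → b * pow b n)) n
    ≡⟨ cong₂ _+_ (scalar-⊛ a (exp a) (exp b) n) (trans (⊛-comm (exp a) _ n) (scalar-⊛ b (exp b) (exp a) n)) ⟩
  a * (exp a ⊛ exp b) n + b * (exp b ⊛ exp a) n
    ≡⟨ cong₂ (λ u v → a * u + b * v) (exp-+ a b n) (trans (⊛-comm (exp b) (exp a) n) (exp-+ a b n)) ⟩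
  a * pow (a + b) n + b * pow (a + b) n
    ≡⟨ sym (ℚ.*-distribʳ-+ (pow (a + b) n) a b) ⟩
  (a + b) * pow (a + b) n ∎
  where open ≡-Reasoning

-- The substitution f(t) ↦ f(ct); the case c = -1 is called `σ` below.
scale : ℚ → Series → Series
scale c f n = pow c n * f n

scale-⊛ : ∀ c f g → scale c (f ⊛ g) ≗ scale c f ⊛ scale c g
scale-⊛ c f g zero = lem (f 0) (g 0)
  where
  lem : ∀ a b → 1ℚ * (a * b) ≡ 1ℚ * a * (1ℚ * b)
  lem = solve-∀ ℚ-ring
scale-⊛ c f g (suc n) = begin
  c * pow c n * ((f ∘ suc ⊛ g) n + (f ⊛ g ∘ suc) n)
    ≡⟨ lem c (pow c n) ((f ∘ suc ⊛ g) n) _ ⟩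
  c * (pow c n * (f ∘ suc ⊛ g) n) + c * (pow c n * (f ⊛ g ∘ suc) n)
    ≡⟨ cong₂ (λ u v → c * u + c * v) (scale-⊛ c (f ∘ suc) g n) (trans (scale-⊛ c f (g ∘ suc) n) (⊛-comm (scale c f) _ n)) ⟩
  c * (scale c (f ∘ suc) ⊛ scale c g) n + c * (scale c (g ∘ suc) ⊛ scale c f) n
    ≡⟨ sym (cong₂ _+_ (tail f (scale c g)) (trans (⊛-comm (scale c f) _ n) (tail g (scale c f)))) ⟩
  (scale c f ∘ suc ⊛ scale c g) n + (scale c f ⊛ scale c g ∘ suc) n ∎
  where
  open ≡-Reasoning
  lem : ∀ c q a b → c * q * (a + b) ≡ c * (q * a) + c * (q * b)
  lem = solve-∀ ℚ-ring
  tail : ∀ f h → (scale c f ∘ suc ⊛ h) n ≡ c * (scale c (f ∘ suc) ⊛ h) n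
  tail f h = trans (⊛-cong {g = h} (λ k → ℚ.*-assoc c (pow c k) (f (suc k))) (λ _ → refl) n) (scalar-⊛ c (scale c (f ∘ suc)) h n)

scale-exp : ∀ c a → scale c (exp a) ≗ exp (c * a)
scale-exp c a n = sym (pow-* c a n)

scale-scale : ∀ c d f → scale c (scale d f) ≗ scale (c * d) f
scale-scale c d f n = trans (sym (ℚ.*-assoc (pow c n) (pow d n) (f n))) (cong (_* f n) (sym (pow-* c d n)))

scale-cong : ∀ c {f g} → f ≗ g → scale c f ≗ scale c g
scale-cong c e n = cong (pow c n *_) (e n)

scale-⊕ : ∀ c f g → scale c (f ⊕ g) ≗ scale c f ⊕ scale c g
scale-⊕ c f g n = ℚ.*-distribˡ-+ (pow c n) (f n) (g n)

t : Series
t 0 = 0ℚ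
t 1 = 1ℚ
t (suc (suc n)) = 0ℚ

scale-t : ∀ c → scale c t ≗ const c ⊛ t
scale-t c n = trans (lem n) (sym (const-⊛ c t n))
  where
  lem : ∀ n → pow c n * t n ≡ c * t n
  lem zero = trans (ℚ.*-zeroʳ 1ℚ) (sym (ℚ.*-zeroʳ c))
  lem (suc zero) = ℚ.*-assoc c 1ℚ 1ℚ
  lem (suc (suc n)) = trans (ℚ.*-zeroʳ (pow c (suc (suc n)))) (sym (ℚ.*-zeroʳ c))

t-⊛ : ∀ f n → (t ⊛ f) (suc n) ≡ ι (suc n) * f n
t-⊛ f n = trans (cong (_+ (t ⊛ f ∘ suc) n) (trans (⊛-cong {g = f} t-tail (λ _ → refl) n) (trans (const-⊛ 1ℚ f n) (ℚ.*-identityˡ (f n))))) (rest n)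
  where
  t-tail : t ∘ suc ≗ const 1ℚ
  t-tail zero = refl
  t-tail (suc n) = refl
  lem : ∀ a n → a + n * a ≡ (1ℚ + n) * a
  lem = solve-∀ ℚ-ring
  rest : ∀ n → f n + (t ⊛ f ∘ suc) n ≡ ι (suc n) * f n
  rest zero = trans (cong (λ z → f 0 + z) (ℚ.*-zeroˡ (f 1))) (trans (ℚ.+-identityʳ (f 0)) (sym (ℚ.*-identityˡ (f 0))))
  rest (suc n) = trans (cong (λ z → f (suc n) + z) (t-⊛ (f ∘ suc) n)) (trans (lem (f (suc n)) (ι (suc n))) (cong (_* f (suc n)) (sym (ι-suc (suc n)))))

-- Pascal's rule is the Leibniz rule read on coefficients. This is the bridge from the product to
-- the binomial sums that define the Bernoulli and Euler numbers.
⊛-binomial : ∀ f g n → (f ⊛ g) n ≡ sumTo (suc n) (λ k → ι (n C k) * f k * g (n ∸ k))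
⊛-binomial f g zero = lem (f 0) (g 0)
  where
  lem : ∀ a b → a * b ≡ 0ℚ + 1ℚ * a * b
  lem = solve-∀ ℚ-ring
⊛-binomial f g (suc n) = begin
  (f ∘ suc ⊛ g) n + (f ⊛ g ∘ suc) n
    ≡⟨ cong₂ _+_ (⊛-binomial (f ∘ suc) g n) (⊛-binomial f (g ∘ suc) n) ⟩
  S₁ + sumTo (suc n) (λ k → ι (n C k) * f k * g (suc (n ∸ k)))
    ≡⟨ cong (λ z → S₁ + z) (sum-first n (λ k → ι (n C k) * f k * g (suc (n ∸ k)))) ⟩
  S₁ + (first n + sumTo n (λ k → ι (n C suc k) * f (suc k) * g (suc (n ∸ suc k))))
    ≡⟨ cong (λ z → S₁ + (first n + z)) (trans (sum-cong< n (λ k k<n → cong (λ m → ι (n C suc k) * f (suc k) * g m) (sym (ℕₚ.+-∸-assoc 1 k<n))))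
         (sym (trans (cong (λ z → sumTo n s₂ + z) last) (ℚ.+-identityʳ (sumTo n s₂))))) ⟩
  S₁ + (first n + sumTo (suc n) s₂)
    ≡⟨ l₁ S₁ (first n) (sumTo (suc n) s₂) ⟩
  first n + (S₁ + sumTo (suc n) s₂)
    ≡⟨ cong₂ _+_ (cong (λ c → ι c * f 0 * g (suc n)) (trans (nC0≡1 n) (sym (nC0≡1 (suc n))))) (sym (sum-+ (suc n) (λ k → ι (n C k) * f (suc k) * g (n ∸ k)) s₂)) ⟩
  first (suc n) + sumTo (suc n) (λ k → ι (n C k) * f (suc k) * g (n ∸ k) + s₂ k)
    ≡⟨ cong (λ z → first (suc n) + z) (sum-cong (suc n) (λ k → trans (l₂ (ι (n C k)) (ι (n C suc k)) (f (suc k)) (g (n ∸ k)))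
         (cong (λ c → c * f (suc k) * g (n ∸ k)) (sym (ι-pascal n k))))) ⟩
  first (suc n) + sumTo (suc n) (λ k → ι (suc n C suc k) * f (suc k) * g (n ∸ k))
    ≡⟨ sym (sum-first (suc n) (λ k → ι (suc n C k) * f k * g (suc n ∸ k))) ⟩
  sumTo (suc (suc n)) (λ k → ι (suc n C k) * f k * g (suc n ∸ k)) ∎
  where
  open ≡-Reasoning
  S₁ : ℚ
  S₁ = sumTo (suc n) (λ k → ι (n C k) * f (suc k) * g (n ∸ k))
  first : ℕ → ℚ
  first m = ι (m C 0) * f 0 * g (suc n)
  s₂ : ℕ → ℚ
  s₂ k = ι (n C suc k) * f (suc k) * g (n ∸ k)
  l₀ : ∀ a b → 0ℚ * a * b ≡ 0ℚ
  l₀ = solve-∀ ℚ-ring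
  last : s₂ n ≡ 0ℚ
  last = trans (cong (λ c → ι c * f (suc n) * g (n ∸ n)) (k>n⇒nCk≡0 (ℕₚ.n<1+n n))) (l₀ (f (suc n)) (g (n ∸ n)))
  l₁ : ∀ a b c → a + (b + c) ≡ b + (a + c)
  l₁ = solve-∀ ℚ-ring
  l₂ : ∀ a b f g → a * f * g + b * f * g ≡ (a + b) * f * g
  l₂ = solve-∀ ℚ-ring

[1+n]Cn : ∀ n → ι (suc n C n) ≡ ι (suc n)
[1+n]Cn n = begin
  ι (suc n C n)                               ≡⟨ lem (ι n) (ι (suc n C n)) ⟩
  ((1ℚ + ι n) - ι n) * ι (suc n C n)          ≡⟨ cong (λ z → (z - ι n) * ι (suc n C n)) (sym (ι-suc n)) ⟩
  (ι (suc n) - ι n) * ι (suc n C n)           ≡⟨ sym (choose-step (suc n) n) ⟩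
  (1ℚ + ι n) * ι (suc n C suc n)              ≡⟨ cong₂ (λ a b → a * ι b) (sym (ι-suc n)) (nCn≡1 (suc n)) ⟩
  ι (suc n) * 1ℚ                              ≡⟨ ℚ.*-identityʳ (ι (suc n)) ⟩
  ι (suc n)                                   ∎
  where
  open ≡-Reasoning
  lem : ∀ n a → a ≡ ((1ℚ + n) - n) * a
  lem = solve-∀ ℚ-ring

-- The series h has order exactly one. Once the earlier coefficients of f vanish, coefficient n + 1
-- of the product is (n + 1) h₁ f_n. Its use is to cancel factors such as e⁶ᵗ - 1, which have no
-- inverse among the series.
⊛-zero-divisor : ∀ f h → h 0 ≡ 0ℚ → h 1 ≢ 0ℚ → (∀ n → (f ⊛ h) n ≡ 0ℚ) → ∀ n → f n ≡ 0ℚ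
⊛-zero-divisor f h h₀ h₁ fh≡0 n = below (suc n) n (ℕₚ.n<1+n n)
  where
  open ≡-Reasoning
  l₀ : ∀ c a → c * 0ℚ * a ≡ 0ℚ
  l₀ = solve-∀ ℚ-ring
  l₁ : ∀ m a h c b → m * h * a ≡ 0ℚ + m * a * h + c * b * 0ℚ
  l₁ = solve-∀ ℚ-ring
  next : ∀ n → (∀ k → k < n → f k ≡ 0ℚ) → f n ≡ 0ℚ
  next n ih = *-cancelˡ (ι (suc n)) (ι-suc≢0 n) (*-cancelˡ (h 1) h₁ (begin
    h 1 * (ι (suc n) * f n)
      ≡⟨ trans (sym (ℚ.*-assoc (h 1) (ι (suc n)) (f n))) (cong (_* f n) (ℚ.*-comm (h 1) (ι (suc n)))) ⟩
    ι (suc n) * h 1 * f n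
      ≡⟨ l₁ (ι (suc n)) (f n) (h 1) (ι (suc n C suc n)) (f (suc n)) ⟩
    0ℚ + ι (suc n) * f n * h 1 + ι (suc n C suc n) * f (suc n) * 0ℚ
      ≡⟨ cong₂ (λ a b → a + ι (suc n C suc n) * f (suc n) * b)
           (cong₂ _+_ (sym (trans (sum-cong< n (λ k k<n → trans (cong (λ z → ι (suc n C k) * z * h (suc n ∸ k)) (ih k k<n)) (l₀ (ι (suc n C k)) (h (suc n ∸ k))))) (sum-0 n)))
             (cong₂ (λ a b → a * f n * h b) (sym ([1+n]Cn n)) (sym (ℕₚ.m+n∸n≡m 1 n))))
           (trans (sym h₀) (cong h (sym (ℕₚ.n∸n≡0 n)))) ⟩
    sumTo n (λ k → ι (suc n C k) * f k * h (suc n ∸ k)) + ι (suc n C n) * f n * h (suc n ∸ n) + ι (suc n C suc n) * f (suc n) * h (n ∸ n)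
      ≡⟨ trans (sym (⊛-binomial f h (suc n))) (fh≡0 (suc n)) ⟩
    0ℚ
      ≡⟨ trans (sym (ℚ.*-zeroʳ (h 1))) (cong (h 1 *_) (sym (ℚ.*-zeroʳ (ι (suc n))))) ⟩
    h 1 * (ι (suc n) * 0ℚ) ∎))
  below : ∀ n k → k < n → f k ≡ 0ℚ
  below (suc n) k (s≤s k≤n) = next k (λ j j<k → below n j (ℕₚ.<-≤-trans j<k k≤n))

⊛-cancelʳ : ∀ f g h → h 0 ≡ 0ℚ → h 1 ≢ 0ℚ → f ⊛ h ≗ g ⊛ h → f ≗ g
⊛-cancelʳ f g h h₀ h₁ e n = begin
  f n                  ≡⟨ l₁ (f n) (g n) ⟩
  (f ⊕ ⊖ g) n + g n    ≡⟨ cong (_+ g n) (⊛-zero-divisor (f ⊕ ⊖ g) h h₀ h₁ difference n) ⟩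
  0ℚ + g n             ≡⟨ ℚ.+-identityˡ (g n) ⟩
  g n                  ∎
  where
  open ≡-Reasoning
  open SeriesSolver using (_:+_; _:*_; :-_; _:=_)
  l₁ : ∀ a b → a ≡ (a + - b) + b
  l₁ = solve-∀ ℚ-ring
  l₂ : ∀ f g h → (f ⊕ ⊖ g) ⊛ h ≗ f ⊛ h ⊕ ⊖ (g ⊛ h)
  l₂ = SeriesSolver.solve 3 (λ f g h → (f :+ :- g) :* h := f :* h :+ :- (g :* h)) (λ _ → refl)
  difference : ∀ n → ((f ⊕ ⊖ g) ⊛ h) n ≡ 0ℚ
  difference n = trans (l₂ f g h n) (trans (cong (_+ - (g ⊛ h) n) (e n)) (ℚ.+-inverseʳ ((g ⊛ h) n)))

-- Bernoulli numbers and polynomials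

at-++ˡ : ∀ xs ys k → k < length xs → at (xs ++ ys) k ≡ at xs k
at-++ˡ (x ∷ xs) ys zero k<l = refl
at-++ˡ (x ∷ xs) ys (suc k) (s≤s k<l) = at-++ˡ xs ys k k<l

at-last : ∀ xs y → at (xs ++ (y ∷ [])) (length xs) ≡ y
at-last [] y = refl
at-last (x ∷ xs) y = at-last xs y

-- `bernTab` and `evenTab` grow by appending at the end, so an entry never changes once it is
-- written. The module turns lookups in a longer table into the diagonal values, on which the
-- recurrences are stated.
module Table (tab : ℕ → List ℚ) (next : ℕ → ℚ)
  (tab-0 : length (tab 0) ≡ 1) (tab-suc : ∀ m → tab (suc m) ≡ tab m ++ (next m ∷ [])) where

  tab-length : ∀ m → length (tab m) ≡ suc m
  tab-length zero = tab-0
  tab-length (suc m) = trans (cong length (tab-suc m)) (trans (Listₚ.length-++ (tab m))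
    (trans (cong (ℕ._+ 1) (tab-length m)) (ℕₚ.+-comm (suc m) 1)))

  tab-next : ∀ m → at (tab (suc m)) (suc m) ≡ next m
  tab-next m = trans (cong₂ at (tab-suc m) (sym (tab-length m))) (at-last (tab m) (next m))

  tab-stable : ∀ m k → k ≤ m → at (tab m) k ≡ at (tab k) k
  tab-stable zero zero z≤n = refl
  tab-stable (suc m) k k≤1+m = helper (ℕₚ.m≤n⇒m<n∨m≡n k≤1+m)
    where
    helper : k < suc m ⊎ k ≡ suc m → at (tab (suc m)) k ≡ at (tab k) k
    helper (inj₁ k<1+m) = trans (cong (λ xs → at xs k) (tab-suc m))
      (trans (at-++ˡ (tab m) (next m ∷ []) k (subst (k <_) (sym (tab-length m)) k<1+m)) (tab-stable m k (ℕₚ.≤-pred k<1+m)))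
    helper (inj₂ refl) = refl

bernNext : ℕ → ℚ
bernNext m = - (inv (ι (suc (suc m))) * sumTo (suc m) (λ k → ι (suc (suc m) C k) * at (bernTab m) k))

module BernTable = Table bernTab bernNext refl (λ _ → refl)

B-suc : ∀ m → B (suc m) ≡ - (1/[1+ suc m ] * sumTo (suc m) (λ k → ι (suc (suc m) C k) * B k))
B-suc m = trans (BernTable.tab-next m) (cong₂ (λ u v → - (u * v)) (inv-ι-suc (suc m))
  (sum-cong< (suc m) (λ k k≤m → cong (ι (suc (suc m) C k) *_) (BernTable.tab-stable m k (ℕₚ.≤-pred k≤m)))))

B-recurrence : ∀ m → sumTo (suc (suc m)) (λ k → ι (suc (suc m) C k) * B k) ≡ 0ℚ
B-recurrence m = begin
  s + ι (suc (suc m) C suc m) * B (suc m)             ≡⟨ cong₂ (λ u v → s + u * v) ([1+n]Cn (suc m)) (B-suc m) ⟩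
  s + ι (suc (suc m)) * - (1/[1+ suc m ] * s)         ≡⟨ l₁ s (ι (suc (suc m))) 1/[1+ suc m ] ⟩
  s - ι (suc (suc m)) * 1/[1+ suc m ] * s             ≡⟨ cong (λ u → s - u * s) (1/[1+]-inverse (suc m)) ⟩
  s - 1ℚ * s                                          ≡⟨ l₂ s ⟩
  0ℚ                                                  ∎
  where
  open ≡-Reasoning
  s : ℚ
  s = sumTo (suc m) (λ k → ι (suc (suc m) C k) * B k)
  l₁ : ∀ s n d → s + n * - (d * s) ≡ s - n * d * s
  l₁ = solve-∀ ℚ-ring
  l₂ : ∀ s → s - 1ℚ * s ≡ 0ℚ
  l₂ = solve-∀ ℚ-ring

e : Series
e = exp 1ℚ

ē : Series
ē = exp (- 1ℚ)

exp-0 : exp 0ℚ ≗ const 1ℚ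
exp-0 zero = refl
exp-0 (suc n) = ℚ.*-zeroˡ (pow 0ℚ n)

eē≗1 : e ⊛ ē ≗ const 1ℚ
eē≗1 n = trans (exp-+ 1ℚ (- 1ℚ) n) (exp-0 n)

-- The generating function B(t) = t/(eᵗ - 1), without division. The recurrence covers the
-- coefficients from index 2 on; the term t accounts for index 1.
B⊛e : B ⊛ e ≗ B ⊕ t
B⊛e n = trans (⊛-binomial B e n) (trans (sum-cong (suc n) (λ k → trans (cong (ι (n C k) * B k *_) (pow-1 (n ∸ k))) (ℚ.*-identityʳ (ι (n C k) * B k)))) (helper n))
  where
  helper : ∀ n → sumTo (suc n) (λ k → ι (n C k) * B k) ≡ B n + t n
  helper zero = refl
  helper (suc zero) = refl
  helper (suc (suc n)) = begin
    sumTo (suc (suc n)) (λ k → ι (suc (suc n) C k) * B k) + ι (suc (suc n) C suc (suc n)) * B (suc (suc n))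
      ≡⟨ cong₂ (λ u v → u + ι v * B (suc (suc n))) (B-recurrence n) (nCn≡1 (suc (suc n))) ⟩
    0ℚ + 1ℚ * B (suc (suc n))    ≡⟨ l₁ (B (suc (suc n))) ⟩
    B (suc (suc n)) + 0ℚ         ∎
    where
    open ≡-Reasoning
    l₁ : ∀ b → 0ℚ + 1ℚ * b ≡ b + 0ℚ
    l₁ = solve-∀ ℚ-ring

Bpoly-series : ∀ y n → Bpoly n y ≡ (B ⊛ exp y) n
Bpoly-series y n = sym (⊛-binomial B (exp y) n)

Bpoly-0 : ∀ n → Bpoly n 0ℚ ≡ B n
Bpoly-0 n = trans (Bpoly-series 0ℚ n) (trans (⊛-comm B (exp 0ℚ) n) (trans (⊛-cong {g = B} exp-0 (λ _ → refl) n) (trans (const-⊛ 1ℚ B n) (ℚ.*-identityˡ (B n)))))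

Bpoly-difference : ∀ y n → Bpoly (suc n) (1ℚ + y) ≡ Bpoly (suc n) y + ι (suc n) * pow y n
Bpoly-difference y n = begin
  Bpoly (suc n) (1ℚ + y)                       ≡⟨ Bpoly-series (1ℚ + y) (suc n) ⟩
  (B ⊛ exp (1ℚ + y)) (suc n)                   ≡⟨ ⊛-cong {B} (λ _ → refl) (λ k → sym (exp-+ 1ℚ y k)) (suc n) ⟩
  (B ⊛ (e ⊛ exp y)) (suc n)                    ≡⟨ sym (⊛-assoc B e (exp y) (suc n)) ⟩
  ((B ⊛ e) ⊛ exp y) (suc n)                    ≡⟨ ⊛-cong {g = exp y} B⊛e (λ _ → refl) (suc n) ⟩
  ((B ⊕ t) ⊛ exp y) (suc n)                    ≡⟨ ⊛-distribʳ (exp y) B t (suc n) ⟩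
  (B ⊛ exp y) (suc n) + (t ⊛ exp y) (suc n)    ≡⟨ cong₂ _+_ (sym (Bpoly-series y (suc n))) (t-⊛ (exp y) n) ⟩
  Bpoly (suc n) y + ι (suc n) * pow y n        ∎
  where open ≡-Reasoning

σ : Series → Series
σ = scale (- 1ℚ)

ē≗σe : ē ≗ σ e
ē≗σe n = sym (scale-exp (- 1ℚ) 1ℚ n)

open SeriesSolver using (_:+_; _:*_; :-_; _:-_; _:=_; con)

module SeriesReasoning where
  open import Relation.Binary.Reasoning.Setoid (CommutativeRing.setoid Series-commutativeRing) public

≗-refl : {f : Series} → f ≗ f
≗-refl _ = refl

⊕-cong : ∀ {f f′ g g′} → f ≗ f′ → g ≗ g′ → f ⊕ g ≗ f′ ⊕ g′
⊕-cong e e′ n = cong₂ _+_ (e n) (e′ n)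

-- Putting -t into `B⊛e` gives B(-t) e⁻ᵗ = B(-t) - t. Hence B(-t)(eᵗ - 1) = t eᵗ = B(t) eᵗ (eᵗ - 1),
-- and eᵗ - 1 cancels.
σB≗B⊛e : σ B ≗ B ⊛ e
σB≗B⊛e = ⊛-cancelʳ (σ B) (B ⊛ e) (e ⊕ ⊖ const 1ℚ) refl ℚ.1≢0 (begin
  σ B ⊛ (e ⊕ ⊖ const 1ℚ)                     ≈⟨ l₁ (σ B) e ⟩
  σ B ⊛ e ⊕ ⊖ (σ B ⊛ const 1ℚ)               ≈⟨ ⊕-cong {σ B ⊛ e} ≗-refl (λ n → cong -_ (⊛-cong {σ B} ≗-refl (λ k → sym (eē≗1 k)) n)) ⟩
  σ B ⊛ e ⊕ ⊖ (σ B ⊛ (e ⊛ ē))                ≈⟨ l₂ (σ B) e ē ⟩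
  σ B ⊛ e ⊕ ⊖ ((σ B ⊛ ē) ⊛ e)                ≈⟨ ⊕-cong {σ B ⊛ e} ≗-refl (λ n → cong -_ (⊛-cong {g = e} σB⊛ē ≗-refl n)) ⟩
  σ B ⊛ e ⊕ ⊖ ((σ B ⊕ const (- 1ℚ) ⊛ t) ⊛ e) ≈⟨ l₃ (σ B) t e ⟩
  (B ⊕ t) ⊛ e ⊕ ⊖ (B ⊛ e)                    ≈⟨ ⊕-cong {g = ⊖ (B ⊛ e)} (⊛-cong {g = e} (λ k → sym (B⊛e k)) ≗-refl) ≗-refl ⟩
  (B ⊛ e) ⊛ e ⊕ ⊖ (B ⊛ e)                    ≈⟨ l₄ (B ⊛ e) e ⟩
  (B ⊛ e) ⊛ (e ⊕ ⊖ const 1ℚ)                 ∎)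
  where
  open SeriesReasoning
  σB⊛ē : σ B ⊛ ē ≗ σ B ⊕ const (- 1ℚ) ⊛ t
  σB⊛ē = begin
    σ B ⊛ ē                          ≈⟨ ⊛-cong {σ B} ≗-refl ē≗σe ⟩
    σ B ⊛ σ e                        ≈⟨ (λ n → sym (scale-⊛ (- 1ℚ) B e n)) ⟩
    σ (B ⊛ e)                        ≈⟨ scale-cong (- 1ℚ) B⊛e ⟩
    σ (B ⊕ t)                        ≈⟨ scale-⊕ (- 1ℚ) B t ⟩
    σ B ⊕ σ t                        ≈⟨ ⊕-cong {σ B} ≗-refl (scale-t (- 1ℚ)) ⟩
    σ B ⊕ const (- 1ℚ) ⊛ t           ∎
  l₁ : ∀ b e → b ⊛ (e ⊕ ⊖ const 1ℚ) ≗ b ⊛ e ⊕ ⊖ (b ⊛ const 1ℚ)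
  l₁ = SeriesSolver.solve 2 (λ b e → b :* (e :- con 1ℚ) := b :* e :- b :* con 1ℚ) ≗-refl
  l₂ : ∀ b e ē → b ⊛ e ⊕ ⊖ (b ⊛ (e ⊛ ē)) ≗ b ⊛ e ⊕ ⊖ ((b ⊛ ē) ⊛ e)
  l₂ = SeriesSolver.solve 3 (λ b e ē → b :* e :- b :* (e :* ē) := b :* e :- b :* ē :* e) ≗-refl
  l₃ : ∀ b t e → b ⊛ e ⊕ ⊖ ((b ⊕ const (- 1ℚ) ⊛ t) ⊛ e) ≗ (B ⊕ t) ⊛ e ⊕ ⊖ (B ⊛ e)
  l₃ b t e = SeriesSolver.solve 4 (λ b t e b′ → b :* e :- (b :+ con (- 1ℚ) :* t) :* e := (b′ :+ t) :* e :- b′ :* e) ≗-refl b t e B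
  l₄ : ∀ b e → b ⊛ e ⊕ ⊖ b ≗ b ⊛ (e ⊕ ⊖ const 1ℚ)
  l₄ = SeriesSolver.solve 2 (λ b e → b :* e :- b := b :* (e :- con 1ℚ)) ≗-refl

-- Bernoulli polynomials at reciprocals; Euler numbers

infixr 9 _^ˢ_

_^ˢ_ : Series → ℕ → Series
f ^ˢ zero = const 1ℚ
f ^ˢ suc k = f ⊛ f ^ˢ k

exp-ι : ∀ k → exp (ι k) ≗ e ^ˢ k
exp-ι zero = exp-0
exp-ι (suc k) = begin
  exp (ι (suc k))       ≈⟨ (λ n → cong (λ c → pow c n) (ι-suc k)) ⟩
  exp (1ℚ + ι k)        ≈⟨ (λ n → sym (exp-+ 1ℚ (ι k) n)) ⟩
  e ⊛ exp (ι k)         ≈⟨ ⊛-cong {e} ≗-refl (exp-ι k) ⟩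
  e ⊛ e ^ˢ k            ∎
  where open SeriesReasoning

scaled-B : ℕ → Series
scaled-B k = scale (ι k) B

scale-ι-e : ∀ k → scale (ι k) e ≗ e ^ˢ k
scale-ι-e k n = trans (scale-exp (ι k) 1ℚ n) (trans (cong (λ c → pow c n) (ℚ.*-identityʳ (ι k))) (exp-ι k n))

scaled-B⊛e^ : ∀ k → scaled-B k ⊛ e ^ˢ k ≗ scaled-B k ⊕ const (ι k) ⊛ t
scaled-B⊛e^ k = begin
  scaled-B k ⊛ e ^ˢ k              ≈⟨ ⊛-cong {scaled-B k} ≗-refl (λ n → sym (scale-ι-e k n)) ⟩
  scaled-B k ⊛ scale (ι k) e       ≈⟨ (λ n → sym (scale-⊛ (ι k) B e n)) ⟩
  scale (ι k) (B ⊛ e)              ≈⟨ scale-cong (ι k) B⊛e ⟩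
  scale (ι k) (B ⊕ t)              ≈⟨ scale-⊕ (ι k) B t ⟩
  scaled-B k ⊕ scale (ι k) t       ≈⟨ ⊕-cong {scaled-B k} ≗-refl (scale-t (ι k)) ⟩
  scaled-B k ⊕ const (ι k) ⊛ t     ∎
  where open SeriesReasoning

scaled-B⊛e : ∀ k n → (scaled-B (suc k) ⊛ e) n ≡ pow (ι (suc k)) n * Bpoly n 1/[1+ k ]
scaled-B⊛e k n = sym (trans (cong (pow (ι (suc k)) n *_) (Bpoly-series 1/[1+ k ] n)) (series n))
  where
  open SeriesReasoning
  series : scale (ι (suc k)) (B ⊛ exp 1/[1+ k ]) ≗ scaled-B (suc k) ⊛ e
  series = begin
    scale (ι (suc k)) (B ⊛ exp 1/[1+ k ])              ≈⟨ scale-⊛ (ι (suc k)) B (exp 1/[1+ k ]) ⟩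
    scaled-B (suc k) ⊛ scale (ι (suc k)) (exp 1/[1+ k ]) ≈⟨ ⊛-cong {scaled-B (suc k)} ≗-refl
      (λ n → trans (scale-exp (ι (suc k)) 1/[1+ k ] n) (cong (λ c → pow c n) (1/[1+]-inverse k))) ⟩
    scaled-B (suc k) ⊛ e                               ∎

σ-scaled-B⊛e : ∀ k → σ (scaled-B (suc k) ⊛ e) ≗ scaled-B (suc k) ⊛ e ^ˢ k
σ-scaled-B⊛e k = begin
  σ (b ⊛ e)                                    ≈⟨ scale-⊛ (- 1ℚ) b e ⟩
  σ b ⊛ σ e                                    ≈⟨ ⊛-cong σb (λ n → sym (ē≗σe n)) ⟩
  (b ⊛ (e ⊛ e ^ˢ k)) ⊛ ē                       ≈⟨ l₁ b e (e ^ˢ k) ē ⟩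
  (b ⊛ e ^ˢ k) ⊛ (e ⊛ ē)                       ≈⟨ ⊛-cong {b ⊛ e ^ˢ k} ≗-refl eē≗1 ⟩
  (b ⊛ e ^ˢ k) ⊛ const 1ℚ                      ≈⟨ l₂ (b ⊛ e ^ˢ k) ⟩
  b ⊛ e ^ˢ k                                   ∎
  where
  open SeriesReasoning
  c : ℚ
  c = ι (suc k)
  b : Series
  b = scaled-B (suc k)
  l₁ : ∀ b e f ē → (b ⊛ (e ⊛ f)) ⊛ ē ≗ (b ⊛ f) ⊛ (e ⊛ ē)
  l₁ = SeriesSolver.solve 4 (λ b e f ē → b :* (e :* f) :* ē := b :* f :* (e :* ē)) ≗-refl
  l₂ : ∀ b → b ⊛ const 1ℚ ≗ b
  l₂ = SeriesSolver.solve 1 (λ b → b :* con 1ℚ := b) ≗-refl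
  σb : σ b ≗ b ⊛ e ^ˢ suc k
  σb = begin
    σ (scale c B)                 ≈⟨ scale-scale (- 1ℚ) c B ⟩
    scale (- 1ℚ * c) B            ≈⟨ (λ n → cong (λ d → scale d B n) (ℚ.*-comm (- 1ℚ) c)) ⟩
    scale (c * - 1ℚ) B            ≈⟨ (λ n → sym (scale-scale c (- 1ℚ) B n)) ⟩
    scale c (σ B)                 ≈⟨ scale-cong c σB≗B⊛e ⟩
    scale c (B ⊛ e)               ≈⟨ scale-⊛ c B e ⟩
    b ⊛ scale c e                 ≈⟨ ⊛-cong {b} ≗-refl (scale-ι-e (suc k)) ⟩
    b ⊛ e ^ˢ suc k                ∎

-- With c = k + 1 this is B(ct)(eᵗ - e^((c-1)t)), twice the odd part of the generating function
-- of the numbers cⁿ B_n(1/c), because B(-t) = B(t) eᵗ.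
G : ℕ → Series
G k = scaled-B (suc k) ⊛ e ⊕ ⊖ (scaled-B (suc k) ⊛ e ^ˢ k)

G-odd : ∀ k n → pow (- 1ℚ) n ≡ - 1ℚ → G k n ≡ (1ℚ + 1ℚ) * (pow (ι (suc k)) n * Bpoly n 1/[1+ k ])
G-odd k n odd = trans (cong₂ (λ a b → a + - b) (scaled-B⊛e k n)
    (trans (sym (σ-scaled-B⊛e k n)) (cong₂ _*_ odd (scaled-B⊛e k n))))
  (lem (pow (ι (suc k)) n * Bpoly n 1/[1+ k ]))
  where
  lem : ∀ a → a + - (- 1ℚ * a) ≡ (1ℚ + 1ℚ) * a
  lem = solve-∀ ℚ-ring

neg≡⇒≡0 : ∀ a → a ≡ - a → a ≡ 0ℚ
neg≡⇒≡0 a eq = *-cancelˡ (ι 2) (ι-suc≢0 1) (trans (l₁ a) (trans (cong (λ z → a + z) eq) (l₂ a)))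
  where
  l₁ : ∀ a → (1ℚ + 1ℚ) * a ≡ a + a
  l₁ = solve-∀ ℚ-ring
  l₂ : ∀ a → a + - a ≡ (1ℚ + 1ℚ) * 0ℚ
  l₂ = solve-∀ ℚ-ring

B-odd : ∀ n → pow (- 1ℚ) (suc (suc n)) ≡ - 1ℚ → B (suc (suc n)) ≡ 0ℚ
B-odd n odd = neg≡⇒≡0 (B m) (sym (begin
  - B m              ≡⟨ lem (B m) ⟩
  - 1ℚ * B m         ≡⟨ cong (_* B m) (sym odd) ⟩
  σ B m              ≡⟨ trans (σB≗B⊛e m) (B⊛e m) ⟩
  B m + 0ℚ           ≡⟨ ℚ.+-identityʳ (B m) ⟩
  B m                ∎))
  where
  open ≡-Reasoning
  m : ℕ
  m = suc (suc n)
  lem : ∀ a → - a ≡ - 1ℚ * a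
  lem = solve-∀ ℚ-ring

data Parity : ℕ → Set where
  even : ∀ j → Parity (2 ℕ.* j)
  odd : ∀ j → Parity (suc (2 ℕ.* j))

2*suc : ∀ j → 2 ℕ.* suc j ≡ suc (suc (2 ℕ.* j))
2*suc j = ℕₚ.*-suc 2 j

parity : ∀ n → Parity n
parity zero = even 0
parity (suc n) = next (parity n)
  where
  next : ∀ {n} → Parity n → Parity (suc n)
  next (even j) = odd j
  next (odd j) = subst Parity (2*suc j) (even (suc j))

pow-neg-2* : ∀ j → pow (- 1ℚ) (2 ℕ.* j) ≡ 1ℚ
pow-neg-2* j = trans (cong (λ m → pow (- 1ℚ) (j ℕ.+ m)) (ℕₚ.+-identityʳ j)) (pow-neg-even j)

pow-neg-1+2* : ∀ j → pow (- 1ℚ) (suc (2 ℕ.* j)) ≡ - 1ℚ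
pow-neg-1+2* j = cong (- 1ℚ *_) (pow-neg-2* j)

sum-even : ∀ m (f : ℕ → ℚ) → (∀ i → f (suc (2 ℕ.* i)) ≡ 0ℚ) →
  sumTo (suc (2 ℕ.* m)) f ≡ sumTo (suc m) (λ i → f (2 ℕ.* i))
sum-even zero f z = refl
sum-even (suc m) f z = begin
  sumTo (2 ℕ.* suc m) f + f (2 ℕ.* suc m)                      ≡⟨ cong (λ k → sumTo k f + f (2 ℕ.* suc m)) (2*suc m) ⟩
  sumTo (suc (2 ℕ.* m)) f + f (suc (2 ℕ.* m)) + f (2 ℕ.* suc m) ≡⟨ cong (_+ f (2 ℕ.* suc m)) (trans (cong₂ _+_ (sum-even m f z) (z m)) (ℚ.+-identityʳ (sumTo (suc m) (λ i → f (2 ℕ.* i))))) ⟩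
  sumTo (suc m) (λ i → f (2 ℕ.* i)) + f (2 ℕ.* suc m)          ∎
  where open ≡-Reasoning

module EvenSequence (c : ℚ) where

  X : Series
  X = evenSeq c

  T : ℕ → ℚ
  T m = at (evenTab c m) m

  next : ℕ → ℚ
  next m = - (c * sumTo (suc m) (λ i → ι ((2 ℕ.* suc m) C (2 ℕ.* suc i)) * at (evenTab c m) (suc m ∸ suc i)))

  module EvenTable = Table (evenTab c) next refl (λ _ → refl)

  X-even : ∀ j → X (2 ℕ.* j) ≡ T j
  X-even j = trans (cong₂ select (cong (ℕ._≡ᵇ 0) (trans (cong (_% 2) (ℕₚ.*-comm 2 j)) (ℕ/.m*n%n≡0 j 2)))
    (trans (cong (λ m → ℕ/._/_ m 2) (ℕₚ.*-comm 2 j)) (ℕ/.m*n/n≡m j 2))) refl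
    where
    select : Bool → ℕ → ℚ
    select b m = if b then T m else 0ℚ

  X-odd : ∀ j → X (suc (2 ℕ.* j)) ≡ 0ℚ
  X-odd j = cong (λ b → if b then T (suc (2 ℕ.* j) div 2) else 0ℚ)
    (cong (ℕ._≡ᵇ 0) (trans (cong (λ m → suc m % 2) (ℕₚ.*-comm 2 j)) (ℕ/.[m+kn]%n≡m%n 1 j 2)))

  T-suc : ∀ m → T (suc m) ≡ - (c * sumTo (suc m) (λ i → ι ((2 ℕ.* suc m) C (2 ℕ.* suc i)) * T (m ∸ i)))
  T-suc m = trans (EvenTable.tab-next m) (cong (λ s → - (c * s)) (sum-cong (suc m) (λ i →
    cong (ι ((2 ℕ.* suc m) C (2 ℕ.* suc i)) *_) (EvenTable.tab-stable m (m ∸ i) (ℕₚ.m∸n≤m m i)))))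

  σX≗X : σ X ≗ X
  σX≗X n = helper (parity n)
    where
    helper : ∀ {n} → Parity n → σ X n ≡ X n
    helper (even j) = trans (cong (_* X (2 ℕ.* j)) (pow-neg-2* j)) (ℚ.*-identityˡ (X (2 ℕ.* j)))
    helper (odd j) = trans (cong (pow (- 1ℚ) (suc (2 ℕ.* j)) *_) (X-odd j)) (trans (ℚ.*-zeroʳ (pow (- 1ℚ) (suc (2 ℕ.* j)))) (sym (X-odd j)))

  χ : Series
  χ = e ⊕ ē

  χ-even : ∀ j → χ (2 ℕ.* j) ≡ 1ℚ + 1ℚ
  χ-even j = cong₂ _+_ (pow-1 (2 ℕ.* j)) (pow-neg-2* j)

  χ-odd : ∀ j → χ (suc (2 ℕ.* j)) ≡ 0ℚ
  χ-odd j = cong₂ _+_ (pow-1 (suc (2 ℕ.* j))) (pow-neg-1+2* j)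

  σχ≗χ : σ χ ≗ χ
  σχ≗χ n = helper (parity n)
    where
    helper : ∀ {n} → Parity n → σ χ n ≡ χ n
    helper (even j) = trans (cong (_* χ (2 ℕ.* j)) (pow-neg-2* j)) (ℚ.*-identityˡ (χ (2 ℕ.* j)))
    helper (odd j) = trans (cong (pow (- 1ℚ) (suc (2 ℕ.* j)) *_) (χ-odd j)) (trans (ℚ.*-zeroʳ (pow (- 1ℚ) (suc (2 ℕ.* j)))) (sym (χ-odd j)))

  χ⊛X-odd : ∀ j → (χ ⊛ X) (suc (2 ℕ.* j)) ≡ 0ℚ
  χ⊛X-odd j = neg≡⇒≡0 a (sym (begin
    - a                                  ≡⟨ lem a ⟩
    - 1ℚ * a                             ≡⟨ cong (_* a) (sym (pow-neg-1+2* j)) ⟩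
    σ (χ ⊛ X) (suc (2 ℕ.* j))            ≡⟨ scale-⊛ (- 1ℚ) χ X (suc (2 ℕ.* j)) ⟩
    (σ χ ⊛ σ X) (suc (2 ℕ.* j))          ≡⟨ ⊛-cong σχ≗χ σX≗X (suc (2 ℕ.* j)) ⟩
    a                                    ∎))
    where
    open ≡-Reasoning
    a : ℚ
    a = (χ ⊛ X) (suc (2 ℕ.* j))
    lem : ∀ a → - a ≡ - 1ℚ * a
    lem = solve-∀ ℚ-ring

  χ⊛X-even : ∀ m → c * (χ ⊛ X) (2 ℕ.* suc m) ≡ (1ℚ + 1ℚ) * (c - 1ℚ) * T (suc m)
  χ⊛X-even m = begin
    c * (χ ⊛ X) (2 ℕ.* suc m)
      ≡⟨ cong (c *_) (⊛-binomial χ X (2 ℕ.* suc m)) ⟩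
    c * sumTo (suc (2 ℕ.* suc m)) f
      ≡⟨ cong (c *_) (sum-even (suc m) f (λ i → trans (cong (λ z → ι ((2 ℕ.* suc m) C suc (2 ℕ.* i)) * z * X (2 ℕ.* suc m ∸ suc (2 ℕ.* i))) (χ-odd i)) (l₀ (ι ((2 ℕ.* suc m) C suc (2 ℕ.* i))) _))) ⟩
    c * sumTo (suc (suc m)) (λ i → f (2 ℕ.* i))
      ≡⟨ cong (c *_) (sum-first (suc m) (λ i → f (2 ℕ.* i))) ⟩
    c * (f 0 + sumTo (suc m) (λ i → f (2 ℕ.* suc i)))
      ≡⟨ cong (c *_) (cong₂ _+_ (cong₂ (λ u v → ι u * (1ℚ + 1ℚ) * v) (nC0≡1 (2 ℕ.* suc m)) (X-even (suc m)))
           (trans (sum-cong (suc m) term) (sum-*ˡ (suc m) (1ℚ + 1ℚ) g))) ⟩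
    c * (1ℚ * (1ℚ + 1ℚ) * T (suc m) + (1ℚ + 1ℚ) * sumTo (suc m) g)
      ≡⟨ l₁ c (T (suc m)) (sumTo (suc m) g) ⟩
    (1ℚ + 1ℚ) * c * T (suc m) - (1ℚ + 1ℚ) * - (c * sumTo (suc m) g)
      ≡⟨ cong (λ z → (1ℚ + 1ℚ) * c * T (suc m) - (1ℚ + 1ℚ) * z) (sym (T-suc m)) ⟩
    (1ℚ + 1ℚ) * c * T (suc m) - (1ℚ + 1ℚ) * T (suc m)
      ≡⟨ l₂ c (T (suc m)) ⟩
    (1ℚ + 1ℚ) * (c - 1ℚ) * T (suc m) ∎
    where
    open ≡-Reasoning
    f g : ℕ → ℚ
    f k = ι ((2 ℕ.* suc m) C k) * χ k * X (2 ℕ.* suc m ∸ k)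
    g i = ι ((2 ℕ.* suc m) C (2 ℕ.* suc i)) * T (m ∸ i)
    l₀ : ∀ a b → a * 0ℚ * b ≡ 0ℚ
    l₀ = solve-∀ ℚ-ring
    l₁ : ∀ c a s → c * (1ℚ * (1ℚ + 1ℚ) * a + (1ℚ + 1ℚ) * s) ≡ (1ℚ + 1ℚ) * c * a - (1ℚ + 1ℚ) * - (c * s)
    l₁ = solve-∀ ℚ-ring
    l₂ : ∀ c a → (1ℚ + 1ℚ) * c * a - (1ℚ + 1ℚ) * a ≡ (1ℚ + 1ℚ) * (c - 1ℚ) * a
    l₂ = solve-∀ ℚ-ring
    l₃ : ∀ a b d → a * b * d ≡ b * (a * d)
    l₃ = solve-∀ ℚ-ring
    term : ∀ i → f (2 ℕ.* suc i) ≡ (1ℚ + 1ℚ) * g i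
    term i = trans (cong₂ (λ u v → ι ((2 ℕ.* suc m) C (2 ℕ.* suc i)) * u * v) (χ-even (suc i))
        (trans (cong X (sym (ℕₚ.*-distribˡ-∸ 2 (suc m) (suc i)))) (X-even (m ∸ i))))
      (l₃ (ι ((2 ℕ.* suc m) C (2 ℕ.* suc i))) (1ℚ + 1ℚ) (T (m ∸ i)))

  -- Since χ = 2 cosh t, this says X = 1/(1 + c (cosh t - 1)): E has generating function 1/cosh t
  -- and U has 1/(2 cosh t - 1). Even coefficients are the recursion multiplied by c; odd ones
  -- vanish because χ and X are even.
  χ⊛X : const c ⊛ (χ ⊛ X) ≗ const ((1ℚ + 1ℚ) * (c - 1ℚ)) ⊛ X ⊕ const (1ℚ + 1ℚ)
  χ⊛X n = trans (const-⊛ c (χ ⊛ X) n) (trans (helper (parity n)) (cong (_+ const (1ℚ + 1ℚ) n) (sym (const-⊛ ((1ℚ + 1ℚ) * (c - 1ℚ)) X n))))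
    where
    l₀ : ∀ c → c * ((1ℚ + 1ℚ) * 1ℚ) ≡ (1ℚ + 1ℚ) * (c - 1ℚ) * 1ℚ + (1ℚ + 1ℚ)
    l₀ = solve-∀ ℚ-ring
    l₁ : ∀ a c → c * 0ℚ ≡ a * 0ℚ + 0ℚ
    l₁ = solve-∀ ℚ-ring
    helper : ∀ {n} → Parity n → c * (χ ⊛ X) n ≡ (1ℚ + 1ℚ) * (c - 1ℚ) * X n + const (1ℚ + 1ℚ) n
    helper (even zero) = l₀ c
    helper (even (suc j)) = trans (χ⊛X-even j) (trans (cong ((1ℚ + 1ℚ) * (c - 1ℚ) *_) (sym (X-even (suc j)))) (sym (ℚ.+-identityʳ _)))
    helper (odd j) = trans (cong (c *_) (χ⊛X-odd j)) (trans (l₁ ((1ℚ + 1ℚ) * (c - 1ℚ)) c) (cong (λ z → (1ℚ + 1ℚ) * (c - 1ℚ) * z + 0ℚ) (sym (X-odd j))))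

Vanishes : Series → Set
Vanishes f = ∀ n → f n ≡ 0ℚ

≗⇒vanishes : ∀ {f g} → f ≗ g → Vanishes (f ⊕ ⊖ g)
≗⇒vanishes {f} {g} eq n = trans (cong (_+ - g n) (eq n)) (ℚ.+-inverseʳ (g n))

vanishes-⊛ : ∀ {f} c → Vanishes f → Vanishes (f ⊛ c)
vanishes-⊛ c z n = trans (⊛-cong {g = c} z ≗-refl n) (0-⊛ c n)

vanishes-⊕ : ∀ {f g} → Vanishes f → Vanishes g → Vanishes (f ⊕ g)
vanishes-⊕ z z′ n = cong₂ _+_ (z n) (z′ n)

-- Ideal membership: the ring solver treats e, t, B, E, U as independent variables and checks f = g
-- + z, where z is an explicit combination of relations known to hold.
≗-modulo : ∀ {f g z} → f ≗ g ⊕ z → Vanishes z → f ≗ g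
≗-modulo {g = g} eq z n = trans (eq n) (trans (cong (λ u → g n + u) (z n)) (ℚ.+-identityʳ (g n)))

-- The relation for 2 cosh t is multiplied by eᵗ to become polynomial in eᵗ; the multiple of eᵗ e⁻ᵗ
-- - 1 removes the remaining e⁻ᵗ. `U-equation` arises in the same way, with a further factor 1/2.
E-equation : E ⊛ (e ⊛ e ⊕ const 1ℚ) ≗ const (ι 2) ⊛ e
E-equation = ≗-modulo (ring E e ē)
    (vanishes-⊕ (vanishes-⊛ e (≗⇒vanishes (EvenSequence.χ⊛X 1ℚ))) (vanishes-⊛ (⊖ E) (≗⇒vanishes eē≗1)))
  where
  ring : ∀ x e ē → x ⊛ (e ⊛ e ⊕ const 1ℚ) ≗ const (ι 2) ⊛ e ⊕
    ((const 1ℚ ⊛ ((e ⊕ ē) ⊛ x) ⊕ ⊖ (const 0ℚ ⊛ x ⊕ const (ι 2))) ⊛ e ⊕ (e ⊛ ē ⊕ ⊖ const 1ℚ) ⊛ (⊖ x))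
  ring = SeriesSolver.solve 3 (λ x e ē → x :* (e :* e :+ con 1ℚ) := con (ι 2) :* e :+
    ((con 1ℚ :* ((e :+ ē) :* x) :- (con 0ℚ :* x :+ con (ι 2))) :* e :+ (e :* ē :- con 1ℚ) :* (:- x))) ≗-refl

U-equation : U ⊛ (e ⊛ e ⊕ const 1ℚ) ≗ e ⊕ U ⊛ e
U-equation = ≗-modulo (ring U e ē)
    (vanishes-⊕ (vanishes-⊛ (const 1/[1+ 1 ] ⊛ e) (≗⇒vanishes (EvenSequence.χ⊛X (ι 2)))) (vanishes-⊛ (⊖ U) (≗⇒vanishes eē≗1)))
  where
  ring : ∀ x e ē → x ⊛ (e ⊛ e ⊕ const 1ℚ) ≗ (e ⊕ x ⊛ e) ⊕
    ((const (ι 2) ⊛ ((e ⊕ ē) ⊛ x) ⊕ ⊖ (const (ι 2) ⊛ x ⊕ const (ι 2))) ⊛ (const 1/[1+ 1 ] ⊛ e) ⊕ (e ⊛ ē ⊕ ⊖ const 1ℚ) ⊛ (⊖ x))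
  ring = SeriesSolver.solve 3 (λ x e ē → x :* (e :* e :+ con 1ℚ) := (e :+ x :* e) :+
    ((con (ι 2) :* ((e :+ ē) :* x) :- (con (ι 2) :* x :+ con (ι 2))) :* (con 1/[1+ 1 ] :* e) :+ (e :* ē :- con 1ℚ) :* (:- x))) ≗-refl

infixr 9 _:^_

_:^_ : ∀ {n} → SeriesSolver.Polynomial n → ℕ → SeriesSolver.Polynomial n
x :^ zero = con 1ℚ
x :^ suc k = x :* x :^ k

scaled-B-relation : ∀ k → Vanishes (scaled-B k ⊛ e ^ˢ k ⊕ ⊖ (scaled-B k ⊕ const (ι k) ⊛ t))
scaled-B-relation k = ≗⇒vanishes (scaled-B⊛e^ k)

-- The next three identities are multiplied by e⁴ᵗ - 1 or e⁶ᵗ - 1; their difference is then a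
-- combination of the defining relations of B, E and U, which the ring solver verifies.
G₃≗tE : G 3 ≗ const (- ι 2) ⊛ (t ⊛ E)
G₃≗tE = ⊛-cancelʳ (G 3) _ (e ^ˢ 4 ⊕ ⊖ const 1ℚ) refl (λ ()) (≗-modulo (ring (scaled-B 4) e t E)
    (vanishes-⊕ (vanishes-⊛ (e ⊕ ⊖ e ^ˢ 3) (scaled-B-relation 4))
                (vanishes-⊛ (const (ι 2) ⊛ t ⊛ (e ⊛ e ⊕ ⊖ const 1ℚ)) (≗⇒vanishes E-equation))))
  where
  ring : ∀ b e t x → (b ⊛ e ⊕ ⊖ (b ⊛ e ^ˢ 3)) ⊛ (e ^ˢ 4 ⊕ ⊖ const 1ℚ) ≗ const (- ι 2) ⊛ (t ⊛ x) ⊛ (e ^ˢ 4 ⊕ ⊖ const 1ℚ) ⊕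
    ((b ⊛ e ^ˢ 4 ⊕ ⊖ (b ⊕ const (ι 4) ⊛ t)) ⊛ (e ⊕ ⊖ e ^ˢ 3) ⊕
     (x ⊛ (e ⊛ e ⊕ const 1ℚ) ⊕ ⊖ (const (ι 2) ⊛ e)) ⊛ (const (ι 2) ⊛ t ⊛ (e ⊛ e ⊕ ⊖ const 1ℚ)))
  ring = SeriesSolver.solve 4 (λ b e t x → (b :* e :- (b :* e :^ 3)) :* (e :^ 4 :- con 1ℚ) := con (- ι 2) :* (t :* x) :* (e :^ 4 :- con 1ℚ) :+
    ((b :* e :^ 4 :- (b :+ con (ι 4) :* t)) :* (e :- e :^ 3) :+
     (x :* (e :* e :+ con 1ℚ) :- (con (ι 2) :* e)) :* (con (ι 2) :* t :* (e :* e :- con 1ℚ)))) ≗-refl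

-- With z = eᵗ the left side is -6tz(z² + 1)/(z⁴ + z² + 1). The denominator is (z² - z + 1)(z² + z +
-- 1), and partial fractions split this into -3tz/(z² - z + 1) = -3tU and -3tz/(z² + z + 1) = G₂.
G₅≗tU+G₂ : G 5 ≗ const (- ι 3) ⊛ (t ⊛ U) ⊕ G 2
G₅≗tU+G₂ = ⊛-cancelʳ (G 5) _ (e ^ˢ 6 ⊕ ⊖ const 1ℚ) refl (λ ()) (≗-modulo (ring (scaled-B 6) (scaled-B 3) e t U)
    (vanishes-⊕ (vanishes-⊛ (e ⊕ ⊖ e ^ˢ 5) (scaled-B-relation 6))
    (vanishes-⊕ (vanishes-⊛ (const (ι 3) ⊛ t ⊛ ((e ⊕ const 1ℚ) ⊛ (e ^ˢ 3 ⊕ ⊖ const 1ℚ))) (≗⇒vanishes U-equation))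
                (vanishes-⊛ ((e ^ˢ 2 ⊕ ⊖ e) ⊛ (e ^ˢ 3 ⊕ const 1ℚ)) (scaled-B-relation 3)))))
  where
  ring : ∀ b c e t x → (b ⊛ e ⊕ ⊖ (b ⊛ e ^ˢ 5)) ⊛ (e ^ˢ 6 ⊕ ⊖ const 1ℚ) ≗
    (const (- ι 3) ⊛ (t ⊛ x) ⊕ (c ⊛ e ⊕ ⊖ (c ⊛ e ^ˢ 2))) ⊛ (e ^ˢ 6 ⊕ ⊖ const 1ℚ) ⊕
    ((b ⊛ e ^ˢ 6 ⊕ ⊖ (b ⊕ const (ι 6) ⊛ t)) ⊛ (e ⊕ ⊖ e ^ˢ 5) ⊕
     ((x ⊛ (e ⊛ e ⊕ const 1ℚ) ⊕ ⊖ (e ⊕ x ⊛ e)) ⊛ (const (ι 3) ⊛ t ⊛ ((e ⊕ const 1ℚ) ⊛ (e ^ˢ 3 ⊕ ⊖ const 1ℚ))) ⊕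
      (c ⊛ e ^ˢ 3 ⊕ ⊖ (c ⊕ const (ι 3) ⊛ t)) ⊛ ((e ^ˢ 2 ⊕ ⊖ e) ⊛ (e ^ˢ 3 ⊕ const 1ℚ))))
  ring = SeriesSolver.solve 5 (λ b c e t x → (b :* e :- (b :* e :^ 5)) :* (e :^ 6 :- con 1ℚ) :=
    (con (- ι 3) :* (t :* x) :+ (c :* e :- (c :* e :^ 2))) :* (e :^ 6 :- con 1ℚ) :+
    ((b :* e :^ 6 :- (b :+ con (ι 6) :* t)) :* (e :- e :^ 5) :+
     ((x :* (e :* e :+ con 1ℚ) :- (e :+ x :* e)) :* (con (ι 3) :* t :* ((e :+ con 1ℚ) :* (e :^ 3 :- con 1ℚ))) :+
      (c :* e :^ 3 :- (c :+ con (ι 3) :* t)) :* ((e :^ 2 :- e) :* (e :^ 3 :+ con 1ℚ))))) ≗-refl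

scale-2-G₂ : scale (ι 2) (G 2) ≗ scaled-B 6 ⊛ e ^ˢ 2 ⊕ ⊖ (scaled-B 6 ⊛ e ^ˢ 4)
scale-2-G₂ = begin
  scale (ι 2) (b ⊛ e ⊕ ⊖ (b ⊛ e ^ˢ 2))                           ≈⟨ scale-⊕ (ι 2) (b ⊛ e) (⊖ (b ⊛ e ^ˢ 2)) ⟩
  scale (ι 2) (b ⊛ e) ⊕ scale (ι 2) (⊖ (b ⊛ e ^ˢ 2))             ≈⟨ ⊕-cong (scale-⊛ (ι 2) b e) (λ n → trans (lem (pow (ι 2) n) _) (cong -_ (scale-⊛ (ι 2) b (e ^ˢ 2) n))) ⟩
  scale (ι 2) b ⊛ scale (ι 2) e ⊕ ⊖ (scale (ι 2) b ⊛ scale (ι 2) (e ^ˢ 2))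
    ≈⟨ ⊕-cong (⊛-cong (scale-scale (ι 2) (ι 3) B) (scale-ι-e 2)) (λ n → cong -_ (⊛-cong (scale-scale (ι 2) (ι 3) B) scale-e² n)) ⟩
  scaled-B 6 ⊛ e ^ˢ 2 ⊕ ⊖ (scaled-B 6 ⊛ e ^ˢ 4)                  ∎
  where
  open SeriesReasoning
  b : Series
  b = scaled-B 3
  lem : ∀ a b → a * - b ≡ - (a * b)
  lem = solve-∀ ℚ-ring
  scale-e² : scale (ι 2) (e ^ˢ 2) ≗ e ^ˢ 4
  scale-e² = begin
    scale (ι 2) (e ^ˢ 2)          ≈⟨ scale-cong (ι 2) (λ n → sym (exp-ι 2 n)) ⟩
    scale (ι 2) (exp (ι 2))       ≈⟨ scale-exp (ι 2) (ι 2) ⟩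
    exp (ι 4)                     ≈⟨ exp-ι 4 ⟩
    e ^ˢ 4                        ∎

-- With z = eᵗ this is the difference of the same partial fractions: z/(z² - z + 1) - z/(z² + z + 1)
-- = 2z²/(z⁴ + z² + 1), whose right side is G₂(2t) up to the factor -3t. The identity ties U to the
-- denominator 3 alone, since G₂(2t) only rescales coefficients.
tU≗G₂ : const (- ι 3) ⊛ (t ⊛ U) ≗ G 2 ⊕ scale (ι 2) (G 2)
tU≗G₂ = begin
  const (- ι 3) ⊛ (t ⊛ U)                              ≈⟨ ⊛-cancelʳ _ _ (e ^ˢ 6 ⊕ ⊖ const 1ℚ) refl (λ ()) (≗-modulo (ring (scaled-B 6) (scaled-B 3) e t U)
    (vanishes-⊕ (vanishes-⊛ (e ^ˢ 4 ⊕ ⊖ e ^ˢ 2) (scaled-B-relation 6))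
    (vanishes-⊕ (vanishes-⊛ (const (- ι 3) ⊛ t ⊛ ((e ⊕ const 1ℚ) ⊛ (e ^ˢ 3 ⊕ ⊖ const 1ℚ))) (≗⇒vanishes U-equation))
                (vanishes-⊛ ((e ^ˢ 2 ⊕ ⊖ e) ⊛ (e ^ˢ 3 ⊕ const 1ℚ)) (scaled-B-relation 3))))) ⟩
  G 2 ⊕ (scaled-B 6 ⊛ e ^ˢ 2 ⊕ ⊖ (scaled-B 6 ⊛ e ^ˢ 4)) ≈⟨ ⊕-cong {G 2} ≗-refl (λ n → sym (scale-2-G₂ n)) ⟩
  G 2 ⊕ scale (ι 2) (G 2)                              ∎
  where
  open SeriesReasoning
  ring : ∀ b c e t x → const (- ι 3) ⊛ (t ⊛ x) ⊛ (e ^ˢ 6 ⊕ ⊖ const 1ℚ) ≗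
    ((c ⊛ e ⊕ ⊖ (c ⊛ e ^ˢ 2)) ⊕ (b ⊛ e ^ˢ 2 ⊕ ⊖ (b ⊛ e ^ˢ 4))) ⊛ (e ^ˢ 6 ⊕ ⊖ const 1ℚ) ⊕
    ((b ⊛ e ^ˢ 6 ⊕ ⊖ (b ⊕ const (ι 6) ⊛ t)) ⊛ (e ^ˢ 4 ⊕ ⊖ e ^ˢ 2) ⊕
     ((x ⊛ (e ⊛ e ⊕ const 1ℚ) ⊕ ⊖ (e ⊕ x ⊛ e)) ⊛ (const (- ι 3) ⊛ t ⊛ ((e ⊕ const 1ℚ) ⊛ (e ^ˢ 3 ⊕ ⊖ const 1ℚ))) ⊕
      (c ⊛ e ^ˢ 3 ⊕ ⊖ (c ⊕ const (ι 3) ⊛ t)) ⊛ ((e ^ˢ 2 ⊕ ⊖ e) ⊛ (e ^ˢ 3 ⊕ const 1ℚ))))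
  ring = SeriesSolver.solve 5 (λ b c e t x → con (- ι 3) :* (t :* x) :* (e :^ 6 :- con 1ℚ) :=
    ((c :* e :- (c :* e :^ 2)) :+ (b :* e :^ 2 :- (b :* e :^ 4))) :* (e :^ 6 :- con 1ℚ) :+
    ((b :* e :^ 6 :- (b :+ con (ι 6) :* t)) :* (e :^ 4 :- e :^ 2) :+
     ((x :* (e :* e :+ con 1ℚ) :- (e :+ x :* e)) :* (con (- ι 3) :* t :* ((e :+ con 1ℚ) :* (e :^ 3 :- con 1ℚ))) :+
      (c :* e :^ 3 :- (c :+ con (ι 3) :* t)) :* ((e :^ 2 :- e) :* (e :^ 3 :+ con 1ℚ))))) ≗-refl

const-t-⊛ : ∀ c f n → (const c ⊛ (t ⊛ f)) (suc n) ≡ c * (ι (suc n) * f n)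
const-t-⊛ c f n = trans (const-⊛ c (t ⊛ f) (suc n)) (cong (c *_) (t-⊛ f n))

-- Bernoulli numbers modulo p

-- Here `q` is p - 3. With `3+q≡p` the indices p - 3, p - 2, p - 1 become `q`, `suc q`, `2 ℕ.+ q`,
-- free of truncated subtraction, so that sums and powers unfold.
module ModPrime (p q : ℕ) (p-prime : Prime p) (0<q : 0 < q) (3+q≡p : 3 ℕ.+ q ≡ p) where
  open Congruences p p-prime

  <p : ∀ {k} → k < 3 ℕ.+ q → k < p
  <p {k} = subst (k <_) 3+q≡p

  1+ι[p-1] : 1ℚ + ι (2 ℕ.+ q) ≡ ι p
  1+ι[p-1] = trans (sym (ι-suc (2 ℕ.+ q))) (cong ι 3+q≡p)

  p∣choose : ∀ k → k < 2 ℕ.+ q → ι (suc (2 ℕ.+ q) C suc k) ≋ 0ℚ [ 1 ]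
  p∣choose k k<p-1 = ≋-cancel (1ℚ + ι k) 1/[1+ k ] (1/-inv k) (int-1/[1+] k (p∤< k (<p (s≤s k<p-1))))
    (subst₂ (_≋_[ 1 ]) (sym (choose-absorb (2 ℕ.+ q) k)) (sym (ℚ.*-zeroʳ (1ℚ + ι k)))
      (≋0-*ʳ (ι ((2 ℕ.+ q) C k)) (int-ι ((2 ℕ.+ q) C k)) (subst (_≋ 0ℚ [ 1 ]) (sym 1+ι[p-1]) p≋0)))

  -- The binomial theorem is obtained as a coefficient of `exp-+`. All inner binomial coefficients
  -- vanish modulo p, and the two end terms remain.
  pow-p-suc : ∀ k → pow (ι (suc k)) (3 ℕ.+ q) ≋ pow (ι k) (3 ℕ.+ q) + 1ℚ [ 1 ]
  pow-p-suc k = ≋-trans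
    (≋-reflexive (trans (cong (λ x → pow x p′) (ι-suc k)) (trans (sym (exp-+ 1ℚ (ι k) p′))
      (trans (⊛-binomial (exp 1ℚ) (exp (ι k)) p′) (cong (_+ f p′) (sum-first (2 ℕ.+ q) f))))))
    (≋-trans (≋-+ (≋-+ (≋-reflexive first) (≋-trans (≋-sum (2 ℕ.+ q) middle) (≋-reflexive (sum-0 (2 ℕ.+ q))))) (≋-reflexive last))
      (≋-reflexive (cong (_+ 1ℚ) (ℚ.+-identityʳ (pow (ι k) p′)))))
    where
    p′ : ℕ
    p′ = 3 ℕ.+ q
    f : ℕ → ℚ
    f j = ι (p′ C j) * pow 1ℚ j * pow (ι k) (p′ ∸ j)
    first : f 0 ≡ pow (ι k) p′
    first = trans (cong (λ c → ι c * 1ℚ * pow (ι k) p′) (nC0≡1 p′)) (ℚ.*-identityˡ (pow (ι k) p′))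
    last : f p′ ≡ 1ℚ
    last = trans (cong₂ (λ c m → ι c * pow 1ℚ p′ * pow (ι k) m) (nCn≡1 p′) (ℕₚ.n∸n≡0 q))
      (cong (λ z → 1ℚ * z * 1ℚ) (pow-1 p′))
    middle : ∀ j → j < 2 ℕ.+ q → f (suc j) ≋ 0ℚ [ 1 ]
    middle j j< = ≋0-*ʳ _ (int-pow (2 ℕ.+ q ∸ j) (int-ι k)) (≋0-*ʳ _ (int-pow (suc j) int-1) (p∣choose j j<))

  pow-p : ∀ k → pow (ι k) (3 ℕ.+ q) ≋ ι k [ 1 ]
  pow-p zero = ≋-reflexive (ℚ.*-zeroˡ (pow 0ℚ (2 ℕ.+ q)))
  pow-p (suc k) = ≋-trans (pow-p-suc k) (≋-trans (≋-+ (pow-p k) ≋-refl)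
    (≋-reflexive (trans (ℚ.+-comm (ι k) 1ℚ) (sym (ι-suc k)))))

  fermat : ∀ k → ¬ p ∣ suc k → pow (ι (suc k)) (2 ℕ.+ q) ≋ 1ℚ [ 1 ]
  fermat k p∤k = ≋-cancel (ι (suc k)) 1/[1+ k ] (1/[1+]-inverse k) (int-1/[1+] k p∤k)
    (≋-trans (pow-p (suc k)) (≋-reflexive (sym (ℚ.*-identityʳ (ι (suc k))))))

  pow-[p-2] : ∀ k → ¬ p ∣ suc k → pow (ι (suc k)) (suc q) ≋ 1/[1+ k ] [ 1 ]
  pow-[p-2] k p∤k = ≋-cancel (ι (suc k)) 1/[1+ k ] (1/[1+]-inverse k) (int-1/[1+] k p∤k)
    (≋-trans (fermat k p∤k) (≋-reflexive (sym (1/[1+]-inverse k))))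

  pow-[p-3] : ∀ k → ¬ p ∣ suc k → pow (ι (suc k)) q ≋ 1/k² k [ 1 ]
  pow-[p-3] k p∤k = ≋-cancel (ι (suc k)) 1/[1+ k ] (1/[1+]-inverse k) (int-1/[1+] k p∤k)
    (≋-trans (pow-[p-2] k p∤k) (≋-reflexive (begin
      1/[1+ k ]                           ≡⟨ sym (ℚ.*-identityˡ 1/[1+ k ]) ⟩
      1ℚ * 1/[1+ k ]                      ≡⟨ cong (_* 1/[1+ k ]) (sym (1/[1+]-inverse k)) ⟩
      ι (suc k) * 1/[1+ k ] * 1/[1+ k ]   ≡⟨ ℚ.*-assoc (ι (suc k)) 1/[1+ k ] 1/[1+ k ] ⟩
      ι (suc k) * 1/k² k                  ∎)))
    where open ≡-Reasoning

  p∤2 : ¬ p ∣ 2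
  p∤2 = p∤< 1 (<p (s≤s (s≤s (s≤s z≤n))))

  p∤3 : ¬ p ∣ 3
  p∤3 = p∤< 2 (<p (s≤s (s≤s (s≤s 0<q))))

  q-even : Σ ℕ (λ j → q ≡ 2 ℕ.* j)
  q-even = helper (parity q) refl
    where
    helper : ∀ {m} → Parity m → m ≡ q → Σ ℕ (λ j → q ≡ 2 ℕ.* j)
    helper (even j) eq = j , sym eq
    helper (odd j) eq = ⊥-elim (2≢p (prime⇒irreducible p-prime 2∣p))
      where
      2∣p : 2 ∣ p
      2∣p = divides (2 ℕ.+ j) (trans (sym 3+q≡p) (trans (cong (3 ℕ.+_) (sym eq)) (trans (cong (4 ℕ.+_) (ℕₚ.*-comm 2 j)) refl)))
      2≢p : ¬ (2 ≡ 1 ⊎ 2 ≡ p)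
      2≢p (inj₁ ())
      2≢p (inj₂ eq) = ℕₚ.<⇒≢ (s≤s (s≤s (s≤s z≤n))) (trans eq (sym 3+q≡p))

  pow-neg-q : pow (- 1ℚ) q ≡ 1ℚ
  pow-neg-q = trans (cong (pow (- 1ℚ)) (proj₂ q-even)) (pow-neg-2* (proj₁ q-even))

  pow-neg-1+q : pow (- 1ℚ) (suc q) ≡ - 1ℚ
  pow-neg-1+q = cong (- 1ℚ *_) pow-neg-q

  -- The recursion for B_m divides only by m + 1, which is below p as long as m < p - 1.
  int-B : ∀ m k → k ≤ m → suc m < p → Integral (B k)
  int-B zero zero k≤m m<p = int-1
  int-B (suc m) k k≤1+m m<p = helper (ℕₚ.m≤n⇒m<n∨m≡n k≤1+m)
    where
    helper : k < suc m ⊎ k ≡ suc m → Integral (B k)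
    helper (inj₁ k≤m) = int-B m k (ℕₚ.≤-pred k≤m) (ℕₚ.<⇒≤ m<p)
    helper (inj₂ refl) = subst Integral (sym (B-suc m)) (int-neg (int-* (int-1/[1+] (suc m) (p∤< (suc m) m<p))
      (int-sum (suc m) (λ j j≤m → int-* (int-ι (suc (suc m) C j)) (int-B m j (ℕₚ.≤-pred j≤m) (ℕₚ.<⇒≤ m<p))))))

  int-B≤ : ∀ {k} → k ≤ suc q → Integral (B k)
  int-B≤ {k} k≤ = int-B (suc q) k k≤ (<p ℕₚ.≤-refl)

  int-Bpoly : ∀ {x} → Integral x → Integral (Bpoly (suc q) x)
  int-Bpoly {x} i = int-sum (suc (suc q)) (λ k k< → int-* (int-* (int-ι (suc q C k)) (int-B≤ (ℕₚ.≤-pred k<))) (int-pow (suc q ∸ k) i))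

  Bpoly-≋ : ∀ {x y} → Integral y → x ≋ y [ 1 ] → Bpoly (suc q) x ≋ Bpoly (suc q) y [ 1 ]
  Bpoly-≋ i eq = ≋-sum (suc (suc q)) (λ k k< → ≋-*ˡ _ (int-* (int-ι (suc q C k)) (int-B≤ (ℕₚ.≤-pred k<))) (≋-pow (suc q ∸ k) i eq))

  -- The index p - 2 is odd, and `0<q` makes it at least 2, which excludes B₁ = -1/2.
  Bpoly-at-0 : Bpoly (suc q) 0ℚ ≡ 0ℚ
  Bpoly-at-0 = trans (Bpoly-0 (suc q)) (helper q 0<q pow-neg-1+q)
    where
    helper : ∀ m → 0 < m → pow (- 1ℚ) (suc m) ≡ - 1ℚ → B (suc m) ≡ 0ℚ
    helper (suc m) _ = B-odd m

  1+q≋-2 : ι (suc q) ≋ - ι 2 [ 1 ]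
  1+q≋-2 = ≋-trans (≋-reflexive (trans (l₁ (ι (suc q))) (cong (λ z → z - ι 2) (trans (sym (ι-+ 2 (suc q))) (cong ι 3+q≡p)))))
    (≋-- {c = ι 2} p≋0 ≋-refl)
    where
    l₁ : ∀ a → a ≡ (ι 2 + a) - ι 2
    l₁ = solve-∀ ℚ-ring

  Bpoly≋H₂ : ∀ j → j ≤ 2 ℕ.+ q → Bpoly (suc q) (- ι j) ≋ ι 2 * H₂ j [ 1 ]
  Bpoly≋H₂ zero _ = ≋-reflexive Bpoly-at-0
  Bpoly≋H₂ (suc j) j< = ≋-trans (≋-reflexive difference)
    (≋-trans (≋-- (Bpoly≋H₂ j (ℕₚ.<⇒≤ j<)) (≋-* (int-neg (int-ι 2)) (int-pow q (int-ι (suc j))) 1+q≋-2 (pow-[p-3] j (p∤< j (<p (s≤s j<))))))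
      (≋-reflexive (l₁ (ι 2) (H₂ j) (1/k² j))))
    where
    l₁ : ∀ a h d → a * h - (- a) * d ≡ a * (h + d)
    l₁ = solve-∀ ℚ-ring
    l₂ : ∀ a b → a ≡ a + b - b
    l₂ = solve-∀ ℚ-ring
    l₃ : ∀ a → - a ≡ 1ℚ + - (1ℚ + a)
    l₃ = solve-∀ ℚ-ring
    l₄ : ∀ a → - a ≡ - 1ℚ * a
    l₄ = solve-∀ ℚ-ring
    even-power : pow (- ι (suc j)) q ≡ pow (ι (suc j)) q
    even-power = trans (cong (λ x → pow x q) (l₄ (ι (suc j)))) (trans (pow-* (- 1ℚ) (ι (suc j)) q)
      (trans (cong (_* pow (ι (suc j)) q) pow-neg-q) (ℚ.*-identityˡ (pow (ι (suc j)) q))))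
    difference : Bpoly (suc q) (- ι (suc j)) ≡ Bpoly (suc q) (- ι j) - ι (suc q) * pow (ι (suc j)) q
    difference = begin
      b                                                           ≡⟨ l₂ b (ι (suc q) * pow (- ι (suc j)) q) ⟩
      b + ι (suc q) * pow (- ι (suc j)) q - ι (suc q) * pow (- ι (suc j)) q
        ≡⟨ cong₂ (λ u v → u - ι (suc q) * v) (sym (Bpoly-difference (- ι (suc j)) q)) even-power ⟩
      Bpoly (suc q) (1ℚ + - ι (suc j)) - ι (suc q) * pow (ι (suc j)) q
        ≡⟨ cong (λ x → Bpoly (suc q) x - ι (suc q) * pow (ι (suc j)) q) (trans (cong (λ z → 1ℚ + - z) (ι-suc j)) (sym (l₃ (ι j)))) ⟩
      Bpoly (suc q) (- ι j) - ι (suc q) * pow (ι (suc j)) q       ∎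
      where
      open ≡-Reasoning
      b : ℚ
      b = Bpoly (suc q) (- ι (suc j))

  -- Evaluate `Bpoly≋H₂` at j = p - 1: the argument 1 - p is 1 modulo p, and B_{p-2}(1) = B_{p-2}(0)
  -- = 0 because the difference (p - 2) · 0^(p-3) vanishes for p > 3.
  H₂[p-1]≋0 : H₂ (2 ℕ.+ q) ≋ 0ℚ [ 1 ]
  H₂[p-1]≋0 = ≋-cancel (ι 2) 1/[1+ 1 ] refl (int-1/[1+] 1 p∤2)
    (≋-trans (≋-sym (Bpoly≋H₂ (2 ℕ.+ q) ℕₚ.≤-refl)) (≋-trans (Bpoly-≋ int-1 -[p-1]≋1) (≋-reflexive (trans Bpoly-at-1 (sym (ℚ.*-zeroʳ (ι 2)))))))
    where
    l₁ : ∀ a → - a ≡ 1ℚ - (1ℚ + a)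
    l₁ = solve-∀ ℚ-ring
    -[p-1]≋1 : - ι (2 ℕ.+ q) ≋ 1ℚ [ 1 ]
    -[p-1]≋1 = ≋-trans (≋-reflexive (trans (l₁ (ι (2 ℕ.+ q))) (cong (λ z → 1ℚ - z) 1+ι[p-1]))) (≋-- {a = 1ℚ} {d = 0ℚ} ≋-refl p≋0)
    pow-0 : ∀ m → 0 < m → pow 0ℚ m ≡ 0ℚ
    pow-0 (suc m) _ = ℚ.*-zeroˡ (pow 0ℚ m)
    Bpoly-at-1 : Bpoly (suc q) (1ℚ + 0ℚ) ≡ 0ℚ
    Bpoly-at-1 = trans (Bpoly-difference 0ℚ q) (cong₂ _+_ Bpoly-at-0 (trans (cong (ι (suc q) *_) (pow-0 q 0<q)) (ℚ.*-zeroʳ (ι (suc q)))))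

  int-evenSeq : ∀ {c} → Integral c → ∀ n → Integral (evenSeq c n)
  int-evenSeq {c} i n = helper (parity n)
    where
    open EvenSequence c
    below : ∀ m k → k ≤ m → Integral (T k)
    below zero zero k≤m = int-1
    below (suc m) k k≤1+m = step (ℕₚ.m≤n⇒m<n∨m≡n k≤1+m)
      where
      step : k < suc m ⊎ k ≡ suc m → Integral (T k)
      step (inj₁ k≤m) = below m k (ℕₚ.≤-pred k≤m)
      step (inj₂ refl) = subst Integral (sym (T-suc m)) (int-neg (int-* i (int-sum (suc m) (λ j _ →
        int-* (int-ι ((2 ℕ.* suc m) C (2 ℕ.* suc j))) (below m (m ∸ j) (ℕₚ.m∸n≤m m j))))))
    helper : ∀ {n} → Parity n → Integral (evenSeq c n)
    helper (even j) = subst Integral (sym (X-even j)) (below j j ℕₚ.≤-refl)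
    helper (odd j) = subst Integral (sym (X-odd j)) int-0

  int-U : Integral (U q)
  int-U = int-evenSeq (int-ι 2) q

  int-E : Integral (E q)
  int-E = int-evenSeq int-1 q

  β : ℕ → ℚ
  β k = Bpoly (suc q) 1/[1+ k ]

  int-β : ∀ k → ¬ p ∣ suc k → Integral (β k)
  int-β k p∤k = int-Bpoly (int-1/[1+] k p∤k)

  G≋ : ∀ k → ¬ p ∣ suc k → G k (suc q) ≋ ι 2 * (1/[1+ k ] * β k) [ 1 ]
  G≋ k p∤k = ≋-trans (≋-reflexive (G-odd k (suc q) pow-neg-1+q))
    (≋-*ˡ (ι 2) (int-ι 2) (≋-*ʳ (β k) (int-β k p∤k) (pow-[p-2] k p∤k)))

  t-≋ : ∀ c f → Integral c → Integral (f q) → (const c ⊛ (t ⊛ f)) (suc q) ≋ c * (- ι 2 * f q) [ 1 ]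
  t-≋ c f i j = ≋-trans (≋-reflexive (const-t-⊛ c f q)) (≋-*ˡ c i (≋-*ʳ (f q) j 1+q≋-2))

  -- Coefficient p - 2 of `tU≗G₂` reads 6U ≡ (2/3)β + (1/2)(2/3)β = β. The 1/2 is 2^(p-2) from the
  -- scaling, and 6 is (-3)(-2) with p - 2 ≡ -2.
  β[1/3]≋6U : β 2 ≋ ι 6 * U q [ 1 ]
  β[1/3]≋6U = ≋-sym (≋-trans (≋-reflexive (l₁ (U q))) (≋-trans (≋-sym (t-≋ (- ι 3) U (int-neg (int-ι 3)) int-U))
    (≋-trans (≋-reflexive (tU≗G₂ (suc q)))
      (≋-trans (≋-+ (G≋ 2 p∤3) (≋-* (int-1/[1+] 1 p∤2) (≋-int (int-* (int-ι 2) (int-* (int-1/[1+] 2 p∤3) (int-β 2 p∤3))) (G≋ 2 p∤3)) (pow-[p-2] 1 p∤2) (G≋ 2 p∤3)))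
        (≋-reflexive (l₂ (β 2)))))))
    where
    l₁ : ∀ u → ι 6 * u ≡ - ι 3 * (- ι 2 * u)
    l₁ = solve-∀ ℚ-ring
    l₂ : ∀ b → ι 2 * (1/[1+ 2 ] * b) + 1/[1+ 1 ] * (ι 2 * (1/[1+ 2 ] * b)) ≡ b
    l₂ = solve-∀ ℚ-ring

  β[1/4]≋8E : β 3 ≋ ι 8 * E q [ 1 ]
  β[1/4]≋8E = ≋-trans (≋-reflexive (l₁ (β 3))) (≋-trans (≋-*ˡ (ι 2) (int-ι 2)
    (≋-trans (≋-sym (G≋ 3 (p∤* {2} {2} p∤2 p∤2))) (≋-trans (≋-reflexive (G₃≗tE (suc q))) (t-≋ (- ι 2) E (int-neg (int-ι 2)) int-E))))
    (≋-reflexive (l₂ (E q))))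
    where
    l₁ : ∀ b → b ≡ ι 2 * (ι 2 * (1/[1+ 3 ] * b))
    l₁ = solve-∀ ℚ-ring
    l₂ : ∀ u → ι 2 * (- ι 2 * (- ι 2 * u)) ≡ ι 8 * u
    l₂ = solve-∀ ℚ-ring

  -- Coefficient p - 2 of `G₅≗tU+G₂` reads (1/3)β ≡ 6U + (2/3) · 6U = 10U.
  β[1/6]≋30U : β 5 ≋ ι 30 * U q [ 1 ]
  β[1/6]≋30U = ≋-trans (≋-reflexive (l₁ (β 5))) (≋-trans (≋-*ˡ (ι 3) (int-ι 3)
    (≋-trans (≋-sym (G≋ 5 (p∤* {2} {3} p∤2 p∤3))) (≋-trans (≋-reflexive (G₅≗tU+G₂ (suc q)))
      (≋-+ (t-≋ (- ι 3) U (int-neg (int-ι 3)) int-U)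
        (≋-trans (G≋ 2 p∤3) (≋-*ˡ (ι 2) (int-ι 2) (≋-*ˡ 1/[1+ 2 ] (int-1/[1+] 2 p∤3) β[1/3]≋6U)))))))
    (≋-reflexive (l₂ (U q))))
    where
    l₁ : ∀ b → b ≡ ι 3 * (ι 2 * (1/[1+ 5 ] * b))
    l₁ = solve-∀ ℚ-ring
    l₂ : ∀ u → ι 3 * (- ι 3 * (- ι 2 * u) + ι 2 * (1/[1+ 2 ] * (ι 6 * u))) ≡ ι 30 * u
    l₂ = solve-∀ ℚ-ring

-- Telescoping

-- At x = 0 only the term k = 0 survives. This gives the starting value F(0) = p of the telescoping.
ΣV-0 : ∀ N → ΣV N 0ℚ ≡ ι N
ΣV-0 N = trans (sum-cong N V-0) (sum-1 N)
  where
  V-0 : ∀ n → V n 0ℚ ≡ 1ℚ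
  V-0 n = begin
    V n 0ℚ                                                       ≡⟨ V≡ΣQQ 0ℚ (ℕₚ.n<1+n n) ⟩
    sumTo (suc n) (λ k → Q k (ι n) * Q k 0ℚ)                     ≡⟨ sum-first n (λ k → Q k (ι n) * Q k 0ℚ) ⟩
    1ℚ + sumTo n (λ k → Q (suc k) (ι n) * Q (suc k) 0ℚ)          ≡⟨ cong (λ z → 1ℚ + z) (trans (sum-cong n (λ k →
      trans (cong (Q (suc k) (ι n) *_) (Q-vanishes 0 (suc k) (s≤s z≤n))) (ℚ.*-zeroʳ (Q (suc k) (ι n))))) (sum-0 n)) ⟩
    1ℚ                                                           ∎
    where open ≡-Reasoning
  sum-1 : ∀ N → sumTo N (λ _ → 1ℚ) ≡ ι N
  sum-1 zero = refl
  sum-1 (suc N) = trans (cong (_+ 1ℚ) (sum-1 N)) (trans (ℚ.+-comm (ι N) 1ℚ) (sym (ι-suc N)))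

ι-^ : ∀ m k → pow (ι m) k ≡ ι (m ℕ.^ k)
ι-^ m zero = refl
ι-^ m (suc k) = trans (cong (ι m *_) (ι-^ m k)) (sym (ι-* m (m ℕ.^ k)))

div-unique : ∀ r m k → .{{_ : ℕ.NonZero k}} → r < k → (r ℕ.+ m ℕ.* k) div k ≡ m
div-unique r m k r<k = trans (ℕ/.+-distrib-/-∣ʳ r (divides m refl)) (cong₂ ℕ._+_ (ℕ/.m<n⇒m/n≡0 r<k) (ℕ/.m*n/n≡m m k))

unscale : ∀ k n v → pow (ι (suc k)) n * v * inv (pow (ι (suc k)) n) ≡ v
unscale k n v = trans (lem (pow (ι (suc k)) n) v (inv (pow (ι (suc k)) n)))
  (trans (cong (_* v) (inv-inverse (pow (ι (suc k)) n) (unit≢0 (pow (ι (suc k)) n) (pow 1/[1+ k ] n)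
    (trans (sym (pow-* (ι (suc k)) 1/[1+ k ] n)) (trans (cong (λ x → pow x n) (1/[1+]-inverse k)) (pow-1 n))))))
    (ℚ.*-identityˡ v))
  where
  lem : ∀ a v b → a * v * b ≡ a * b * v
  lem = solve-∀ ℚ-ring

module Telescoping (p q : ℕ) (p-prime : Prime p) (0<q : 0 < q) (3+q≡p : 3 ℕ.+ q ≡ p) where
  open Congruences p p-prime
  open ModPrime p q p-prime 0<q 3+q≡p
  open SumOfV p p-prime (subst (λ m → H₂ m ≋ 0ℚ [ 1 ]) (cong (_∸ 1) 3+q≡p) H₂[p-1]≋0)

  F : ℚ → ℚ
  F y = (y + y + 1ℚ) * ΣV p y

  F-step : ∀ {y y′} → y ≢ 0ℚ → y - 1ℚ ≡ y′ → F y ≡ F y′ + ι 2 * ι p * D p y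
  F-step {y} y≢0 refl = trans (ΣV-difference p y y≢0) (cong (_+ ι 2 * ι p * D p y) (cong (_* ΣV p (y - 1ℚ)) (lem y)))
    where
    lem : ∀ y → y + y - 1ℚ ≡ (y - 1ℚ) + (y - 1ℚ) + 1ℚ
    lem = solve-∀ ℚ-ring

  p³ : ℚ
  p³ = ι p * p²

  p³≋0 : p³ ≋ 0ℚ [ 3 ]
  p³≋0 = ≋0-* p≋0 p²≋0

  -- The right side of the theorem multiplied by 1 + 2x, with t for x' and 2 H₂(i) for B_{p-2}(-x).
  Φ : ℚ → ℕ → ℚ
  Φ t i = ι p * (1ℚ + t + t) + p³ * ((t * t + t + 1ℚ) * (ι 2 * H₂ i))

  2p≋0 : ι 2 * ι p ≋ 0ℚ [ 1 ]
  2p≋0 = ≋-trans (≋-*ˡ (ι 2) (int-ι 2) p≋0) (≋-reflexive (ℚ.*-zeroʳ (ι 2)))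

  ι-positive≢0 : ∀ {m} → 0 < m → ι m ≢ 0ℚ
  ι-positive≢0 {suc m} _ = ι-suc≢0 m

  -- Induction along pT + i in unit steps, i running through a block and T counting blocks. The
  -- congruences for D hold modulo p³, and the factor 2p in front of D lifts them to p⁴.
  telescope : ∀ T i → i ≤ n → F (ι p * ι T + ι i) ≋ Φ (ι T) i [ 4 ]
  telescope zero zero _ = ≋-reflexive (trans (cong F (trans (ℚ.+-identityʳ (ι p * 0ℚ)) (ℚ.*-zeroʳ (ι p)))) (trans (cong (1ℚ *_) (ΣV-0 p)) (lem (ι p) p³)))
    where
    lem : ∀ p c → 1ℚ * p ≡ p * (1ℚ + 0ℚ + 0ℚ) + c * ((0ℚ * 0ℚ + 0ℚ + 1ℚ) * (ι 2 * 0ℚ))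
    lem = solve-∀ ℚ-ring
  telescope T (suc i) i<n = ≋-trans (≋-reflexive (F-step y≢0 (y-suc (ι T) (int-ι T) i)))
    (≋-trans (≋-+ (telescope T i (ℕₚ.<⇒≤ i<n)) (≋-absorb {j = 1} 2p≋0 (D≋ (ι T) (int-ι T) i i<n)))
      (≋-reflexive (lem (ι p) (ι T) (ι 2) (H₂ i) (1/k² i))))
    where
    y≢0 : ι p * ι T + ι (suc i) ≢ 0ℚ
    y≢0 = subst (_≢ 0ℚ) (trans (ι-+ (p ℕ.* T) (suc i)) (cong (_+ ι (suc i)) (ι-* p T)))
      (ι-positive≢0 (ℕₚ.<-≤-trans (s≤s z≤n) (ℕₚ.m≤n+m (suc i) (p ℕ.* T))))
    lem : ∀ p t c h d → p * (1ℚ + t + t) + p * (p * p) * ((t * t + t + 1ℚ) * (c * h)) + c * p * (p * p * (t * t + t + 1ℚ) * d)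
      ≡ p * (1ℚ + t + t) + p * (p * p) * ((t * t + t + 1ℚ) * (c * (h + d)))
    lem = solve-∀ ℚ-ring
  -- The predecessor of p(T + 1) is pT + (p - 1). There H₂(p-1) ≡ 0 wipes out the p³ term, and D ≡ 1
  -- adds 2p, turning 1 + 2T into 1 + 2(T + 1).
  telescope (suc T) zero _ = ≋-trans (≋-reflexive (trans (cong F (ℚ.+-identityʳ (ι p * ι (suc T)))) (F-step y≢0 y-1)))
    (≋-trans (≋-+ (≋-trans (telescope T n ℕₚ.≤-refl) Φ-last) (≋-absorb {j = 1} 2p≋0 (D≋1 (ι (suc T)) (int-ι (suc T)))))
      (≋-reflexive (trans (l₁ (ι p) (ι T) p³) (cong (λ z → ι p * (1ℚ + z + z) + p³ * ((z * z + z + 1ℚ) * (ι 2 * 0ℚ))) (sym (ι-suc T))))))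
    where
    y≢0 : ι p * ι (suc T) ≢ 0ℚ
    y≢0 = subst (_≢ 0ℚ) (ι-* p (suc T)) (ι-positive≢0 (ℕₚ.≤-trans (ℕₚ.<⇒≤ 1<p) (ℕₚ.m≤m*n p (suc T))))
    l₀ : ∀ n t → (1ℚ + n) * (1ℚ + t) - 1ℚ ≡ (1ℚ + n) * t + n
    l₀ = solve-∀ ℚ-ring
    y-1 : ι p * ι (suc T) - 1ℚ ≡ ι p * ι T + ι n
    y-1 = trans (cong₂ (λ a b → a * b - 1ℚ) (sym 1+ιn≡ιp) (ι-suc T)) (trans (l₀ (ι n) (ι T)) (cong (λ a → a * ι T + ι n) 1+ιn≡ιp))
    l₁ : ∀ p t c → p * (1ℚ + t + t) + 0ℚ + ι 2 * p * 1ℚ ≡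
      p * (1ℚ + (1ℚ + t) + (1ℚ + t)) + c * (((1ℚ + t) * (1ℚ + t) + (1ℚ + t) + 1ℚ) * (ι 2 * 0ℚ))
    l₁ = solve-∀ ℚ-ring
    H₂n≋0 : H₂ n ≋ 0ℚ [ 1 ]
    H₂n≋0 = subst (λ m → H₂ m ≋ 0ℚ [ 1 ]) (cong (_∸ 1) 3+q≡p) H₂[p-1]≋0
    Φ-last : Φ (ι T) n ≋ ι p * (1ℚ + ι T + ι T) + 0ℚ [ 4 ]
    Φ-last = ≋-+ {a = ι p * (1ℚ + ι T + ι T)} ≋-refl (≋0-* {i = 3} {j = 1} p³≋0 (≋-trans
      (≋-*ˡ (ι T * ι T + ι T + 1ℚ) (int-+ (int-+ (int-* (int-ι T) (int-ι T)) (int-ι T)) int-1)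
        (≋-trans (≋-*ˡ (ι 2) (int-ι 2) H₂n≋0) (≋-reflexive (ℚ.*-zeroʳ (ι 2)))))
      (≋-reflexive (ℚ.*-zeroʳ (ι T * ι T + ι T + 1ℚ)))))

  -- num / d ≡ num d^(p-2), with a negative numerator -m replaced by m (p - 1).
  residue : ∀ {x} → Integral x → Σ ℕ (λ r → x ≋ ι r [ 1 ])
  residue {x} (fraction num zero p∤d eq) = ⊥-elim (p∤d (divides 0 refl))
  residue {x} i@(fraction num d@(suc d-1) p∤d eq) = natural num eq
    where
    l₁ : ∀ x d z → x * (d * z) ≡ x * d * z
    l₁ = solve-∀ ℚ-ring
    x≋num*d^ : ∀ m → x * ι d ≡ m → x ≋ m * ι (d ℕ.^ suc q) [ 1 ]
    x≋num*d^ m e = ≋-sym (≋-trans (≋-reflexive (trans (cong₂ _*_ (sym e) (sym (ι-^ d (suc q)))) (sym (l₁ x (ι d) (pow (ι d) (suc q))))))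
      (≋-trans (≋-*ˡ x i (fermat d-1 p∤d)) (≋-reflexive (ℚ.*-identityʳ x))))
    l₂ : ∀ a n w → - a * w ≡ a * (1ℚ * n) * w - (1ℚ + n) * (a * w)
    l₂ = solve-∀ ℚ-ring
    l₃ : ∀ z a → z - 0ℚ * a ≡ z
    l₃ = solve-∀ ℚ-ring
    l₄ : ∀ a n w → a * (1ℚ * n) * w ≡ a * n * w
    l₄ = solve-∀ ℚ-ring
    natural : ∀ m → x * ι d ≡ ζ m → Σ ℕ (λ r → x ≋ ι r [ 1 ])
    natural (+ m) e = m ℕ.* d ℕ.^ suc q , ≋-trans (x≋num*d^ (ι m) e) (≋-reflexive (sym (ι-* m (d ℕ.^ suc q))))
    natural (ℤ.-[1+ m ]) e = suc m ℕ.* n ℕ.* d ℕ.^ suc q , ≋-trans (x≋num*d^ (- ι (suc m)) e)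
      (≋-trans (≋-reflexive (trans (l₂ a (ι n) w) (cong (λ z → a * (1ℚ * ι n) * w - z * (a * w)) 1+ιn≡ιp)))
        (≋-trans (≋-- {a = a * (1ℚ * ι n) * w} ≋-refl (≋-*ʳ (a * w) (int-* (int-ι (suc m)) (int-ι (d ℕ.^ suc q))) p≋0))
          (≋-reflexive (trans (l₃ (a * (1ℚ * ι n) * w) (a * w)) (trans (l₄ a (ι n) w)
            (sym (trans (ι-* (suc m ℕ.* n) (d ℕ.^ suc q)) (cong (_* w) (ι-* (suc m) n)))))))))
      where
      a w : ℚ
      a = ι (suc m)
      w = ι (d ℕ.^ suc q)

  -- Built digit by digit: with r from `residue`, x = r + pγ, and γ is approximated to one power
  -- less. The digits r need only represent their residue class; they may exceed p.
  approximate : ∀ k {x} → Integral x → Σ ℕ (λ T → x ≋ ι T [ k ])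
  approximate zero {x} i = 0 , congruent (x - 0ℚ) (int-- i int-0) (sym (ℚ.*-identityˡ (x - 0ℚ)))
  approximate (suc k) {x} i = r ℕ.+ p ℕ.* T , congruent γ′ γ′-int (begin
    x - ι (r ℕ.+ p ℕ.* T)                ≡⟨ cong (λ z → x - z) (trans (ι-+ r (p ℕ.* T)) (cong (λ z → ι r + z) (ι-* p T))) ⟩
    x - (ι r + ι p * ι T)                ≡⟨ l₁ x (ι r) (ι p * ι T) ⟩
    (x - ι r) - ι p * ι T                ≡⟨ cong (_- ι p * ι T) x-r ⟩
    ι p * 1ℚ * γ - ι p * ι T             ≡⟨ l₂ (ι p) γ (ι T) ⟩
    ι p * (γ - ι T)                      ≡⟨ cong (ι p *_) γ-T ⟩
    ι p * (pow (ι p) k * γ′)             ≡⟨ sym (ℚ.*-assoc (ι p) (pow (ι p) k) γ′) ⟩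
    ι p * pow (ι p) k * γ′               ∎)
    where
    open ≡-Reasoning
    r : ℕ
    r = proj₁ (residue i)
    open _≋_[_] (proj₂ (residue i)) renaming (quot to γ; quot-int to γ-int; diff to x-r)
    T : ℕ
    T = proj₁ (approximate k γ-int)
    open _≋_[_] (proj₂ (approximate k γ-int)) renaming (quot to γ′; quot-int to γ′-int; diff to γ-T)
    l₁ : ∀ x r z → x - (r + z) ≡ (x - r) - z
    l₁ = solve-∀ ℚ-ring
    l₂ : ∀ p c t → p * 1ℚ * c - p * t ≡ p * (c - t)
    l₂ = solve-∀ ℚ-ring

  int-binom : ∀ k {x} → k < p → Integral x → Integral (binom x k)
  int-binom zero k<p i = int-1
  int-binom (suc k) k<p i = int-* (int-binom k (ℕₚ.<⇒≤ k<p) i) (int-* (int-- i (int-ι k)) (int-1/[1+] k (p∤< k k<p)))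

  binom-≋ : ∀ k {x y j} → k < p → Integral x → Integral y → x ≋ y [ j ] → binom x k ≋ binom y k [ j ]
  binom-≋ zero k<p i i′ eq = ≋-refl
  binom-≋ (suc k) k<p i i′ eq = ≋-* (int-binom k (ℕₚ.<⇒≤ k<p) i′) (int-* (int-- i (int-ι k)) d-int)
    (binom-≋ k (ℕₚ.<⇒≤ k<p) i i′ eq) (≋-*ʳ 1/[1+ k ] d-int (≋-- eq ≋-refl))
    where
    d-int : Integral 1/[1+ k ]
    d-int = int-1/[1+] k (p∤< k k<p)

  -- For n < p only binomials of order k < p occur. Their denominators k! are units, so V_n is a
  -- polynomial with p-integral coefficients.
  ΣV-≋ : ∀ {x y j} → Integral x → Integral y → x ≋ y [ j ] → ΣV p x ≋ ΣV p y [ j ]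
  ΣV-≋ {x} {y} i i′ eq = ≋-sum p (λ m m<p → ≋-sum (suc m) (λ k k≤m → term m k (ℕₚ.≤-<-trans (ℕₚ.≤-pred k≤m) m<p)))
    where
    reflected : ∀ {x} → Integral x → Integral (- 1ℚ - x)
    reflected i = int-- (int-neg int-1) i
    term : ∀ m k → k < p →
      ι (m C k) * ι ((m ℕ.+ k) C k) * pow (- 1ℚ) k * binom x k * binom (- 1ℚ - x) k ≋
      ι (m C k) * ι ((m ℕ.+ k) C k) * pow (- 1ℚ) k * binom y k * binom (- 1ℚ - y) k [ _ ]
    term m k k<p = ≋-* (int-* c-int (int-binom k k<p i′)) (int-binom k k<p (reflected i))
      (≋-*ˡ (ι (m C k) * ι ((m ℕ.+ k) C k) * pow (- 1ℚ) k) c-int (binom-≋ k k<p i i′ eq))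
      (binom-≋ k k<p (reflected i) (reflected i′) (≋-- {a = - 1ℚ} ≋-refl eq))
      where
      c-int : Integral (ι (m C k) * ι ((m ℕ.+ k) C k) * pow (- 1ℚ) k)
      c-int = int-* (int-* (int-ι (m C k)) (int-ι ((m ℕ.+ k) C k))) (int-pow k (int-neg int-1))

  -- Here c is x' and v is 1/(1 + 2x). They are given by equations rather than through `inv`, so
  -- that the special cases can supply explicit fractions.
  ΣV-formula : ∀ x c v r → Integral x → Integral c → Integral v → r < p →
    x ≡ ι p * c + ι r → (x + x + 1ℚ) * v ≡ 1ℚ →
    ΣV p x ≋ (1ℚ + ι 2 * c) * v * ι p + (c * (c + 1ℚ) + 1ℚ) * v * pow (ι p) 3 * Bpoly (suc q) (- x) [ 4 ]
  ΣV-formula x c v r x-int c-int v-int r<p x≡ uv = ≋-cancel u v uv v-int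
    -- The point X = pT + r replaces x, first in the sum and then in the factor 1 + 2x; after
    -- `telescope`, T is exchanged for c again. In the p³ term T ≡ c modulo p suffices for that.
    (≋-trans (≋-*ˡ u u-int (ΣV-≋ x-int X-int x≋X))
      (≋-trans (≋-*ʳ (ΣV p X) (int-ΣV X-int) (≋-+ (≋-+ x≋X x≋X) (≋-refl {a = 1ℚ})))
        (≋-trans (telescope T r r≤n) (≋-trans Φ≋ (≋-reflexive final)))))
    where
    u : ℚ
    u = x + x + 1ℚ
    u-int : Integral u
    u-int = int-+ (int-+ x-int x-int) int-1
    T : ℕ
    T = proj₁ (approximate 4 c-int)
    c≋T : c ≋ ι T [ 4 ]
    c≋T = proj₂ (approximate 4 c-int)
    X : ℚ
    X = ι p * ι T + ι r
    X-int : Integral X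
    X-int = int-+ (int-* (int-ι p) (int-ι T)) (int-ι r)
    x≋X : x ≋ X [ 4 ]
    x≋X = ≋-trans (≋-reflexive x≡) (≋-+ (≋-*ˡ (ι p) (int-ι p) c≋T) ≋-refl)
    int-ΣV : ∀ {y} → Integral y → Integral (ΣV p y)
    int-ΣV {y} i = int-sum p (λ m m<p → int-sum (suc m) (λ k k≤m → int-* (int-* (int-* (int-* (int-ι (m C k)) (int-ι ((m ℕ.+ k) C k))) (int-pow k (int-neg int-1)))
      (int-binom k (ℕₚ.≤-<-trans (ℕₚ.≤-pred k≤m) m<p) i)) (int-binom k (ℕₚ.≤-<-trans (ℕₚ.≤-pred k≤m) m<p) (int-- (int-neg int-1) i))))
    r≤n : r ≤ n
    r≤n = ℕₚ.≤-pred (subst (r <_) (sym 1+n≡p) r<p)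
    b : ℚ
    b = Bpoly (suc q) (- x)
    -x≋-r : - x ≋ - ι r [ 1 ]
    -x≋-r = ≋-neg (≋-trans (≋-reflexive x≡) (≋-trans (≋-+ (≋0-*ʳ c c-int p≋0) ≋-refl) (≋-reflexive (ℚ.+-identityˡ (ι r)))))
    2H₂≋b : ι 2 * H₂ r ≋ b [ 1 ]
    2H₂≋b = ≋-sym (≋-trans (Bpoly-≋ (int-neg (int-ι r)) -x≋-r) (Bpoly≋H₂ r (subst (r ≤_) (sym (cong (_∸ 1) 3+q≡p)) r≤n)))
    T≋c : ι T ≋ c [ 4 ]
    T≋c = ≋-sym c≋T
    T≋c₁ : ι T ≋ c [ 1 ]
    T≋c₁ = ≋-weaken 3 T≋c
    Φ≋ : Φ (ι T) r ≋ ι p * (1ℚ + c + c) + p³ * ((c * c + c + 1ℚ) * b) [ 4 ]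
    Φ≋ = ≋-+ (≋-*ˡ (ι p) (int-ι p) (≋-+ (≋-+ (≋-refl {a = 1ℚ}) T≋c) T≋c))
      (≋-absorb {j = 3} {k = 1} p³≋0 (≋-* (int-+ (int-+ (int-* c-int c-int) c-int) int-1) (int-* (int-ι 2) (int-H₂ r≤n))
        (≋-+ (≋-+ (≋-* c-int (int-ι T) T≋c₁ T≋c₁) T≋c₁) (≋-refl {a = 1ℚ})) 2H₂≋b))
    l₁ : ∀ p c b → p * (1ℚ + c + c) + p * (p * p) * ((c * c + c + 1ℚ) * b) ≡
      1ℚ * ((1ℚ + ι 2 * c) * p + (c * (c + 1ℚ) + 1ℚ) * (p * (p * (p * 1ℚ))) * b)
    l₁ = solve-∀ ℚ-ring
    l₂ : ∀ u v p c d b → u * v * (c * p + d * (p * (p * (p * 1ℚ))) * b) ≡ u * (c * v * p + d * v * (p * (p * (p * 1ℚ))) * b)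
    l₂ = solve-∀ ℚ-ring
    final : ι p * (1ℚ + c + c) + p³ * ((c * c + c + 1ℚ) * b) ≡ u * ((1ℚ + ι 2 * c) * v * ι p + (c * (c + 1ℚ) + 1ℚ) * v * pow (ι p) 3 * b)
    final = trans (l₁ (ι p) c b) (trans (cong (_* ((1ℚ + ι 2 * c) * ι p + (c * (c + 1ℚ) + 1ℚ) * (ι p * (ι p * (ι p * 1ℚ))) * b)) (sym uv))
      (l₂ u v (ι p) (1ℚ + ι 2 * c) (c * (c + 1ℚ) + 1ℚ) b))

-- The values at -1/3, -1/4 and -1/6

data Mod3 : ℕ → Set where
  0mod3 : ∀ a → Mod3 (3 ℕ.* a)
  1mod3 : ∀ a → Mod3 (1 ℕ.+ 3 ℕ.* a)
  2mod3 : ∀ a → Mod3 (2 ℕ.+ 3 ℕ.* a)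

mod3 : ∀ n → Mod3 n
mod3 zero = 0mod3 0
mod3 (suc n) = next (mod3 n)
  where
  next : ∀ {n} → Mod3 n → Mod3 (suc n)
  next (0mod3 a) = 1mod3 a
  next (1mod3 a) = 2mod3 a
  next (2mod3 a) = subst Mod3 (ℕₚ.*-suc 3 a) (0mod3 (suc a))

ι-affine : ∀ m k a → ι (m ℕ.+ k ℕ.* a) ≡ ι m + ι k * ι a
ι-affine m k a = trans (ι-+ m (k ℕ.* a)) (cong (λ z → ι m + z) (ι-* k a))

affine-< : ∀ {m k m′ k′} a → m < m′ → k ≤ k′ → m ℕ.+ k ℕ.* a < m′ ℕ.+ k′ ℕ.* a
affine-< a m< k≤ = ℕₚ.+-mono-<-≤ m< (ℕₚ.*-monoˡ-≤ a k≤)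

module Consequences (p q : ℕ) (p-prime : Prime p) (0<q : 0 < q) (3+q≡p : 3 ℕ.+ q ≡ p) where
  open Congruences p p-prime
  open ModPrime p q p-prime 0<q 3+q≡p
  open Telescoping p q p-prime 0<q 3+q≡p

  ΣV≋ : ∀ x → InZp p x → ¬ Cong p 1 (ι 2 * x + 1ℚ) 0ℚ → ∀ r → r < p → Cong p 1 x (ι r) →
    ΣV p x ≋ (1ℚ + ι 2 * ((x - ι r) * inv (ι p))) * inv (1ℚ + ι 2 * x) * ι p
      + (((x - ι r) * inv (ι p)) * (((x - ι r) * inv (ι p)) + 1ℚ) + 1ℚ)
        * inv (1ℚ + ι 2 * x) * pow (ι p) 3 * Bpoly (suc q) (- x) [ 4 ]
  ΣV≋ x x∈Zp u≇0 r r<p x≡r = ΣV-formula x x′ v r x-int x′-int v-int r<p x≡ uv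
    where
    open _≋_[_] (Cong⇒≋ {x} {ι r} {1} x≡r) renaming (quot to γ; quot-int to γ-int; diff to x-r)
    x-int : Integral x
    x-int = InZp⇒Integral x∈Zp
    x′ u v : ℚ
    x′ = (x - ι r) * inv (ι p)
    u = 1ℚ + ι 2 * x
    v = inv u
    l₁ : ∀ x → ι 2 * x + 1ℚ ≡ 1ℚ + ι 2 * x
    l₁ = solve-∀ ℚ-ring
    l₂ : ∀ x → x + x + 1ℚ ≡ 1ℚ + ι 2 * x
    l₂ = solve-∀ ℚ-ring
    l₃ : ∀ p c i → p * 1ℚ * c * i ≡ p * i * c
    l₃ = solve-∀ ℚ-ring
    l₄ : ∀ x r → x ≡ (x - r) + r
    l₄ = solve-∀ ℚ-ring
    l₅ : ∀ y p i → y * (p * i) ≡ p * (y * i)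
    l₅ = solve-∀ ℚ-ring
    u≇0′ : ¬ u ≋ 0ℚ [ 1 ]
    u≇0′ u≋0 = u≇0 (≋⇒Cong (≋-trans (≋-reflexive (l₁ x)) u≋0))
    u-int : Integral u
    u-int = int-+ int-1 (int-* (int-ι 2) x-int)
    v-int : Integral v
    v-int = int-inv u-int u≇0′
    uv : (x + x + 1ℚ) * v ≡ 1ℚ
    uv = trans (cong (_* v) (l₂ x)) (inv-inverse u (λ u≡0 → u≇0′ (≋-reflexive u≡0)))
    p-inverse : ι p * inv (ι p) ≡ 1ℚ
    p-inverse = inv-inverse (ι p) (ι-positive≢0 (ℕₚ.<⇒≤ 1<p))
    x′-int : Integral x′
    x′-int = subst Integral (sym (trans (cong (_* inv (ι p)) x-r) (trans (l₃ (ι p) γ (inv (ι p))) (trans (cong (_* γ) p-inverse) (ℚ.*-identityˡ γ))))) γ-int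
    x≡ : x ≡ ι p * x′ + ι r
    x≡ = trans (l₄ x (ι r)) (cong (_+ ι r) (trans (sym (ℚ.*-identityʳ (x - ι r))) (trans (cong ((x - ι r) *_) (sym p-inverse)) (l₅ (x - ι r) (ι p) (inv (ι p))))))

  int-1/2 : Integral 1/[1+ 1 ]
  int-1/2 = int-1/[1+] 1 p∤2

  int-1/3 : Integral 1/[1+ 2 ]
  int-1/3 = int-1/[1+] 2 p∤3

  p∤4 : ¬ p ∣ 4
  p∤4 = p∤* {2} {2} p∤2 p∤2

  p∤6 : ¬ p ∣ 6
  p∤6 = p∤* {2} {3} p∤2 p∤3

  int-1/4 : Integral 1/[1+ 3 ]
  int-1/4 = int-1/[1+] 3 p∤4

  int-1/6 : Integral 1/[1+ 5 ]
  int-1/6 = int-1/[1+] 5 p∤6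

  -- The number κ is 6, 8 or 30, from the value of B_{p-2} at 1/3, 1/4 or 1/6. With c = x' and v =
  -- 1/(1 + 2x), the coefficient w is (c(c + 1) + 1) v κ: 7/9 · 3 · 6 = 14, 13/16 · 2 · 8 = 13 and
  -- 31/36 · 3/2 · 30 = 155/4. The base of the powers is m + 1.
  ΣV-at-reciprocal : ∀ k c v r κ s w N m → ¬ p ∣ suc k → Integral c → Integral v → r < p →
    - 1/[1+ k ] ≡ ι p * c + ι r → (- 1/[1+ k ] + - 1/[1+ k ] + 1ℚ) * v ≡ 1ℚ →
    β k ≋ κ * N [ 1 ] → (1ℚ + ι 2 * c) * v ≡ s → (c * (c + 1ℚ) + 1ℚ) * v * κ ≡ w →
    sumTo p (λ i → pow (ι (suc m)) i * V i (- 1/[1+ k ]) * inv (pow (ι (suc m)) i)) ≋ s * ι p + w * pow (ι p) 3 * N [ 4 ]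
  ΣV-at-reciprocal k c v r κ s w N m p∤k c-int v-int r<p x≡ uv β≋ refl refl =
    ≋-trans (≋-reflexive (sum-cong p (λ i → unscale m i (V i (- 1/[1+ k ])))))
      (≋-trans (ΣV-formula (- 1/[1+ k ]) c v r (int-neg (int-1/[1+] k p∤k)) c-int v-int r<p x≡ uv)
        (≋-+ (≋-refl {a = s * ι p}) (≋-trans (≋-reflexive (trans (cong (λ x → ν * v * pow (ι p) 3 * Bpoly (suc q) x) (l₁ 1/[1+ k ])) (l₂ (ν * v) (pow (ι p) 3) (β k))))
          (≋-trans (≋-absorb {j = 3} {k = 1} (pow-p≋0 3) (≋-*ˡ (ν * v) (int-* (int-+ (int-* c-int (int-+ c-int int-1)) int-1) v-int) β≋))
            (≋-reflexive (l₃ (ν * v) (pow (ι p) 3) κ N))))))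
    where
    ν : ℚ
    ν = c * (c + 1ℚ) + 1ℚ
    l₁ : ∀ a → - (- a) ≡ a
    l₁ = solve-∀ ℚ-ring
    l₂ : ∀ a p b → a * p * b ≡ p * (a * b)
    l₂ = solve-∀ ℚ-ring
    l₃ : ∀ a p k n → p * (a * (k * n)) ≡ a * k * p * n
    l₃ = solve-∀ ℚ-ring

  ΣV3 ΣV4 ΣV6 : ℚ
  ΣV3 = sumTo p (λ i → V3 i * inv (pow (ι 27) i))
  ΣV4 = sumTo p (λ i → V4 i * inv (pow (ι 64) i))
  ΣV6 = sumTo p (λ i → V6 i * inv (pow (ι 432) i))

  q≡2j : ∀ {j} → proj₁ q-even ≡ j → 3 ℕ.+ 2 ℕ.* j ≡ p
  q≡2j refl = trans (cong (3 ℕ.+_) (sym (proj₂ q-even))) 3+q≡p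

  sign-odd : ∀ {m} a → m ≡ suc (2 ℕ.* a) → - 1ℚ ≡ pow (- 1ℚ) m
  sign-odd a eq = sym (trans (cong (pow (- 1ℚ)) eq) (pow-neg-1+2* a))

  sign-even : ∀ {m} a → m ≡ 2 ℕ.* a → 1ℚ ≡ pow (- 1ℚ) m
  sign-even a eq = sym (trans (cong (pow (- 1ℚ)) eq) (pow-neg-2* a))

  -- The residue of p modulo 6 settles -1/3 and -1/6 at once. For x = -1/d choose 0 < m < d with mp
  -- ≡ 1 modulo d; then ⟨x⟩ = (mp - 1)/d and x' = -m/d. This is the origin of the witnesses below: m
  -- = 1 if p ≡ 1 modulo d, and m = d - 1 if p ≡ -1.
  thirds-sixths :
    (ΣV3 ≋ pow (- 1ℚ) (p div 3) * ι p + ι 14 * pow (ι p) 3 * U q [ 4 ]) ×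
    (ΣV6 ≋ pow (- 1ℚ) (p div 3) * ι p + Data.Rational._/_ (+ 155) 4 * pow (ι p) 3 * U q [ 4 ])
  thirds-sixths = helper (mod3 (proj₁ q-even)) (q≡2j refl)
    where
    helper : ∀ {j} → Mod3 j → 3 ℕ.+ 2 ℕ.* j ≡ p →
      (ΣV3 ≋ pow (- 1ℚ) (p div 3) * ι p + ι 14 * pow (ι p) 3 * U q [ 4 ]) ×
      (ΣV6 ≋ pow (- 1ℚ) (p div 3) * ι p + Data.Rational._/_ (+ 155) 4 * pow (ι p) 3 * U q [ 4 ])
    helper (0mod3 a) eq = ⊥-elim (3≢p (prime⇒irreducible p-prime (divides (1 ℕ.+ 2 ℕ.* a) (trans (sym eq) (l a)))))
      where
      l : ∀ a → 3 ℕ.+ 2 ℕ.* (3 ℕ.* a) ≡ (1 ℕ.+ 2 ℕ.* a) ℕ.* 3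
      l = ℕRing.solve-∀
      3≢p : ¬ (3 ≡ 1 ⊎ 3 ≡ p)
      3≢p (inj₁ ())
      3≢p (inj₂ 3≡p) = ℕₚ.<⇒≢ (ℕₚ.m<m+n 3 0<q) (trans 3≡p (sym 3+q≡p))
    -- p = 6a + 5: the residues are (2p - 1)/3 and (5p - 1)/6, with x' = -2/3 and -5/6; [p/3] = 2a +
    -- 1 is odd.
    helper (1mod3 a) eq =
      ΣV-at-reciprocal 2 (- (ι 2 * 1/[1+ 2 ])) (ι 3) (3 ℕ.+ 4 ℕ.* a) (ι 6) _ (ι 14) (U q) 26 p∤3
        (int-neg (int-* (int-ι 2) int-1/3)) (int-ι 3) (<P (s≤s (s≤s (s≤s (s≤s z≤n)))) (ℕₚ.m≤m+n 4 2))
        (trans (l₁ (ι a)) (cong₂ (λ P R → P * - (ι 2 * 1/[1+ 2 ]) + R) ιp (sym (ι-affine 3 4 a)))) refl β[1/3]≋6U (sign-odd a p/3) refl ,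
      ΣV-at-reciprocal 5 (- (ι 5 * 1/[1+ 5 ])) (ι 3 * 1/[1+ 1 ]) (4 ℕ.+ 5 ℕ.* a) (ι 30) _ _ (U q) 431 p∤6
        (int-neg (int-* (int-ι 5) int-1/6)) (int-* (int-ι 3) int-1/2) (<P (s≤s (s≤s (s≤s (s≤s (s≤s z≤n))))) (ℕₚ.m≤m+n 5 1))
        (trans (l₂ (ι a)) (cong₂ (λ P R → P * - (ι 5 * 1/[1+ 5 ]) + R) ιp (sym (ι-affine 4 5 a)))) refl β[1/6]≋30U (sign-odd a p/3) refl
      where
      p≡ : p ≡ 5 ℕ.+ 6 ℕ.* a
      p≡ = trans (sym eq) (l a)
        where
        l : ∀ a → 3 ℕ.+ 2 ℕ.* (1 ℕ.+ 3 ℕ.* a) ≡ 5 ℕ.+ 6 ℕ.* a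
        l = ℕRing.solve-∀
      <P : ∀ {m k} → m < 5 → k ≤ 6 → m ℕ.+ k ℕ.* a < p
      <P m<5 k≤6 = subst (_ <_) (sym p≡) (affine-< a m<5 k≤6)
      ιp : ι 5 + ι 6 * ι a ≡ ι p
      ιp = trans (sym (ι-affine 5 6 a)) (cong ι (sym p≡))
      p/3 : p div 3 ≡ suc (2 ℕ.* a)
      p/3 = trans (cong (_div 3) (trans p≡ (l a))) (div-unique 2 (suc (2 ℕ.* a)) 3 (s≤s (s≤s (s≤s z≤n))))
        where
        l : ∀ a → 5 ℕ.+ 6 ℕ.* a ≡ 2 ℕ.+ suc (2 ℕ.* a) ℕ.* 3
        l = ℕRing.solve-∀
      l₁ : ∀ a → - 1/[1+ 2 ] ≡ (ι 5 + ι 6 * a) * - (ι 2 * 1/[1+ 2 ]) + (ι 3 + ι 4 * a)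
      l₁ = solve-∀ ℚ-ring
      l₂ : ∀ a → - 1/[1+ 5 ] ≡ (ι 5 + ι 6 * a) * - (ι 5 * 1/[1+ 5 ]) + (ι 4 + ι 5 * a)
      l₂ = solve-∀ ℚ-ring
    -- p = 6a + 7: the residues are (p - 1)/3 and (p - 1)/6, with x' = -1/3 and -1/6; [p/3] = 2a + 2
    -- is even.
    helper (2mod3 a) eq =
      ΣV-at-reciprocal 2 (- 1/[1+ 2 ]) (ι 3) (2 ℕ.+ 2 ℕ.* a) (ι 6) _ (ι 14) (U q) 26 p∤3
        (int-neg int-1/3) (int-ι 3) (<P (ℕₚ.m≤m+n 3 4) (ℕₚ.m≤m+n 2 4))
        (trans (l₁ (ι a)) (cong₂ (λ P R → P * - 1/[1+ 2 ] + R) ιp (sym (ι-affine 2 2 a)))) refl β[1/3]≋6U (sign-even (suc a) p/3) refl ,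
      ΣV-at-reciprocal 5 (- 1/[1+ 5 ]) (ι 3 * 1/[1+ 1 ]) (1 ℕ.+ 1 ℕ.* a) (ι 30) _ _ (U q) 431 p∤6
        (int-neg int-1/6) (int-* (int-ι 3) int-1/2) (<P (ℕₚ.m≤m+n 2 5) (ℕₚ.m≤m+n 1 5))
        (trans (l₂ (ι a)) (cong₂ (λ P R → P * - 1/[1+ 5 ] + R) ιp (sym (ι-affine 1 1 a)))) refl β[1/6]≋30U (sign-even (suc a) p/3) refl
      where
      p≡ : p ≡ 7 ℕ.+ 6 ℕ.* a
      p≡ = trans (sym eq) (l a)
        where
        l : ∀ a → 3 ℕ.+ 2 ℕ.* (2 ℕ.+ 3 ℕ.* a) ≡ 7 ℕ.+ 6 ℕ.* a
        l = ℕRing.solve-∀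
      <P : ∀ {m k} → m < 7 → k ≤ 6 → m ℕ.+ k ℕ.* a < p
      <P m<7 k≤6 = subst (_ <_) (sym p≡) (affine-< a m<7 k≤6)
      ιp : ι 7 + ι 6 * ι a ≡ ι p
      ιp = trans (sym (ι-affine 7 6 a)) (cong ι (sym p≡))
      p/3 : p div 3 ≡ 2 ℕ.* suc a
      p/3 = trans (cong (_div 3) (trans p≡ (l a))) (div-unique 1 (2 ℕ.* suc a) 3 (s≤s (s≤s z≤n)))
        where
        l : ∀ a → 7 ℕ.+ 6 ℕ.* a ≡ 1 ℕ.+ 2 ℕ.* suc a ℕ.* 3
        l = ℕRing.solve-∀
      l₁ : ∀ a → - 1/[1+ 2 ] ≡ (ι 7 + ι 6 * a) * - 1/[1+ 2 ] + (ι 2 + ι 2 * a)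
      l₁ = solve-∀ ℚ-ring
      l₂ : ∀ a → - 1/[1+ 5 ] ≡ (ι 7 + ι 6 * a) * - 1/[1+ 5 ] + (ι 1 + ι 1 * a)
      l₂ = solve-∀ ℚ-ring

  quarters : ΣV4 ≋ pow (- 1ℚ) ((p ∸ 1) div 2) * ι p + ι 13 * pow (ι p) 3 * E q [ 4 ]
  quarters = helper (parity (proj₁ q-even)) (q≡2j refl)
    where
    helper : ∀ {j} → Parity j → 3 ℕ.+ 2 ℕ.* j ≡ p →
      ΣV4 ≋ pow (- 1ℚ) ((p ∸ 1) div 2) * ι p + ι 13 * pow (ι p) 3 * E q [ 4 ]
    -- p = 4a + 3: the residue of -1/4 is (3p - 1)/4, so x' = -3/4. In the other case p = 4a + 5, it
    -- is (p - 1)/4 and x' = -1/4.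
    helper (even a) eq =
      ΣV-at-reciprocal 3 (- (ι 3 * 1/[1+ 3 ])) (ι 2) (2 ℕ.+ 3 ℕ.* a) (ι 8) _ (ι 13) (E q) 63 p∤4
        (int-neg (int-* (int-ι 3) int-1/4)) (int-ι 2)
        (subst (2 ℕ.+ 3 ℕ.* a <_) (sym p≡) (affine-< {2} {3} {3} {4} a (s≤s (s≤s (s≤s z≤n))) (ℕₚ.m≤m+n 3 1)))
        (trans (l₁ (ι a)) (cong₂ (λ P R → P * - (ι 3 * 1/[1+ 3 ]) + R) (trans (sym (ι-affine 3 4 a)) (cong ι (sym p≡))) (sym (ι-affine 2 3 a))))
        refl β[1/4]≋8E (sign-odd a [p-1]/2) refl
      where
      p≡ : p ≡ 3 ℕ.+ 4 ℕ.* a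
      p≡ = trans (sym eq) (l a)
        where
        l : ∀ a → 3 ℕ.+ 2 ℕ.* (2 ℕ.* a) ≡ 3 ℕ.+ 4 ℕ.* a
        l = ℕRing.solve-∀
      [p-1]/2 : (p ∸ 1) div 2 ≡ suc (2 ℕ.* a)
      [p-1]/2 = trans (cong (_div 2) (trans (cong (_∸ 1) p≡) (l a))) (div-unique 0 (suc (2 ℕ.* a)) 2 (s≤s z≤n))
        where
        l : ∀ a → 2 ℕ.+ 4 ℕ.* a ≡ suc (2 ℕ.* a) ℕ.* 2
        l = ℕRing.solve-∀
      l₁ : ∀ a → - 1/[1+ 3 ] ≡ (ι 3 + ι 4 * a) * - (ι 3 * 1/[1+ 3 ]) + (ι 2 + ι 3 * a)
      l₁ = solve-∀ ℚ-ring
    helper (odd a) eq =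
      ΣV-at-reciprocal 3 (- 1/[1+ 3 ]) (ι 2) (1 ℕ.+ 1 ℕ.* a) (ι 8) _ (ι 13) (E q) 63 p∤4
        (int-neg int-1/4) (int-ι 2)
        (subst (1 ℕ.+ 1 ℕ.* a <_) (sym p≡) (affine-< {1} {1} {5} {4} a (s≤s (s≤s z≤n)) (ℕₚ.m≤m+n 1 3)))
        (trans (l₁ (ι a)) (cong₂ (λ P R → P * - 1/[1+ 3 ] + R) (trans (sym (ι-affine 5 4 a)) (cong ι (sym p≡))) (sym (ι-affine 1 1 a))))
        refl β[1/4]≋8E (sign-even (suc a) [p-1]/2) refl
      where
      p≡ : p ≡ 5 ℕ.+ 4 ℕ.* a
      p≡ = trans (sym eq) (l a)
        where
        l : ∀ a → 3 ℕ.+ 2 ℕ.* suc (2 ℕ.* a) ≡ 5 ℕ.+ 4 ℕ.* a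
        l = ℕRing.solve-∀
      [p-1]/2 : (p ∸ 1) div 2 ≡ 2 ℕ.* suc a
      [p-1]/2 = trans (cong (_div 2) (trans (cong (_∸ 1) p≡) (l a))) (div-unique 0 (2 ℕ.* suc a) 2 (s≤s z≤n))
        where
        l : ∀ a → 4 ℕ.+ 4 ℕ.* a ≡ 2 ℕ.* suc a ℕ.* 2
        l = ℕRing.solve-∀
      l₁ : ∀ a → - 1/[1+ 3 ] ≡ (ι 5 + ι 4 * a) * - 1/[1+ 3 ] + (ι 1 + ι 1 * a)
      l₁ = solve-∀ ℚ-ring

theorem4p4 : (p : ℕ) → Prime p → 3 < p →
    (x : ℚ) → InZp p x → ¬ Cong p 1 (ℕ→ℚ 2 * x + 1ℚ) 0ℚ →
    (r : ℕ) → r < p → Cong p 1 x (ℕ→ℚ r) →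
    Cong p 4 (sumTo p (λ n → V n x))
    ((1ℚ + ℕ→ℚ 2 * ((x - ℕ→ℚ r) * inv (ℕ→ℚ p))) * inv (1ℚ + ℕ→ℚ 2 * x) * ℕ→ℚ p
    + (((x - ℕ→ℚ r) * inv (ℕ→ℚ p)) * (((x - ℕ→ℚ r) * inv (ℕ→ℚ p)) + 1ℚ) + 1ℚ)
    * inv (1ℚ + ℕ→ℚ 2 * x) * pow (ℕ→ℚ p) 3 * Bpoly (p ∸ 2) (- x))
    × Cong p 4 (sumTo p (λ n → V3 n * inv (pow (ℕ→ℚ 27) n)))
    (pow (- 1ℚ) (p div 3) * ℕ→ℚ p + ℕ→ℚ 14 * pow (ℕ→ℚ p) 3 * U (p ∸ 3))
    × Cong p 4 (sumTo p (λ n → V4 n * inv (pow (ℕ→ℚ 64) n)))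
    (pow (- 1ℚ) ((p ∸ 1) div 2) * ℕ→ℚ p + ℕ→ℚ 13 * pow (ℕ→ℚ p) 3 * E (p ∸ 3))
    × Cong p 4 (sumTo p (λ n → V6 n * inv (pow (ℕ→ℚ 432) n)))
    (pow (- 1ℚ) (p div 3) * ℕ→ℚ p
    + Data.Rational._/_ (+ 155) 4 * pow (ℕ→ℚ p) 3 * U (p ∸ 3))
theorem4p4 p p-prime 3<p x x∈Zp u≇0 r r<p x≡r =
  ≋⇒Cong (subst (λ m → ΣV p x ≋ (1ℚ + ι 2 * x′) * inv (1ℚ + ι 2 * x) * ι p + (x′ * (x′ + 1ℚ) + 1ℚ) * inv (1ℚ + ι 2 * x) * pow (ι p) 3 * Bpoly m (- x) [ 4 ])
    (cong (_∸ 2) 3+q≡p) (ΣV≋ x x∈Zp u≇0 r r<p x≡r)) ,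
  ≋⇒Cong (proj₁ thirds-sixths) , ≋⇒Cong quarters , ≋⇒Cong (proj₂ thirds-sixths)
  where
  3+q≡p : 3 ℕ.+ (p ∸ 3) ≡ p
  3+q≡p = ℕₚ.m+[n∸m]≡n (ℕₚ.<⇒≤ 3<p)
  open Congruences p p-prime
  open Consequences p (p ∸ 3) p-prime (ℕₚ.m<n⇒0<n∸m 3<p) 3+q≡p
  x′ : ℚ
  x′ = (x - ι r) * inv (ι p)
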